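{- Let $q$ be a power of a prime $p\ge 3$. The product $m:\mathbf{SC}^D\otimes\mathbf{SC}^D\to\mathbf{SC}^D$ and the coproduct $\Delta:\mathbf{SC}^D\to\mathbf{SC}^D\otimes\mathbf{SC}^D$ that are given in the $P$-basis, by (bi)linear extension, by $$P_{\mu}\cdot P_{\nu}=P_{\mu\sqcup\nu\uparrow^{k}}\qquad(k,l\ge 0,\ \mu\in D_{2k}(q),\ \nu\in D_{2l}(q)),$$ $$\Delta(P_{\lambda})=\sum_{\substack{A\subseteq[n]\\ \lambda=\lambda|_A\sqcup\lambda|_{A^c}}}P_{\mathrm{st}_A(\lambda|_A)}\otimes P_{\mathrm{st}_{A^c}(\lambda|_{A^c})}\qquad(n\ge 0,\ \lambda\in D_{2n}(q)),$$ endow the complex vector space $\mathbf{SC}^D=\bigoplus_{n\ge 0}\mathbf{SC}^D_{2n}$ with a Hopf algebra structure (with unit $\kappa_\emptyset\in\mathbf{SC}^D_0$ and counit $\epsilon$ described in the context).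
   Context: Let $\mathbb F_q$ be a finite field of order $q=p^r$ with $p\ge 3$, and $\mathbb F_q^*$ its nonzero elements. For $n\ge 0$ write $[n]=\{1,\dots,n\}$ and $[\pm n]=\{\pm1,\dots,\pm n\}$, totally ordered by $1\prec\cdots\prec n\prec -n\prec\cdots\prec -1$; rows and columns of $2n\times 2n$ matrices are indexed by $[\pm n]$ in this order. Let $U_{m}(q)$ be the group of unipotent upper triangular $m\times m$ matrices over $\mathbb F_q$. Let $J$ be the $n\times n$ matrix with ones on the antidiagonal and zeros elsewhere. The type $D$ unipotent group is $$U^D_{2n}(q)=\left\{\begin{pmatrix}P&PQ\\0&JP^{ -t}J\end{pmatrix}: P\in U_n(q),\ Q\in M_n(q),\ JQ^tJ=-Q\right\}\subseteq U_{2n}(q),$$ where $M_n(q)$ is the set of $n\times n$ matrices over $\mathbb F_q$. Labelled $D$-partitions. A $D_{2n}(q)$-partition $\lambda$ of $[\pm n]$ is a set of labelled arcs $(i,j,a)$ with $i,j\in[\pm n]$, $i\prec j$, $j\ne -i$, $a\in\mathbb F_q^*$ (at most one label for each pair $(i,j)$), such that: (a) if $(i,j,a)\in\lambda$ then $(-j,-i,-a)\in\lambda$; (b) if $(i,j,a)\in\lambda$ and $i\prec k\prec j$, then no arc $(i,k,b)$ and no arc $(k,j,b)$ belongs to $\lambda$. Write $\lambda\in D_{2n}(q)$; the set $D_0(q)$ has the single element $\emptyset$ (empty ground set). The ground set $[\pm n]$ is part of the data. Let $\mathcal A(\lambda)$ denote the set of labelled arcs of $\lambda$. Superclass functions. For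 $\lambda\in D_{2n}(q)$ put $y_\lambda=\sum_{(i,j,a)\in\lambda}a\,e_{i,j}$, where $e_{i,j}$ is the matrix unit, $V_\lambda=U_{2n}(q)\,y_\lambda\,U_{2n}(q)$, and let $K_\lambda=U^D_{2n}(q)\cap(V_\lambda+I_{2n})$ be the superclass of $\lambda$. The sets $K_\lambda$, $\lambda\in D_{2n}(q)$, partition $U^D_{2n}(q)$ into nonempty, pairwise distinct pieces (known result of André and Neto). $\mathbf{SC}^D_{2n}$ is the complex vector space of functions $U^D_{2n}(q)\to\mathbb C$ constant on superclasses, with basis $\{\kappa_\lambda\}_{\lambda\in D_{2n}(q)}$, $\kappa_\lambda$ being the indicator function of $K_\lambda$; $\mathbf{SC}^D_0=\mathbb C$. Put $\mathbf{SC}^D=\bigoplus_{n\ge0}\mathbf{SC}^D_{2n}$. $P$-basis. For $\lambda,\mu\in D_{2n}(q)$ write $\lambda\le\mu$ if $\mathcal A(\lambda)\subseteq\mathcal A(\mu)$, and set $P_\lambda=\sum_{\mu\ge\lambda}\kappa_\mu$ (sum over $\mu\in D_{2n}(q)$). Then $\{P_\lambda\}_{\lambda\in D_{2n}(q),\,n\ge 0}$ is a basis of $\mathbf{SC}^D$. Shift. For $\nu\in D_{2l}(q)$ and $k\ge0$, $\nu\uparrow^k$ is the set of arcs on the ground set $\{\pm(k+1),\dots,\pm(k+l)\}$ obtained from $\nu$ by relabelling $i\mapsto k+i$ and $-i\mapsto -(k+i)$ for $1\le i\le l$, keeping arc labels. For $\mu\in D_{2k}(q)$, $\mu\sqcup\nu\uparrow^k\in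 D_{2(k+l)}(q)$ is the $D$-partition of $[\pm(k+l)]$ whose set of arcs is the union of those of $\mu$ and of $\nu\uparrow^k$. Restriction and standardization. For $A\subseteq[n]$ let $A^c=[n]\setminus A$ and $[\pm A]=A\cup(-A)$. For $\lambda\in D_{2n}(q)$, $\lambda|_A$ has ground set $[\pm A]$ and consists of all arcs of $\lambda$ with both endpoints in $[\pm A]$. Write $\lambda=\lambda|_A\sqcup\lambda|_{A^c}$ when $\mathcal A(\lambda)=\mathcal A(\lambda|_A)\cup\mathcal A(\lambda|_{A^c})$. Let $\mathrm{st}_A:[\pm A]\to[\pm|A|]$ be the unique order-preserving bijection; $\mathrm{st}_A(\lambda|_A)\in D_{2|A|}(q)$ is obtained from $\lambda|_A$ by relabelling endpoints via $\mathrm{st}_A$. Unit and counit. The unit is $\kappa_\emptyset=P_\emptyset$, $\emptyset\in D_0(q)$; the counit $\epsilon:\mathbf{SC}^D\to\mathbb C$ takes the coefficient of this $\kappa_\emptyset\in\mathbf{SC}^D_0$. A Hopf algebra is a bialgebra (the coproduct and counit are algebra homomorphisms) with an antipode $S$, i.e. a linear map $S$ with $\sum_k S(a_k)b_k=\epsilon(a)1=\sum_k a_kS(b_k)$ whenever $\Delta(a)=\sum_k a_k\otimes b_k$. -}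

module Defs where

open import Algebra.Bundles using (CommutativeRing; CommutativeMonoid)
open import Algebra.Module.Bundles using (LeftModule)
import Algebra.Module.Construct.TensorUnit as TensorUnit
open import Algebra.Module.Morphism.Structures using (module LeftModuleMorphisms)
import Algebra.Properties.CommutativeSemigroup as CommutativeSemigroupProperties
import Algebra.Properties.Group as GroupProperties
import Algebra.Properties.Ring as RingProperties
import Algebra.Properties.Semiring.Sum as SemiringSum
open import Algebra.Structures using (IsCommutativeRing)
import Data.Bool.Base as Bool
open import Data.Fin.Base as Fin using (Fin; zero; suc; opposite; _↑ˡ_; _↑ʳ_)
import Data.Fin.Induction as Fin
import Data.Fin.Properties as Fin
open import Data.Fin.Subset using (Subset; inside; outside; ∁) renaming (_∈_ to _∈ˢ_; ∣_∣ to card)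
open import Data.Fin.Subset.Properties using () renaming (_∈?_ to _∈ˢ?_)
open import Data.List.Base
  using (List; []; _∷_; [_]; _++_; map; filter; foldr; allFin; cartesianProductWith; mapMaybe)
open import Data.List.Membership.Propositional using (_∈_)
open import Data.List.Membership.Propositional.Properties using (∈-map⁺; ∈-allFin)
open import Data.List.Relation.Unary.Any using (Any; here)
import Data.List.Relation.Unary.Any as Any
import Data.List.Relation.Unary.Any.Properties as Any
open import Data.Maybe.Base as Maybe using (Maybe)
open import Data.Nat.Base as ℕ using (ℕ)
import Data.Nat.Properties as ℕ
open import Data.Product.Base using (∃; ∃-syntax; _×_; _,_; proj₁; proj₂)
open import Data.Sum.Base as Sum using (_⊎_; inj₁; inj₂)
open import Data.Vec.Base using () renaming ([] to []ᵛ; _∷_ to _∷ᵛ_)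
open import Data.Vec.Functional as Vector using ()
open import Function.Base using (_∘_)
open import Function.Bundles using (_↔_; Inverse)
open import Function.Properties.Inverse using (↔⇒↣; ↔-sym)
open import Induction.WellFounded using (WellFounded; Acc; acc)
open import Level using (0ℓ)
open import Relation.Binary.Definitions using (DecidableEquality; tri<; tri≈; tri>)
open import Relation.Binary.PropositionalEquality
  using (_≡_; _≢_; refl; sym; trans; cong; cong₂; subst; subst₂; module ≡-Reasoning)
open import Relation.Nullary using (Dec; yes; no; does; ¬_; contradiction; ¬?)
open import Relation.Nullary.Decidable
  using (map′; _×-dec_; _→-dec_; _⊎-dec_; dec⇒maybe; via-injection; decidable-stable)

-- ℝ is the setoid of Cauchy sequences of rationals modulo null sequences.
module Complex where

  open import Data.Rational.Base
    using (ℚ; 0ℚ; 1ℚ; ½; _+_; _*_; _-_; -_; _≤_; _<_; ∣_∣; 1/_; Positive; positive; nonNegative)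
  import Data.Rational.Properties as ℚ
  open import Data.Rational.Solver using (module +-*-Solver)
  open +-*-Solver using (solve; _:=_; _:+_; _:*_; _:-_; :-_; con)

  record ℝ : Set where
    field
      seq    : ℕ → ℚ
      cauchy : ∀ ε → 0ℚ < ε →
               ∃[ N ] ∀ m n → N ℕ.≤ m → N ℕ.≤ n → ∣ seq m - seq n ∣ < ε

  open ℝ public

  infix 4 _≈ʳ_

  _≈ʳ_ : ℝ → ℝ → Set
  x ≈ʳ y = ∀ ε → 0ℚ < ε → ∃[ N ] ∀ n → N ℕ.≤ n → ∣ seq x n - seq y n ∣ < ε

  Null : (ℕ → ℕ → ℚ) → Set
  Null f = ∀ ε → 0ℚ < ε → ∃[ N ] ∀ m n → N ℕ.≤ m → N ℕ.≤ n → ∣ f m n ∣ < ε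

  Bounded : (ℕ → ℕ → ℚ) → Set
  Bounded f = ∃[ B ] Positive B × ∃[ N ] ∀ m n → N ℕ.≤ m → N ℕ.≤ n → ∣ f m n ∣ ≤ B

  diff : ℝ → ℝ → ℕ → ℕ → ℚ
  diff x y n _ = seq x n - seq y n

  ≈ʳ⇒null : ∀ {x y} → x ≈ʳ y → Null (diff x y)
  ≈ʳ⇒null p ε 0<ε with p ε 0<ε
  ... | N , h = N , λ m n N≤m _ → h m N≤m

  null⇒≈ʳ : ∀ {x y} → Null (diff x y) → x ≈ʳ y
  null⇒≈ʳ p ε 0<ε with p ε 0<ε
  ... | N , h = N , λ n N≤n → h n n N≤n N≤n

  null-cong : ∀ {f g} → (∀ m n → f m n ≡ g m n) → Null f → Null g
  null-cong e p ε 0<ε with p ε 0<ε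
  ... | N , h = N , λ m n a b → subst (λ z → ∣ z ∣ < ε) (e m n) (h m n a b)

  null-0 : Null (λ _ _ → 0ℚ)
  null-0 ε 0<ε = 0 , λ _ _ _ _ → 0<ε

  half-pos : ∀ {ε} → 0ℚ < ε → 0ℚ < ½ * ε
  half-pos {ε} 0<ε = subst (_< ½ * ε) (ℚ.*-zeroʳ ½) (ℚ.*-monoʳ-<-pos ½ 0<ε)

  half+half : ∀ ε → ½ * ε + ½ * ε ≡ ε
  half+half ε = trans (sym (ℚ.*-distribʳ-+ ε ½ ½)) (ℚ.*-identityˡ ε)

  null-+ : ∀ {f g} → Null f → Null g → Null (λ m n → f m n + g m n)
  null-+ {f} {g} p q ε 0<ε with p (½ * ε) (half-pos 0<ε) | q (½ * ε) (half-pos 0<ε)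
  ... | M , h | N , k = M ℕ.⊔ N , λ m n a b →
    ℚ.≤-<-trans (ℚ.∣p+q∣≤∣p∣+∣q∣ (f m n) (g m n))
      (subst (∣ f m n ∣ + ∣ g m n ∣ <_) (half+half ε)
        (ℚ.+-mono-< (h m n (ℕ.m⊔n≤o⇒m≤o M N a) (ℕ.m⊔n≤o⇒m≤o M N b))
                    (k m n (ℕ.m⊔n≤o⇒n≤o M N a) (ℕ.m⊔n≤o⇒n≤o M N b))))

  null-neg : ∀ {f} → Null f → Null (λ m n → - f m n)
  null-neg {f} p ε 0<ε with p ε 0<ε
  ... | N , h = N , λ m n a b → subst (_< ε) (sym (ℚ.∣-p∣≡∣p∣ (f m n))) (h m n a b)

  divide : ∀ B → Positive B → ∀ ε → 0ℚ < ε → ∃[ δ ] 0ℚ < δ × B * δ ≡ ε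
  divide B B>0 ε 0<ε = 1/B * ε , 0<δ , eq
    where
    instance
      _ = B>0
      _ = ℚ.pos⇒nonZero B
    1/B = 1/ B
    instance
      _ : Positive (1/ B)
      _ = ℚ.1/pos⇒pos B
    0<δ : 0ℚ < 1/B * ε
    0<δ = subst (_< 1/B * ε) (ℚ.*-zeroʳ 1/B) (ℚ.*-monoʳ-<-pos 1/B 0<ε)
    eq : B * (1/B * ε) ≡ ε
    eq = trans (sym (ℚ.*-assoc B 1/B ε))
               (trans (cong (_* ε) (ℚ.*-inverseʳ B)) (ℚ.*-identityˡ ε))

  null-* : ∀ {b f} → Bounded b → Null f → Null (λ m n → b m n * f m n)
  null-* {b} {f} (B , B>0 , M , h) p ε 0<ε with divide B B>0 ε 0<ε
  ... | δ , 0<δ , Bδ≡ε with p δ 0<δ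
  ... | N , k = M ℕ.⊔ N , λ m n u v →
    let bnd = h m n (ℕ.m⊔n≤o⇒m≤o M N u) (ℕ.m⊔n≤o⇒m≤o M N v)
        sml = k m n (ℕ.m⊔n≤o⇒n≤o M N u) (ℕ.m⊔n≤o⇒n≤o M N v)
        instance
          nn = nonNegative (ℚ.0≤∣p∣ (f m n))
          ps = B>0
    in subst (_< ε) (sym (ℚ.∣p*q∣≡∣p∣*∣q∣ (b m n) (f m n)))
         (ℚ.≤-<-trans (ℚ.*-monoʳ-≤-nonNeg ∣ f m n ∣ bnd)
           (subst (B * ∣ f m n ∣ <_) Bδ≡ε (ℚ.*-monoʳ-<-pos B sml)))

  cauchy-bounded : ∀ x → Bounded (λ m _ → seq x m)
  cauchy-bounded x with cauchy x 1ℚ (ℚ.positive⁻¹ 1ℚ)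
  ... | N , h = ∣ seq x N ∣ + 1ℚ , positive 0<B , N , λ m _ a _ → le m a
    where
    0<B : 0ℚ < ∣ seq x N ∣ + 1ℚ
    0<B = ℚ.+-mono-≤-< (ℚ.0≤∣p∣ (seq x N)) (ℚ.positive⁻¹ 1ℚ)
    le : ∀ m → N ℕ.≤ m → ∣ seq x m ∣ ≤ ∣ seq x N ∣ + 1ℚ
    le m a = subst (λ z → ∣ z ∣ ≤ ∣ seq x N ∣ + 1ℚ)
      (solve 2 (λ u v → u :+ (v :- u) := v) refl (seq x N) (seq x m))
      (ℚ.≤-trans (ℚ.∣p+q∣≤∣p∣+∣q∣ (seq x N) (seq x m - seq x N))
        (ℚ.+-monoʳ-≤ ∣ seq x N ∣ (ℚ.<⇒≤ (h m N a ℕ.≤-refl))))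

  bounded-swap : ∀ {f} → Bounded f → Bounded (λ m n → f n m)
  bounded-swap (B , B>0 , N , h) = B , B>0 , N , λ m n a b → h n m b a

  constʳ : ℚ → ℝ
  constʳ c = record
    { seq = λ _ → c
    ; cauchy = null-cong (λ _ _ → sym (ℚ.+-inverseʳ c)) null-0 }

  0ʳ 1ʳ : ℝ
  0ʳ = constʳ 0ℚ
  1ʳ = constʳ 1ℚ

  infixl 6 _+ʳ_
  infixl 7 _*ʳ_

  _+ʳ_ : ℝ → ℝ → ℝ
  x +ʳ y = record
    { seq = λ n → seq x n + seq y n
    ; cauchy = null-cong
        (λ m n → solve 4 (λ a b c d → (a :- c) :+ (b :- d) := (a :+ b) :- (c :+ d)) refl
                   (seq x m) (seq y m) (seq x n) (seq y n))
        (null-+ (cauchy x) (cauchy y)) }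

  -ʳ_ : ℝ → ℝ
  -ʳ x = record
    { seq = λ n → - seq x n
    ; cauchy = null-cong
        (λ m n → solve 2 (λ a c → :- (a :- c) := :- a :- :- c) refl (seq x m) (seq x n))
        (null-neg (cauchy x)) }

  _*ʳ_ : ℝ → ℝ → ℝ
  x *ʳ y = record
    { seq = λ n → seq x n * seq y n
    ; cauchy = null-cong
        (λ m n → solve 4 (λ a b c d → a :* (b :- d) :+ d :* (a :- c) := a :* b :- c :* d) refl
                   (seq x m) (seq y m) (seq x n) (seq y n))
        (null-+ (null-* (cauchy-bounded x) (cauchy y))
                (null-* (bounded-swap (cauchy-bounded y)) (cauchy x))) }

  ≗⇒≈ʳ : ∀ {x y} → (∀ n → seq x n ≡ seq y n) → x ≈ʳ y
  ≗⇒≈ʳ {x} {y} e = null⇒≈ʳ {x} {y}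
    (null-cong (λ m _ → trans (sym (ℚ.+-inverseʳ (seq y m))) (cong (_- seq y m) (sym (e m)))) null-0)

  ≈ʳ-refl : ∀ {x} → x ≈ʳ x
  ≈ʳ-refl {x} = ≗⇒≈ʳ {x} {x} (λ _ → refl)

  ≈ʳ-sym : ∀ {x y} → x ≈ʳ y → y ≈ʳ x
  ≈ʳ-sym {x} {y} p = null⇒≈ʳ {y} {x} (null-cong
    (λ m _ → solve 2 (λ a b → :- (a :- b) := b :- a) refl (seq x m) (seq y m))
    (null-neg (≈ʳ⇒null {x} {y} p)))

  ≈ʳ-trans : ∀ {x y z} → x ≈ʳ y → y ≈ʳ z → x ≈ʳ z
  ≈ʳ-trans {x} {y} {z} p q = null⇒≈ʳ {x} {z} (null-cong
    (λ m _ → solve 3 (λ a b c → (a :- b) :+ (b :- c) := a :- c) refl (seq x m) (seq y m) (seq z m))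
    (null-+ (≈ʳ⇒null {x} {y} p) (≈ʳ⇒null {y} {z} q)))

  +ʳ-cong : ∀ {x y u v} → x ≈ʳ y → u ≈ʳ v → x +ʳ u ≈ʳ y +ʳ v
  +ʳ-cong {x} {y} {u} {v} p q = null⇒≈ʳ {x +ʳ u} {y +ʳ v} (null-cong
    (λ m _ → solve 4 (λ a b c d → (a :- b) :+ (c :- d) := (a :+ c) :- (b :+ d)) refl
               (seq x m) (seq y m) (seq u m) (seq v m))
    (null-+ (≈ʳ⇒null {x} {y} p) (≈ʳ⇒null {u} {v} q)))

  -ʳ-cong : ∀ {x y} → x ≈ʳ y → -ʳ x ≈ʳ -ʳ y
  -ʳ-cong {x} {y} p = null⇒≈ʳ { -ʳ x} { -ʳ y} (null-cong
    (λ m _ → solve 2 (λ a b → :- (a :- b) := :- a :- :- b) refl (seq x m) (seq y m))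
    (null-neg (≈ʳ⇒null {x} {y} p)))

  *ʳ-cong : ∀ {x y u v} → x ≈ʳ y → u ≈ʳ v → x *ʳ u ≈ʳ y *ʳ v
  *ʳ-cong {x} {y} {u} {v} p q = null⇒≈ʳ {x *ʳ u} {y *ʳ v} (null-cong
    (λ m _ → solve 4 (λ a b c d → a :* (c :- d) :+ d :* (a :- b) := a :* c :- b :* d) refl
               (seq x m) (seq y m) (seq u m) (seq v m))
    (null-+ (null-* (cauchy-bounded x) (≈ʳ⇒null {u} {v} q))
            (null-* (cauchy-bounded v) (≈ʳ⇒null {x} {y} p))))

  record ℂ : Set where
    constructor _+i_
    field
      re im : ℝ

  open ℂ public

  infix 4 _≈ᶜ_

  _≈ᶜ_ : ℂ → ℂ → Set
  z ≈ᶜ w = re z ≈ʳ re w × im z ≈ʳ im w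

  0ᶜ 1ᶜ : ℂ
  0ᶜ = 0ʳ +i 0ʳ
  1ᶜ = 1ʳ +i 0ʳ

  infixl 6 _+ᶜ_
  infixl 7 _*ᶜ_

  _+ᶜ_ _*ᶜ_ : ℂ → ℂ → ℂ
  (a +i b) +ᶜ (c +i d) = (a +ʳ c) +i (b +ʳ d)
  (a +i b) *ᶜ (c +i d) = ((a *ʳ c) +ʳ (-ʳ (b *ʳ d))) +i ((a *ʳ d) +ʳ (b *ʳ c))

  -ᶜ_ : ℂ → ℂ
  -ᶜ (a +i b) = (-ʳ a) +i (-ʳ b)

  ≗⇒≈ᶜ : ∀ {z w} → (∀ n → seq (re z) n ≡ seq (re w) n) →
         (∀ n → seq (im z) n ≡ seq (im w) n) → z ≈ᶜ w
  ≗⇒≈ᶜ {z} {w} e f = ≗⇒≈ʳ {re z} {re w} e , ≗⇒≈ʳ {im z} {im w} f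

  *ᶜ-cong : ∀ {x y u v} → x ≈ᶜ y → u ≈ᶜ v → x *ᶜ u ≈ᶜ y *ᶜ v
  *ᶜ-cong {a +i b} {a′ +i b′} {c +i d} {c′ +i d′} (p , q) (r , s) =
    +ʳ-cong {a *ʳ c} {a′ *ʳ c′} { -ʳ (b *ʳ d)} { -ʳ (b′ *ʳ d′)}
      (*ʳ-cong {a} {a′} {c} {c′} p r)
      (-ʳ-cong {b *ʳ d} {b′ *ʳ d′} (*ʳ-cong {b} {b′} {d} {d′} q s)) ,
    +ʳ-cong {a *ʳ d} {a′ *ʳ d′} {b *ʳ c} {b′ *ʳ c′}
      (*ʳ-cong {a} {a′} {d} {d′} p s)
      (*ʳ-cong {b} {b′} {c} {c′} q r)

  *ᶜ-assoc : ∀ x y z → (x *ᶜ y) *ᶜ z ≈ᶜ x *ᶜ (y *ᶜ z)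
  *ᶜ-assoc x@(a +i b) y@(c +i d) z@(e +i f) = ≗⇒≈ᶜ {(x *ᶜ y) *ᶜ z} {x *ᶜ (y *ᶜ z)}
    (λ n → solve 6 (λ a b c d e f →
        (a :* c :+ :- (b :* d)) :* e :+ :- ((a :* d :+ b :* c) :* f) :=
        a :* (c :* e :+ :- (d :* f)) :+ :- (b :* (c :* f :+ d :* e))) refl
      (seq a n) (seq b n) (seq c n) (seq d n) (seq e n) (seq f n))
    (λ n → solve 6 (λ a b c d e f →
        (a :* c :+ :- (b :* d)) :* f :+ (a :* d :+ b :* c) :* e :=
        a :* (c :* f :+ d :* e) :+ b :* (c :* e :+ :- (d :* f))) refl
      (seq a n) (seq b n) (seq c n) (seq d n) (seq e n) (seq f n))

  *ᶜ-comm : ∀ x y → x *ᶜ y ≈ᶜ y *ᶜ x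
  *ᶜ-comm x@(a +i b) y@(c +i d) = ≗⇒≈ᶜ {x *ᶜ y} {y *ᶜ x}
    (λ n → solve 4 (λ a b c d → a :* c :+ :- (b :* d) := c :* a :+ :- (d :* b)) refl
      (seq a n) (seq b n) (seq c n) (seq d n))
    (λ n → solve 4 (λ a b c d → a :* d :+ b :* c := c :* b :+ d :* a) refl
      (seq a n) (seq b n) (seq c n) (seq d n))

  *ᶜ-identityˡ : ∀ x → 1ᶜ *ᶜ x ≈ᶜ x
  *ᶜ-identityˡ x@(a +i b) = ≗⇒≈ᶜ {1ᶜ *ᶜ x} {x}
    (λ n → solve 2 (λ a b → con 1ℚ :* a :+ :- (con 0ℚ :* b) := a) refl (seq a n) (seq b n))
    (λ n → solve 2 (λ a b → con 1ℚ :* b :+ con 0ℚ :* a := b) refl (seq a n) (seq b n))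

  *ᶜ-distribˡ : ∀ x y z → x *ᶜ (y +ᶜ z) ≈ᶜ x *ᶜ y +ᶜ x *ᶜ z
  *ᶜ-distribˡ x@(a +i b) y@(c +i d) z@(e +i f) =
    ≗⇒≈ᶜ {x *ᶜ (y +ᶜ z)} {x *ᶜ y +ᶜ x *ᶜ z}
    (λ n → solve 6 (λ a b c d e f →
        a :* (c :+ e) :+ :- (b :* (d :+ f)) :=
        (a :* c :+ :- (b :* d)) :+ (a :* e :+ :- (b :* f))) refl
      (seq a n) (seq b n) (seq c n) (seq d n) (seq e n) (seq f n))
    (λ n → solve 6 (λ a b c d e f →
        a :* (d :+ f) :+ b :* (c :+ e) :=
        (a :* d :+ b :* c) :+ (a :* f :+ b :* e)) refl
      (seq a n) (seq b n) (seq c n) (seq d n) (seq e n) (seq f n))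

  ≈ᶜ-trans : ∀ {x y z} → x ≈ᶜ y → y ≈ᶜ z → x ≈ᶜ z
  ≈ᶜ-trans {a +i b} {c +i d} {e +i f} (p , q) (r , s) =
    ≈ʳ-trans {a} {c} {e} p r , ≈ʳ-trans {b} {d} {f} q s

  +ᶜ-comm : ∀ x y → x +ᶜ y ≈ᶜ y +ᶜ x
  +ᶜ-comm x y = ≗⇒≈ᶜ {x +ᶜ y} {y +ᶜ x}
    (λ n → ℚ.+-comm (seq (re x) n) (seq (re y) n))
    (λ n → ℚ.+-comm (seq (im x) n) (seq (im y) n))

  +ᶜ-identityˡ : ∀ x → 0ᶜ +ᶜ x ≈ᶜ x
  +ᶜ-identityˡ x = ≗⇒≈ᶜ {0ᶜ +ᶜ x} {x}
    (λ n → ℚ.+-identityˡ (seq (re x) n)) (λ n → ℚ.+-identityˡ (seq (im x) n))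

  +ᶜ-inverseˡ : ∀ x → (-ᶜ x) +ᶜ x ≈ᶜ 0ᶜ
  +ᶜ-inverseˡ x = ≗⇒≈ᶜ {(-ᶜ x) +ᶜ x} {0ᶜ}
    (λ n → ℚ.+-inverseˡ (seq (re x) n)) (λ n → ℚ.+-inverseˡ (seq (im x) n))

  ℂ-ring : CommutativeRing 0ℓ 0ℓ
  ℂ-ring = record
    { Carrier = ℂ ; _≈_ = _≈ᶜ_ ; _+_ = _+ᶜ_ ; _*_ = _*ᶜ_ ; -_ = -ᶜ_ ; 0# = 0ᶜ ; 1# = 1ᶜ
    ; isCommutativeRing = record
      { isRing = record
        { +-isAbelianGroup = record
          { isGroup = record
            { isMonoid = record
              { isSemigroup = record
                { isMagma = record
                  { isEquivalence = record
                    { refl = λ {x} → ≈ʳ-refl {re x} , ≈ʳ-refl {im x}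
                    ; sym = λ {x} {y} (p , q) →
                        ≈ʳ-sym {re x} {re y} p , ≈ʳ-sym {im x} {im y} q
                    ; trans = λ {x} {y} {z} → ≈ᶜ-trans {x} {y} {z}
                    }
                  ; ∙-cong = λ {x} {y} {u} {v} (p , q) (r , s) →
                      +ʳ-cong {re x} {re y} {re u} {re v} p r ,
                      +ʳ-cong {im x} {im y} {im u} {im v} q s
                  }
                ; assoc = λ x y z → ≗⇒≈ᶜ {(x +ᶜ y) +ᶜ z} {x +ᶜ (y +ᶜ z)}
                    (λ n → ℚ.+-assoc (seq (re x) n) (seq (re y) n) (seq (re z) n))
                    (λ n → ℚ.+-assoc (seq (im x) n) (seq (im y) n) (seq (im z) n))
                }
              ; identity = +ᶜ-identityˡ , λ x →
                  ≈ᶜ-trans {x +ᶜ 0ᶜ} {0ᶜ +ᶜ x} {x} (+ᶜ-comm x 0ᶜ) (+ᶜ-identityˡ x)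
              }
            ; inverse = +ᶜ-inverseˡ , λ x →
                ≈ᶜ-trans {x +ᶜ (-ᶜ x)} {(-ᶜ x) +ᶜ x} {0ᶜ} (+ᶜ-comm x (-ᶜ x)) (+ᶜ-inverseˡ x)
            ; ⁻¹-cong = λ {x} {y} (p , q) →
                -ʳ-cong {re x} {re y} p , -ʳ-cong {im x} {im y} q
            }
          ; comm = +ᶜ-comm
          }
        ; *-cong = λ {x} {y} {u} {v} → *ᶜ-cong {x} {y} {u} {v}
        ; *-assoc = *ᶜ-assoc
        ; *-identity = *ᶜ-identityˡ , λ x →
            ≈ᶜ-trans {x *ᶜ 1ᶜ} {1ᶜ *ᶜ x} {x} (*ᶜ-comm x 1ᶜ) (*ᶜ-identityˡ x)
        ; distrib = *ᶜ-distribˡ , λ x y z →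
            ≈ᶜ-trans {(y +ᶜ z) *ᶜ x} {x *ᶜ (y +ᶜ z)} {y *ᶜ x +ᶜ z *ᶜ x}
              (*ᶜ-comm (y +ᶜ z) x)
              (≈ᶜ-trans {x *ᶜ (y +ᶜ z)} {x *ᶜ y +ᶜ x *ᶜ z} {y *ᶜ x +ᶜ z *ᶜ x}
                (*ᶜ-distribˡ x y z)
                (+ʳ-cong {re (x *ᶜ y)} {re (y *ᶜ x)} {re (x *ᶜ z)} {re (z *ᶜ x)}
                   (proj₁ (*ᶜ-comm x y)) (proj₁ (*ᶜ-comm x z)) ,
                 +ʳ-cong {im (x *ᶜ y)} {im (y *ᶜ x)} {im (x *ᶜ z)} {im (z *ᶜ x)}
                   (proj₂ (*ᶜ-comm x y)) (proj₂ (*ᶜ-comm x z))))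
        }
      ; *-comm = *ᶜ-comm
      }
    }

module Linear (R : CommutativeRing 0ℓ 0ℓ) where

  open CommutativeRing R
    using (ring; _*_; _+_; -_; 0#; 1#) renaming (Carrier to K; _≈_ to _≈ₖ_)
  private module R = CommutativeRing R

  Mod : Set₁
  Mod = LeftModule ring 0ℓ 0ℓ

  ∣_∣ : Mod → Set
  ∣ M ∣ = LeftModule.Carrierᴹ M

  infix 4 Eq
  Eq : (M : Mod) → ∣ M ∣ → ∣ M ∣ → Set
  Eq M = LeftModule._≈ᴹ_ M

  syntax Eq M x y = x ≈[ M ] y

  𝕂 : Mod
  𝕂 = TensorUnit.leftModule {R = ring}

  infix 3 _⟶_

  record _⟶_ (M N : Mod) : Set where
    open LeftModuleMorphisms (LeftModule.rawLeftModule M) (LeftModule.rawLeftModule N)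
    field
      fun   : ∣ M ∣ → ∣ N ∣
      isHom : IsLeftModuleHomomorphism fun
    open IsLeftModuleHomomorphism isHom public

  infixr 5 _$_
  _$_ : ∀ {M N} → (M ⟶ N) → ∣ M ∣ → ∣ N ∣
  _$_ = _⟶_.fun

  linear : ∀ {M N} → let open LeftModule in
           (f : ∣ M ∣ → ∣ N ∣) →
           (∀ {x y} → x ≈[ M ] y → f x ≈[ N ] f y) →
           (∀ x y → f (_+ᴹ_ M x y) ≈[ N ] _+ᴹ_ N (f x) (f y)) →
           (∀ r x → f (_*ₗ_ M r x) ≈[ N ] _*ₗ_ N r (f x)) →
           M ⟶ N
  linear {M} {N} f f-cong f-+ f-* = record
    { fun = f
    ; isHom = record
      { +ᴹ-isGroupHomomorphism = record
        { isMonoidHomomorphism = record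
          { isMagmaHomomorphism = record
            { isRelHomomorphism = record { cong = f-cong }
            ; homo = f-+
            }
          ; ε-homo = f-0
          }
        ; ⁻¹-homo = λ x → GP.inverseˡ-unique (f (M.-ᴹ x)) (f x)
            (N.≈ᴹ-trans (N.≈ᴹ-sym (f-+ (M.-ᴹ x) x))
              (N.≈ᴹ-trans (f-cong (M.-ᴹ‿inverseˡ x)) f-0))
        }
      ; *ₗ-homo = f-*
      }
    }
    where
    module M = LeftModule M
    module N = LeftModule N
    module GP = GroupProperties N.+ᴹ-group
    f-0 : f M.0ᴹ N.≈ᴹ N.0ᴹ
    f-0 = N.≈ᴹ-trans (f-cong (M.≈ᴹ-sym (M.*ₗ-zeroˡ M.0ᴹ)))
            (N.≈ᴹ-trans (f-* 0# M.0ᴹ) (N.*ₗ-zeroˡ (f M.0ᴹ)))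

  idᴸ : ∀ {M} → M ⟶ M
  idᴸ {M} = linear {M} {M} (λ x → x) (λ e → e) (λ _ _ → ≈ᴹ-refl) (λ _ _ → ≈ᴹ-refl)
    where open LeftModule M

  _⟶≈_ : ∀ {M N} → (M ⟶ N) → (M ⟶ N) → Set
  _⟶≈_ {M} {N} f g = ∀ x → (f $ x) ≈[ N ] (g $ x)

  Hom : Mod → Mod → Mod
  Hom M N = record
    { Carrierᴹ = M ⟶ N
    ; _≈ᴹ_ = _⟶≈_
    ; _+ᴹ_ = add
    ; _*ₗ_ = scale
    ; 0ᴹ = linear {M} {N} (λ _ → N.0ᴹ) (λ _ → N.≈ᴹ-refl)
        (λ _ _ → N.≈ᴹ-sym (N.+ᴹ-identityˡ N.0ᴹ)) (λ r _ → N.≈ᴹ-sym (N.*ₗ-zeroʳ r))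
    ; -ᴹ_ = λ f → scale (- 1#) f
    ; isLeftModule = record
      { isLeftSemimodule = record
        { +ᴹ-isCommutativeMonoid = record
          { isMonoid = record
            { isSemigroup = record
              { isMagma = record
                { isEquivalence = record
                  { refl = λ _ → N.≈ᴹ-refl
                  ; sym = λ e x → N.≈ᴹ-sym (e x)
                  ; trans = λ e e′ x → N.≈ᴹ-trans (e x) (e′ x)
                  }
                ; ∙-cong = λ e e′ x → N.+ᴹ-cong (e x) (e′ x)
                }
              ; assoc = λ f g h x → N.+ᴹ-assoc (f $ x) (g $ x) (h $ x)
              }
            ; identity = (λ f x → N.+ᴹ-identityˡ (f $ x)) , (λ f x → N.+ᴹ-identityʳ (f $ x))
            }
          ; comm = λ f g x → N.+ᴹ-comm (f $ x) (g $ x)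
          }
        ; isPreleftSemimodule = record
          { *ₗ-cong = λ r≈s e x → N.*ₗ-cong r≈s (e x)
          ; *ₗ-zeroˡ = λ f x → N.*ₗ-zeroˡ (f $ x)
          ; *ₗ-distribʳ = λ f r s x → N.*ₗ-distribʳ (f $ x) r s
          ; *ₗ-identityˡ = λ f x → N.*ₗ-identityˡ (f $ x)
          ; *ₗ-assoc = λ r s f x → N.*ₗ-assoc r s (f $ x)
          ; *ₗ-zeroʳ = λ r x → N.*ₗ-zeroʳ r
          ; *ₗ-distribˡ = λ r f g x → N.*ₗ-distribˡ r (f $ x) (g $ x)
          }
        }
      ; -ᴹ‿cong = λ e x → N.*ₗ-congˡ (e x)
      ; -ᴹ‿inverse = (λ f x → N.≈ᴹ-trans (N.+ᴹ-comm _ _) (inverseʳ (f $ x)))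
                   , (λ f x → inverseʳ (f $ x))
      }
    }
    where
    module M = LeftModule M
    module N = LeftModule N
    open CommutativeSemigroupProperties
      (CommutativeMonoid.commutativeSemigroup N.+ᴹ-commutativeMonoid) using (interchange)
    inverseʳ : ∀ y → (y N.+ᴹ ((- 1#) N.*ₗ y)) N.≈ᴹ N.0ᴹ
    inverseʳ y =
      N.≈ᴹ-trans (N.+ᴹ-cong (N.≈ᴹ-sym (N.*ₗ-identityˡ y)) N.≈ᴹ-refl)
      (N.≈ᴹ-trans (N.≈ᴹ-sym (N.*ₗ-distribʳ y 1# (- 1#)))
      (N.≈ᴹ-trans (N.*ₗ-cong (R.-‿inverseʳ 1#) N.≈ᴹ-refl) (N.*ₗ-zeroˡ y)))
    scale : K → (M ⟶ N) → (M ⟶ N)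
    scale s f =
      linear {M} {N} (λ x → s N.*ₗ (f $ x)) (λ e → N.*ₗ-congˡ (f.⟦⟧-cong e))
        (λ x y → N.≈ᴹ-trans (N.*ₗ-congˡ (f.+ᴹ-homo x y)) (N.*ₗ-distribˡ s (f $ x) (f $ y)))
        (λ r x → N.≈ᴹ-trans (N.*ₗ-congˡ (f.*ₗ-homo r x))
          (N.≈ᴹ-trans (N.≈ᴹ-sym (N.*ₗ-assoc s r (f $ x)))
          (N.≈ᴹ-trans (N.*ₗ-cong (R.*-comm s r) N.≈ᴹ-refl) (N.*ₗ-assoc r s (f $ x)))))
      where module f = _⟶_ f
    add : (M ⟶ N) → (M ⟶ N) → (M ⟶ N)
    add f g =
      linear {M} {N} (λ x → (f $ x) N.+ᴹ (g $ x))
        (λ e → N.+ᴹ-cong (f.⟦⟧-cong e) (g.⟦⟧-cong e))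
        (λ x y → N.≈ᴹ-trans (N.+ᴹ-cong (f.+ᴹ-homo x y) (g.+ᴹ-homo x y))
                            (interchange (f $ x) (f $ y) (g $ x) (g $ y)))
        (λ r x → N.≈ᴹ-trans (N.+ᴹ-cong (f.*ₗ-homo r x) (g.*ₗ-homo r x))
                            (N.≈ᴹ-sym (N.*ₗ-distribˡ r (f $ x) (g $ x))))
      where
      module f = _⟶_ f
      module g = _⟶_ g

  -- M ⊗ N is the module of formal sums of pure tensors modulo the least
  -- congruence making ⊗ bilinear.
  module TensorProduct (M N : Mod) where

    private
      module M = LeftModule M
      module N = LeftModule N

    infixl 6 _⊕_
    infix 7 _⊗_
    infix 4 _≋_

    data Tensor : Set where
      _⊗_ : ∣ M ∣ → ∣ N ∣ → Tensor
      0ᵗ  : Tensor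
      _⊕_ : Tensor → Tensor → Tensor

    data _≋_ : Tensor → Tensor → Set where
      ≋-refl  : ∀ {t} → t ≋ t
      ≋-sym   : ∀ {t u} → t ≋ u → u ≋ t
      ≋-trans : ∀ {t u v} → t ≋ u → u ≋ v → t ≋ v
      ⊕-cong  : ∀ {t t′ u u′} → t ≋ t′ → u ≋ u′ → t ⊕ u ≋ t′ ⊕ u′
      ⊕-assoc : ∀ t u v → (t ⊕ u) ⊕ v ≋ t ⊕ (u ⊕ v)
      ⊕-comm  : ∀ t u → t ⊕ u ≋ u ⊕ t
      ⊕-identityˡ : ∀ t → 0ᵗ ⊕ t ≋ t
      ⊗-cong  : ∀ {x x′ y y′} → x M.≈ᴹ x′ → y N.≈ᴹ y′ → x ⊗ y ≋ x′ ⊗ y′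
      ⊗-+ˡ    : ∀ x x′ y → (x M.+ᴹ x′) ⊗ y ≋ x ⊗ y ⊕ x′ ⊗ y
      ⊗-+ʳ    : ∀ x y y′ → x ⊗ (y N.+ᴹ y′) ≋ x ⊗ y ⊕ x ⊗ y′
      ⊗-zeroˡ : ∀ y → M.0ᴹ ⊗ y ≋ 0ᵗ
      ⊗-*     : ∀ r x y → (r M.*ₗ x) ⊗ y ≋ x ⊗ (r N.*ₗ y)

    infixr 8 _•_
    _•_ : K → Tensor → Tensor
    r • (x ⊗ y) = (r M.*ₗ x) ⊗ y
    r • 0ᵗ      = 0ᵗ
    r • (t ⊕ u) = r • t ⊕ r • u

    ⊕-medial : ∀ a b c d → (a ⊕ b) ⊕ (c ⊕ d) ≋ (a ⊕ c) ⊕ (b ⊕ d)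
    ⊕-medial a b c d =
      ≋-trans (⊕-assoc a b (c ⊕ d))
      (≋-trans (⊕-cong ≋-refl (≋-trans (≋-sym (⊕-assoc b c d))
        (≋-trans (⊕-cong (⊕-comm b c) ≋-refl) (⊕-assoc c b d))))
      (≋-sym (⊕-assoc a c (b ⊕ d))))

    •-congˡ : ∀ r {t u} → t ≋ u → r • t ≋ r • u
    •-congˡ r ≋-refl = ≋-refl
    •-congˡ r (≋-sym p) = ≋-sym (•-congˡ r p)
    •-congˡ r (≋-trans p q) = ≋-trans (•-congˡ r p) (•-congˡ r q)
    •-congˡ r (⊕-cong p q) = ⊕-cong (•-congˡ r p) (•-congˡ r q)
    •-congˡ r (⊕-assoc t u v) = ⊕-assoc _ _ _
    •-congˡ r (⊕-comm t u) = ⊕-comm _ _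
    •-congˡ r (⊕-identityˡ t) = ⊕-identityˡ _
    •-congˡ r (⊗-cong p q) = ⊗-cong (M.*ₗ-congˡ p) q
    •-congˡ r (⊗-+ˡ x x′ y) =
      ≋-trans (⊗-cong (M.*ₗ-distribˡ r x x′) N.≈ᴹ-refl) (⊗-+ˡ _ _ _)
    •-congˡ r (⊗-+ʳ x y y′) = ⊗-+ʳ _ _ _
    •-congˡ r (⊗-zeroˡ y) = ≋-trans (⊗-cong (M.*ₗ-zeroʳ r) N.≈ᴹ-refl) (⊗-zeroˡ y)
    •-congˡ r (⊗-* s x y) = ≋-trans
      (⊗-cong (M.≈ᴹ-trans (M.≈ᴹ-sym (M.*ₗ-assoc r s x))
         (M.≈ᴹ-trans (M.*ₗ-congʳ (R.*-comm r s)) (M.*ₗ-assoc s r x))) N.≈ᴹ-refl)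
      (⊗-* s (r M.*ₗ x) y)

    •-congʳ : ∀ {r s} → r ≈ₖ s → ∀ t → r • t ≋ s • t
    •-congʳ e (x ⊗ y) = ⊗-cong (M.*ₗ-congʳ e) N.≈ᴹ-refl
    •-congʳ e 0ᵗ = ≋-refl
    •-congʳ e (t ⊕ u) = ⊕-cong (•-congʳ e t) (•-congʳ e u)

    •-zeroˡ : ∀ t → 0# • t ≋ 0ᵗ
    •-zeroˡ (x ⊗ y) = ≋-trans (⊗-cong (M.*ₗ-zeroˡ x) N.≈ᴹ-refl) (⊗-zeroˡ y)
    •-zeroˡ 0ᵗ = ≋-refl
    •-zeroˡ (t ⊕ u) = ≋-trans (⊕-cong (•-zeroˡ t) (•-zeroˡ u)) (⊕-identityˡ 0ᵗ)

    •-distribʳ : ∀ t r s → (r + s) • t ≋ r • t ⊕ s • t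
    •-distribʳ (x ⊗ y) r s = ≋-trans (⊗-cong (M.*ₗ-distribʳ x r s) N.≈ᴹ-refl) (⊗-+ˡ _ _ y)
    •-distribʳ 0ᵗ r s = ≋-sym (⊕-identityˡ 0ᵗ)
    •-distribʳ (t ⊕ u) r s =
      ≋-trans (⊕-cong (•-distribʳ t r s) (•-distribʳ u r s)) (⊕-medial _ _ _ _)

    •-identityˡ : ∀ t → 1# • t ≋ t
    •-identityˡ (x ⊗ y) = ⊗-cong (M.*ₗ-identityˡ x) N.≈ᴹ-refl
    •-identityˡ 0ᵗ = ≋-refl
    •-identityˡ (t ⊕ u) = ⊕-cong (•-identityˡ t) (•-identityˡ u)

    •-assoc : ∀ r s t → (r * s) • t ≋ r • s • t
    •-assoc r s (x ⊗ y) = ⊗-cong (M.*ₗ-assoc r s x) N.≈ᴹ-refl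
    •-assoc r s 0ᵗ = ≋-refl
    •-assoc r s (t ⊕ u) = ⊕-cong (•-assoc r s t) (•-assoc r s u)

    •-inverseʳ : ∀ t → t ⊕ (- 1#) • t ≋ 0ᵗ
    •-inverseʳ t =
      ≋-trans (⊕-cong (≋-sym (•-identityˡ t)) ≋-refl)
      (≋-trans (≋-sym (•-distribʳ t 1# (- 1#)))
      (≋-trans (•-congʳ (R.-‿inverseʳ 1#) t) (•-zeroˡ t)))

    tensorModule : Mod
    tensorModule = record
      { Carrierᴹ = Tensor
      ; _≈ᴹ_ = _≋_
      ; _+ᴹ_ = _⊕_
      ; _*ₗ_ = _•_
      ; 0ᴹ = 0ᵗ
      ; -ᴹ_ = (- 1#) •_
      ; isLeftModule = record
        { isLeftSemimodule = record
          { +ᴹ-isCommutativeMonoid = record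
            { isMonoid = record
              { isSemigroup = record
                { isMagma = record
                  { isEquivalence = record { refl = ≋-refl ; sym = ≋-sym ; trans = ≋-trans }
                  ; ∙-cong = ⊕-cong
                  }
                ; assoc = ⊕-assoc
                }
              ; identity = ⊕-identityˡ , λ t → ≋-trans (⊕-comm t 0ᵗ) (⊕-identityˡ t)
              }
            ; comm = ⊕-comm
            }
          ; isPreleftSemimodule = record
            { *ₗ-cong = λ {r} {s} {t} {u} e p → ≋-trans (•-congʳ e t) (•-congˡ s p)
            ; *ₗ-zeroˡ = •-zeroˡ
            ; *ₗ-distribʳ = •-distribʳ
            ; *ₗ-identityˡ = •-identityˡ
            ; *ₗ-assoc = •-assoc
            ; *ₗ-zeroʳ = λ _ → ≋-refl
            ; *ₗ-distribˡ = λ _ _ _ → ≋-refl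
            }
          }
        ; -ᴹ‿cong = •-congˡ (- 1#)
        ; -ᴹ‿inverse = (λ t → ≋-trans (⊕-comm _ t) (•-inverseʳ t)) , •-inverseʳ
        }
      }

  open TensorProduct public using (Tensor)
  open module Pure {M N : Mod} = TensorProduct M N public using (_⊗_; 0ᵗ; _⊕_)

  infixl 7 _⊗ᴹ_
  _⊗ᴹ_ : Mod → Mod → Mod
  M ⊗ᴹ N = TensorProduct.tensorModule M N

  ⊗-ext : ∀ {M N L} (f g : M ⊗ᴹ N ⟶ L) →
          (∀ x y → (f $ x ⊗ y) ≈[ L ] (g $ x ⊗ y)) → f ⟶≈ g
  ⊗-ext {L = L} f g e = go
    where
    open LeftModule L
    module f = _⟶_ f
    module g = _⟶_ g
    go : ∀ t → (f $ t) ≈ᴹ (g $ t)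
    go (x ⊗ y) = e x y
    go 0ᵗ = ≈ᴹ-trans f.0ᴹ-homo (≈ᴹ-sym g.0ᴹ-homo)
    go (t ⊕ u) = ≈ᴹ-trans (f.+ᴹ-homo t u)
      (≈ᴹ-trans (+ᴹ-cong (go t) (go u)) (≈ᴹ-sym (g.+ᴹ-homo t u)))

  -- The universal property, a bilinear map M × N → L being given as a
  -- linear map M ⟶ Hom N L.
  lift : ∀ {M N L} → (M ⟶ Hom N L) → (M ⊗ᴹ N ⟶ L)
  lift {M} {N} {L} b = linear {M ⊗ᴹ N} {L} ⟦_⟧ ⟦⟧-cong (λ _ _ → ≈ᴹ-refl) ⟦⟧-*
    where
    open LeftModule L
    module b = _⟶_ b
    module b$ x = _⟶_ (b $ x)
    module T = TensorProduct M N
    ⟦_⟧ : Tensor M N → ∣ L ∣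
    ⟦ x ⊗ y ⟧ = (b $ x) $ y
    ⟦ 0ᵗ ⟧    = 0ᴹ
    ⟦ t ⊕ u ⟧ = ⟦ t ⟧ +ᴹ ⟦ u ⟧
    ⟦⟧-cong : ∀ {t u} → t T.≋ u → ⟦ t ⟧ ≈ᴹ ⟦ u ⟧
    ⟦⟧-cong T.≋-refl = ≈ᴹ-refl
    ⟦⟧-cong (T.≋-sym p) = ≈ᴹ-sym (⟦⟧-cong p)
    ⟦⟧-cong (T.≋-trans p q) = ≈ᴹ-trans (⟦⟧-cong p) (⟦⟧-cong q)
    ⟦⟧-cong (T.⊕-cong p q) = +ᴹ-cong (⟦⟧-cong p) (⟦⟧-cong q)
    ⟦⟧-cong (T.⊕-assoc t u v) = +ᴹ-assoc _ _ _
    ⟦⟧-cong (T.⊕-comm t u) = +ᴹ-comm _ _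
    ⟦⟧-cong (T.⊕-identityˡ t) = +ᴹ-identityˡ _
    ⟦⟧-cong (T.⊗-cong {x} {x′} {y} p q) = ≈ᴹ-trans (b.⟦⟧-cong p y) (b$.⟦⟧-cong x′ q)
    ⟦⟧-cong (T.⊗-+ˡ x x′ y) = b.+ᴹ-homo x x′ y
    ⟦⟧-cong (T.⊗-+ʳ x y y′) = b$.+ᴹ-homo x y y′
    ⟦⟧-cong (T.⊗-zeroˡ y) = b.0ᴹ-homo y
    ⟦⟧-cong (T.⊗-* r x y) = ≈ᴹ-trans (b.*ₗ-homo r x y) (≈ᴹ-sym (b$.*ₗ-homo x r y))
    ⟦⟧-* : ∀ r t → ⟦ r T.• t ⟧ ≈ᴹ r *ₗ ⟦ t ⟧
    ⟦⟧-* r (x ⊗ y) = b.*ₗ-homo r x y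
    ⟦⟧-* r 0ᵗ = ≈ᴹ-sym (*ₗ-zeroʳ r)
    ⟦⟧-* r (t ⊕ u) = ≈ᴹ-trans (+ᴹ-cong (⟦⟧-* r t) (⟦⟧-* r u)) (≈ᴹ-sym (*ₗ-distribˡ r _ _))

  pure : ∀ {M N} → M ⟶ Hom N (M ⊗ᴹ N)
  pure {M} {N} = linear {M} {Hom N (M ⊗ᴹ N)}
    (λ x → linear {N} {M ⊗ᴹ N} (x ⊗_) (T.⊗-cong M.≈ᴹ-refl) (T.⊗-+ʳ x) (λ r y → T.≋-sym (T.⊗-* r x y)))
    (λ e y → T.⊗-cong e N.≈ᴹ-refl) T.⊗-+ˡ (λ _ _ _ → T.≋-refl)
    where
    module M = LeftModule M
    module N = LeftModule N
    module T = TensorProduct M N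

  infixr 9 _∘ᴸ_
  _∘ᴸ_ : ∀ {L M N} → (M ⟶ N) → (L ⟶ M) → (L ⟶ N)
  _∘ᴸ_ {L} {M} {N} g f = linear {L} {N} (λ x → g $ f $ x)
    (λ e → g.⟦⟧-cong (f.⟦⟧-cong e))
    (λ x y → N.≈ᴹ-trans (g.⟦⟧-cong (f.+ᴹ-homo x y)) (g.+ᴹ-homo _ _))
    (λ r x → N.≈ᴹ-trans (g.⟦⟧-cong (f.*ₗ-homo r x)) (g.*ₗ-homo _ _))
    where
    module N = LeftModule N
    module f = _⟶_ f
    module g = _⟶_ g

  post : ∀ {L M N} → (M ⟶ N) → (Hom L M ⟶ Hom L N)
  post {L} {M} {N} h = linear {Hom L M} {Hom L N} (h ∘ᴸ_)
    (λ e x → h.⟦⟧-cong (e x)) (λ f g x → h.+ᴹ-homo _ _) (λ r f x → h.*ₗ-homo _ _)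
    where module h = _⟶_ h

  pre : ∀ {L M N} → (L ⟶ M) → (Hom M N ⟶ Hom L N)
  pre {L} {M} {N} h = linear {Hom M N} {Hom L N} (_∘ᴸ h)
    (λ e x → e (h $ x)) (λ f g x → N.≈ᴹ-refl) (λ r f x → N.≈ᴹ-refl)
    where module N = LeftModule N

  infixl 7 _⊗ᴸ_
  -- (f ⊗ᴸ g) (x ⊗ y) = f x ⊗ g y
  _⊗ᴸ_ : ∀ {M M′ N N′} → (M ⟶ M′) → (N ⟶ N′) → (M ⊗ᴹ N ⟶ M′ ⊗ᴹ N′)
  f ⊗ᴸ g = lift (pre g ∘ᴸ pure ∘ᴸ f)

  -- (x ⊗ y) ⊗ z ↦ x ⊗ (y ⊗ z)
  associator : ∀ {M N P} → (M ⊗ᴹ N) ⊗ᴹ P ⟶ M ⊗ᴹ (N ⊗ᴹ P)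
  associator = lift (lift (step ∘ᴸ pure))
    where
    step : ∀ {N P X} → Hom (N ⊗ᴹ P) X ⟶ Hom N (Hom P X)
    step {N} {P} {X} = linear {Hom (N ⊗ᴹ P) X} {Hom N (Hom P X)} (λ h → post h ∘ᴸ pure)
      (λ e x y → e (x ⊗ y)) (λ _ _ _ _ → X.≈ᴹ-refl) (λ _ _ _ _ → X.≈ᴹ-refl)
      where module X = LeftModule X

  -- r ⊗ x ↦ r x  and  x ⊗ r ↦ r x
  unitorˡ : ∀ {M} → 𝕂 ⊗ᴹ M ⟶ M
  unitorˡ {M} = lift (linear {𝕂} {Hom M M} (λ r → LeftModule._*ₗ_ (Hom M M) r idᴸ)
    (λ e x → *ₗ-congʳ e) (λ r s x → *ₗ-distribʳ x r s) (λ r s x → *ₗ-assoc r s x))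
    where open LeftModule M

  unitorʳ : ∀ {M} → M ⊗ᴹ 𝕂 ⟶ M
  unitorʳ {M} = lift (linear {M} {Hom 𝕂 M}
    (λ x → linear {𝕂} {M} (_*ₗ x) *ₗ-congʳ (λ r s → *ₗ-distribʳ x r s) (λ r s → *ₗ-assoc r s x))
    (λ e r → *ₗ-congˡ e) (λ x y r → *ₗ-distribˡ r x y)
    (λ s x r → ≈ᴹ-trans (≈ᴹ-sym (*ₗ-assoc r s x))
                 (≈ᴹ-trans (*ₗ-congʳ (R.*-comm r s)) (*ₗ-assoc s r x))))
    where open LeftModule M

  -- (a ⊗ b) ⊗ (c ⊗ d) ↦ (a ⊗ c) ⊗ (b ⊗ d)
  middleSwap : ∀ {A B C D} → (A ⊗ᴹ B) ⊗ᴹ (C ⊗ᴹ D) ⟶ (A ⊗ᴹ C) ⊗ᴹ (B ⊗ᴹ D)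
  middleSwap {A} {B} {C} {D} = lift {A ⊗ᴹ B} {C ⊗ᴹ D} {X} (lift {A} {B} {Hom (C ⊗ᴹ D) X}
      (linear {A} {Hom B (Hom (C ⊗ᴹ D) X)}
      (λ a → linear {B} {Hom (C ⊗ᴹ D) X} (φ a)
        (λ {b} {b′} e → ext (φ a b) (φ a b′)
          (λ c d → X.⊗-cong AC.≋-refl (BD.⊗-cong e D.≈ᴹ-refl)))
        (λ b b′ → ext (φ a (b B.+ᴹ b′)) (φ a b H.+ᴹ φ a b′)
          (λ c d → X.≋-trans (X.⊗-cong AC.≋-refl (BD.⊗-+ˡ b b′ d))
                             (X.⊗-+ʳ (a ⊗ c) (b ⊗ d) (b′ ⊗ d))))
        (λ r b → ext (φ a (r B.*ₗ b)) (r H.*ₗ φ a b)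
          (λ c d → X.≋-sym (X.⊗-* r (a ⊗ c) (b ⊗ d)))))
      (λ {a} {a′} e b → ext (φ a b) (φ a′ b)
          (λ c d → X.⊗-cong (AC.⊗-cong e C.≈ᴹ-refl) BD.≋-refl))
      (λ a a′ b → ext (φ (a A.+ᴹ a′) b) (φ a b H.+ᴹ φ a′ b)
          (λ c d → X.≋-trans (X.⊗-cong (AC.⊗-+ˡ a a′ c) BD.≋-refl)
                             (X.⊗-+ˡ (a ⊗ c) (a′ ⊗ c) (b ⊗ d))))
      (λ r a b → ext (φ (r A.*ₗ a) b) (r H.*ₗ φ a b) (λ c d → X.≋-refl))))
    where
    X : Mod
    X = (A ⊗ᴹ C) ⊗ᴹ (B ⊗ᴹ D)
    module A = LeftModule A
    module B = LeftModule B
    module C = LeftModule C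
    module D = LeftModule D
    module AC = TensorProduct A C
    module BD = TensorProduct B D
    module X = TensorProduct (A ⊗ᴹ C) (B ⊗ᴹ D)
    module H = LeftModule (Hom (C ⊗ᴹ D) X)
    φ : ∣ A ∣ → ∣ B ∣ → (C ⊗ᴹ D ⟶ X)
    φ a b = _⊗ᴸ_ {C} {A ⊗ᴹ C} {D} {B ⊗ᴹ D}
      (_$_ {A} {Hom C (A ⊗ᴹ C)} pure a) (_$_ {B} {Hom D (B ⊗ᴹ D)} pure b)
    ext : (f g : C ⊗ᴹ D ⟶ X) →
          (∀ c d → _$_ {C ⊗ᴹ D} {X} f (c ⊗ d) ≈[ X ] _$_ {C ⊗ᴹ D} {X} g (c ⊗ d)) →
          ∀ t → _$_ {C ⊗ᴹ D} {X} f t ≈[ X ] _$_ {C ⊗ᴹ D} {X} g t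
    ext = ⊗-ext {C} {D} {X}

  record IsHopfAlgebra (A : Mod) (m : A ⊗ᴹ A ⟶ A) (1ᴬ : ∣ A ∣)
                       (Δ : A ⟶ A ⊗ᴹ A) (ε : A ⟶ 𝕂) : Set where
    open LeftModule A using (_*ₗ_)
    field
      assoc     : ∀ a b c → (m $ (m $ a ⊗ b) ⊗ c) ≈[ A ] (m $ a ⊗ (m $ b ⊗ c))
      identityˡ : ∀ a → (m $ 1ᴬ ⊗ a) ≈[ A ] a
      identityʳ : ∀ a → (m $ a ⊗ 1ᴬ) ≈[ A ] a
      coassoc   : ∀ a → (associator $ Δ ⊗ᴸ idᴸ $ Δ $ a) ≈[ A ⊗ᴹ (A ⊗ᴹ A) ] (idᴸ ⊗ᴸ Δ $ Δ $ a)
      counitˡ   : ∀ a → (unitorˡ $ ε ⊗ᴸ idᴸ $ Δ $ a) ≈[ A ] a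
      counitʳ   : ∀ a → (unitorʳ $ idᴸ ⊗ᴸ ε $ Δ $ a) ≈[ A ] a
      Δ-homo    : ∀ a b → (Δ $ m $ a ⊗ b) ≈[ A ⊗ᴹ A ] (m ⊗ᴸ m $ middleSwap $ (Δ $ a) ⊗ (Δ $ b))
      Δ-unit    : (Δ $ 1ᴬ) ≈[ A ⊗ᴹ A ] (1ᴬ ⊗ 1ᴬ)
      ε-homo    : ∀ a b → (ε $ m $ a ⊗ b) ≈ₖ (ε $ a) * (ε $ b)
      ε-unit    : (ε $ 1ᴬ) ≈ₖ 1#
      S         : A ⟶ A
      antipodeˡ : ∀ a → (m $ S ⊗ᴸ idᴸ $ Δ $ a) ≈[ A ] ((ε $ a) *ₗ 1ᴬ)
      antipodeʳ : ∀ a → (m $ idᴸ ⊗ᴸ S $ Δ $ a) ≈[ A ] ((ε $ a) *ₗ 1ᴬ)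

  record FinSupp (M : ℕ → Mod) : Set where
    field
      component : ∀ n → ∣ M n ∣
      bound     : ℕ
      vanishes  : ∀ n → bound ℕ.≤ n → component n ≈[ M n ] LeftModule.0ᴹ (M n)

  open FinSupp public

  ⨁ : (ℕ → Mod) → Mod
  ⨁ M = record
    { Carrierᴹ = FinSupp M
    ; _≈ᴹ_ = λ f g → ∀ n → component f n ≈[ M n ] component g n
    ; _+ᴹ_ = λ f g → record
        { component = λ n → M._+ᴹ_ n (component f n) (component g n)
        ; bound = bound f ℕ.⊔ bound g
        ; vanishes = λ n b → M.≈ᴹ-trans n
            (M.+ᴹ-cong n (vanishes f n (ℕ.m⊔n≤o⇒m≤o (bound f) (bound g) b))
                         (vanishes g n (ℕ.m⊔n≤o⇒n≤o (bound f) (bound g) b)))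
            (M.+ᴹ-identityˡ n (M.0ᴹ n)) }
    ; _*ₗ_ = λ r f → record
        { component = λ n → M._*ₗ_ n r (component f n)
        ; bound = bound f
        ; vanishes = λ n b → M.≈ᴹ-trans n (M.*ₗ-congˡ n (vanishes f n b)) (M.*ₗ-zeroʳ n r) }
    ; 0ᴹ = record { component = M.0ᴹ ; bound = 0 ; vanishes = λ n _ → M.≈ᴹ-refl n }
    ; -ᴹ_ = λ f → record
        { component = λ n → M.-ᴹ_ n (component f n)
        ; bound = bound f
        ; vanishes = λ n b → M.≈ᴹ-trans n (M.-ᴹ‿cong n (vanishes f n b))
            (GroupProperties.ε⁻¹≈ε (M.+ᴹ-group n)) }
    ; isLeftModule = record
      { isLeftSemimodule = record
        { +ᴹ-isCommutativeMonoid = record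
          { isMonoid = record
            { isSemigroup = record
              { isMagma = record
                { isEquivalence = record
                  { refl = λ n → M.≈ᴹ-refl n
                  ; sym = λ e n → M.≈ᴹ-sym n (e n)
                  ; trans = λ e e′ n → M.≈ᴹ-trans n (e n) (e′ n)
                  }
                ; ∙-cong = λ e e′ n → M.+ᴹ-cong n (e n) (e′ n)
                }
              ; assoc = λ f g h n → M.+ᴹ-assoc n _ _ _
              }
            ; identity = (λ f n → M.+ᴹ-identityˡ n _) , (λ f n → M.+ᴹ-identityʳ n _)
            }
          ; comm = λ f g n → M.+ᴹ-comm n _ _
          }
        ; isPreleftSemimodule = record
          { *ₗ-cong = λ r≈s e n → M.*ₗ-cong n r≈s (e n)
          ; *ₗ-zeroˡ = λ f n → M.*ₗ-zeroˡ n _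
          ; *ₗ-distribʳ = λ f r s n → M.*ₗ-distribʳ n _ r s
          ; *ₗ-identityˡ = λ f n → M.*ₗ-identityˡ n _
          ; *ₗ-assoc = λ r s f n → M.*ₗ-assoc n r s _
          ; *ₗ-zeroʳ = λ r n → M.*ₗ-zeroʳ n r
          ; *ₗ-distribˡ = λ r f g n → M.*ₗ-distribˡ n r _ _
          }
        }
      ; -ᴹ‿cong = λ e n → M.-ᴹ‿cong n (e n)
      ; -ᴹ‿inverse = (λ f n → M.-ᴹ‿inverseˡ n _) , (λ f n → M.-ᴹ‿inverseʳ n _)
      }
    }
    where module M n = LeftModule (M n)

  ι : ∀ (M : ℕ → Mod) n → ∣ M n ∣ → ∣ ⨁ M ∣
  ι M n x = record
    { component = at
    ; bound = ℕ.suc n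
    ; vanishes = λ m n<m → off m (ℕ.<⇒≢ n<m)
    }
    where
    at : ∀ m → ∣ M m ∣
    at m with n ℕ.≟ m
    ... | yes refl = x
    ... | no _     = LeftModule.0ᴹ (M m)
    off : ∀ m → ¬ (n ≡ m) → at m ≈[ M m ] LeftModule.0ᴹ (M m)
    off m n≢m with n ℕ.≟ m
    ... | yes n≡m = contradiction n≡m n≢m
    ... | no _    = LeftModule.≈ᴹ-refl (M m)

  sumᴸ : ∀ M {A : Set} → List A → (A → ∣ M ∣) → ∣ M ∣
  sumᴸ M xs f = foldr (λ a s → f a +ᴹ s) 0ᴹ xs
    where open LeftModule M

record FiniteField (q : ℕ) : Set₁ where
  infixl 6 _+_
  infixl 7 _*_
  infix 8 -_
  field
    Carrier : Set
    _+_ _*_ : Carrier → Carrier → Carrier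
    -_      : Carrier → Carrier
    0# 1#   : Carrier
    isCommutativeRing : IsCommutativeRing _≡_ _+_ _*_ -_ 0# 1#
    0≢1     : 0# ≢ 1#
    inverse : ∀ x → x ≢ 0# → ∃[ y ] x * y ≡ 1#
    enumeration : Fin q ↔ Carrier

  commutativeRing : CommutativeRing 0ℓ 0ℓ
  commutativeRing = record { isCommutativeRing = isCommutativeRing }

-- [±n]: pos i and neg i stand for i + 1 and -(i + 1).
data Index (n : ℕ) : Set where
  pos neg : Fin n → Index n

opp : ∀ {n} → Index n → Index n
opp (pos i) = neg i
opp (neg i) = pos i

infix 4 _≺_

data _≺_ {n} : Index n → Index n → Set where
  pos≺pos : ∀ {i j} → i Fin.< j → pos i ≺ pos j
  pos≺neg : ∀ {i j} → pos i ≺ neg j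
  neg≺neg : ∀ {i j} → j Fin.< i → neg i ≺ neg j

±map : ∀ {m n} → (Fin m → Fin n) → Index m → Index n
±map e (pos i) = pos (e i)
±map e (neg i) = neg (e i)

module IndexProperties where

  private variable n : ℕ

  opp-involutive : (i : Index n) → opp (opp i) ≡ i
  opp-involutive (pos _) = refl
  opp-involutive (neg _) = refl

  opp-≺ : {i j : Index n} → i ≺ j → opp j ≺ opp i
  opp-≺ (pos≺pos p) = neg≺neg p
  opp-≺ pos≺neg = pos≺neg
  opp-≺ (neg≺neg p) = pos≺pos p

  opp-≺⁻¹ : {i j : Index n} → opp j ≺ opp i → i ≺ j
  opp-≺⁻¹ {i = i} {j} p = subst₂ _≺_ (opp-involutive i) (opp-involutive j) (opp-≺ p)

  pos-injective : {i j : Fin n} → pos i ≡ pos j → i ≡ j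
  pos-injective refl = refl

  neg-injective : {i j : Fin n} → neg i ≡ neg j → i ≡ j
  neg-injective refl = refl

  _≟_ : DecidableEquality (Index n)
  pos i ≟ pos j = map′ (cong pos) pos-injective (i Fin.≟ j)
  pos i ≟ neg j = no λ ()
  neg i ≟ pos j = no λ ()
  neg i ≟ neg j = map′ (cong neg) neg-injective (i Fin.≟ j)

  _≺?_ : (i j : Index n) → Dec (i ≺ j)
  pos i ≺? pos j = map′ pos≺pos (λ { (pos≺pos p) → p }) (i Fin.<? j)
  pos i ≺? neg j = yes pos≺neg
  neg i ≺? pos j = no λ ()
  neg i ≺? neg j = map′ neg≺neg (λ { (neg≺neg p) → p }) (j Fin.<? i)

  ≺-irrefl : {i : Index n} → ¬ i ≺ i
  ≺-irrefl (pos≺pos p) = Fin.<-irrefl refl p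
  ≺-irrefl (neg≺neg p) = Fin.<-irrefl refl p

  ≺-trans : {i j k : Index n} → i ≺ j → j ≺ k → i ≺ k
  ≺-trans (pos≺pos p) (pos≺pos q) = pos≺pos (Fin.<-trans p q)
  ≺-trans (pos≺pos p) pos≺neg = pos≺neg
  ≺-trans pos≺neg (neg≺neg q) = pos≺neg
  ≺-trans (neg≺neg p) (neg≺neg q) = neg≺neg (Fin.<-trans q p)

  ≺-connex : (i j : Index n) → i ≢ j → i ≺ j ⊎ j ≺ i
  ≺-connex (pos i) (pos j) i≢j with Fin.<-cmp i j
  ... | tri< p _ _ = inj₁ (pos≺pos p)
  ... | tri≈ _ p _ = contradiction (cong pos p) i≢j
  ... | tri> _ _ p = inj₂ (pos≺pos p)
  ≺-connex (pos i) (neg j) _ = inj₁ pos≺neg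
  ≺-connex (neg i) (pos j) _ = inj₂ pos≺neg
  ≺-connex (neg i) (neg j) i≢j with Fin.<-cmp i j
  ... | tri< p _ _ = inj₂ (neg≺neg p)
  ... | tri≈ _ p _ = contradiction (cong neg p) i≢j
  ... | tri> _ _ p = inj₁ (neg≺neg p)

  ≺-wellFounded : WellFounded (_≺_ {n})
  ≺-wellFounded (pos i) = acc-pos (Fin.<-wellFounded i)
    where
    acc-pos : ∀ {i} → Acc Fin._<_ i → Acc _≺_ (pos i)
    acc-pos (acc r) = acc λ { (pos≺pos p) → acc-pos (r p) }
  ≺-wellFounded (neg i) = acc-neg (Fin.>-wellFounded i)
    where
    acc-neg : ∀ {i} → Acc Fin._>_ i → Acc _≺_ (neg i)
    acc-neg (acc r) = acc λ { pos≺neg → ≺-wellFounded (pos _) ; (neg≺neg p) → acc-neg (r p) }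

  ≻-wellFounded : WellFounded (λ i j → _≺_ {n} j i)
  ≻-wellFounded i = subst (Acc _) (opp-involutive i) (go (≺-wellFounded (opp i)))
    where
    go : ∀ {i : Index n} → Acc _≺_ i → Acc (λ i j → j ≺ i) (opp i)
    go {i = i} (acc r) = acc λ {k} p → subst (Acc _) (opp-involutive k)
      (go (r (opp-≺⁻¹ (subst (opp i ≺_) (sym (opp-involutive k)) p))))

  all? : {P : Index n → Set} → (∀ i → Dec (P i)) → Dec (∀ i → P i)
  all? P? = map′ (λ { (p , q) (pos i) → p i ; (p , q) (neg i) → q i })
                 (λ p → p ∘ pos , p ∘ neg)
                 (Fin.all? (P? ∘ pos) ×-dec Fin.all? (P? ∘ neg))

  any? : {P : Index n → Set} → (∀ i → Dec (P i)) → Dec (∃ P)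
  any? P? = map′ (λ { (inj₁ (i , p)) → pos i , p ; (inj₂ (i , p)) → neg i , p })
                 (λ { (pos i , p) → inj₁ (i , p) ; (neg i , p) → inj₂ (i , p) })
                 (Fin.any? (P? ∘ pos) ⊎-dec Fin.any? (P? ∘ neg))

  module ±map {m n} (e : Fin m → Fin n) (mono : ∀ {i j} → i Fin.< j → e i Fin.< e j) where

    ±map-opp : ∀ i → ±map e (opp i) ≡ opp (±map e i)
    ±map-opp (pos _) = refl
    ±map-opp (neg _) = refl

    ±map-≺ : ∀ {i j} → i ≺ j → ±map e i ≺ ±map e j
    ±map-≺ (pos≺pos p) = pos≺pos (mono p)
    ±map-≺ pos≺neg = pos≺neg
    ±map-≺ (neg≺neg p) = neg≺neg (mono p)

    ±map-≺⁻¹ : ∀ {i j} → ±map e i ≺ ±map e j → i ≺ j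
    ±map-≺⁻¹ {i} {j} p with i ≟ j
    ... | yes refl = contradiction p ≺-irrefl
    ... | no i≢j with ≺-connex i j i≢j
    ...   | inj₁ i≺j = i≺j
    ...   | inj₂ j≺i = contradiction (≺-trans p (±map-≺ j≺i)) ≺-irrefl

    ±map-injective : ∀ {i j} → ±map e i ≡ ±map e j → i ≡ j
    ±map-injective {i} {j} p with i ≟ j
    ... | yes i≡j = i≡j
    ... | no i≢j with ≺-connex i j i≢j
    ...   | inj₁ i≺j = contradiction (subst (±map e i ≺_) (sym p) (±map-≺ i≺j)) ≺-irrefl
    ...   | inj₂ j≺i = contradiction (subst (_≺ ±map e i) (sym p) (±map-≺ j≺i)) ≺-irrefl

module Enumeration where

  functions : ∀ {A : Set} m → List A → List (Fin m → A)
  functions ℕ.zero    xs = [ (λ ()) ]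
  functions (ℕ.suc m) xs = cartesianProductWith Vector._∷_ xs (functions m xs)

  copair : ∀ {A : Set} {n} → (Fin n → A) → (Fin n → A) → Index n → A
  copair f g (pos i) = f i
  copair f g (neg i) = g i

  indexFunctions : ∀ {A : Set} n → List A → List (Index n → A)
  indexFunctions n xs = cartesianProductWith copair (functions n xs) (functions n xs)

  functions-complete : ∀ {A B : Set} {R : A → B → Set} {xs : List A} →
    (∀ b → Any (λ a → R a b) xs) →
    ∀ m (f : Fin m → B) → Any (λ f′ → ∀ i → R (f′ i) (f i)) (functions m xs)
  functions-complete c ℕ.zero    f = here λ ()
  functions-complete c (ℕ.suc m) f = Any.cartesianProductWith⁺ Vector._∷_
    (λ p q → λ { zero → p ; (suc i) → q i }) (c (f zero)) (functions-complete c m (f ∘ suc))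

  indexFunctions-complete : ∀ {A B : Set} {R : A → B → Set} {xs : List A} →
    (∀ b → Any (λ a → R a b) xs) →
    ∀ n (f : Index n → B) → Any (λ f′ → ∀ i → R (f′ i) (f i)) (indexFunctions n xs)
  indexFunctions-complete c n f = Any.cartesianProductWith⁺ copair
    (λ p q → λ { (pos i) → p i ; (neg i) → q i })
    (functions-complete c n (f ∘ pos)) (functions-complete c n (f ∘ neg))

module Group {q : ℕ} (𝔽 : FiniteField q) where

  open FiniteField 𝔽 public
    using (_+_; _*_; -_; 0#; 1#; 0≢1; inverse; enumeration) renaming (Carrier to F)
  open CommutativeRing (FiniteField.commutativeRing 𝔽)
    using (ring; semiring; _-_; +-identityˡ; +-identityʳ; +-assoc; +-comm; *-identityˡ; *-identityʳ;
           *-assoc; *-comm; zeroˡ; zeroʳ; distribˡ; distribʳ; -‿inverseʳ; -‿inverseˡ)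
  open RingProperties ring using (-‿distribˡ-*; -‿distribʳ-*; -0#≈0#; -‿involutive; -‿+-comm)
  open SemiringSum semiring
    using (sum; sum-cong-≗; sum-replicate-zero; ∑-distrib-+; ∑-comm; *-distribˡ-sum; *-distribʳ-sum)
  open IndexProperties

  _≟ᶠ_ : DecidableEquality F
  _≟ᶠ_ = via-injection (↔⇒↣ (↔-sym enumeration)) Fin._≟_

  elements : List F
  elements = map (Inverse.to enumeration) (allFin q)

  elements-complete : ∀ a → a ∈ elements
  elements-complete a = subst (_∈ elements) (Inverse.strictlyInverseˡ enumeration a)
    (∈-map⁺ (Inverse.to enumeration) (∈-allFin (Inverse.from enumeration a)))

  allᶠ? : {P : F → Set} → (∀ a → Dec (P a)) → Dec (∀ a → P a)
  allᶠ? {P} P? = map′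
    (λ p a → subst P (Inverse.strictlyInverseˡ enumeration a) (p (Inverse.from enumeration a)))
    (λ p i → p (Inverse.to enumeration i))
    (Fin.all? (λ i → P? (Inverse.to enumeration i)))

  Mat Mat± : ℕ → Set
  Mat n  = Fin n → Fin n → F
  Mat± n = Index n → Index n → F

  infix 4 _≋_

  _≋_ : {I : Set} → (I → I → F) → (I → I → F) → Set
  x ≋ y = ∀ i j → x i j ≡ y i j

  sum± : ∀ {n} → (Index n → F) → F
  sum± f = sum (f ∘ pos) + sum (f ∘ neg)

  infixl 7 _∙_ _·_

  _∙_ : ∀ {n} → Mat n → Mat n → Mat n
  (x ∙ y) i j = sum λ k → x i k * y k j

  _·_ : ∀ {n} → Mat± n → Mat± n → Mat± n
  (x · y) i j = sum± λ k → x i k * y k j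

  δ : Bool.Bool → F
  δ b = Bool.if b then 1# else 0#

  I J : ∀ {n} → Mat n
  I i j = δ (does (i Fin.≟ j))
  J i j = δ (does (i Fin.≟ opposite j))

  I± : ∀ {n} → Mat± n
  I± i j = δ (does (i ≟ j))

  infix 9 _ᵗ

  _ᵗ : ∀ {n} → Mat n → Mat n
  (x ᵗ) i j = x j i

  IsUnitriangular : {X : Set} → (X → X → Set) → (X → X → F) → Set
  IsUnitriangular _⊏_ x = (∀ i → x i i ≡ 1#) × (∀ i j → j ⊏ i → x i j ≡ 0#)

  -- neg j is the column (row) number opposite j of a right-hand (lower)
  -- block, since n, …, 1 is the order of the absolute values there.
  block : ∀ {n} (X Y Z W : Mat n) → Mat± n
  block X Y Z W (pos i) (pos j) = X i j
  block X Y Z W (pos i) (neg j) = Y i (opposite j)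
  block X Y Z W (neg i) (pos j) = Z (opposite i) j
  block X Y Z W (neg i) (neg j) = W (opposite i) (opposite j)

  record IsUᴰ {n} (x : Mat± n) : Set where
    field
      P P⁻¹ Q : Mat n
      P∈U     : IsUnitriangular Fin._<_ P
      P∙P⁻¹   : P ∙ P⁻¹ ≋ I
      P⁻¹∙P   : P⁻¹ ∙ P ≋ I
      JQᵗJ    : J ∙ Q ᵗ ∙ J ≋ λ i j → - Q i j
      blocks  : x ≋ block P (P ∙ Q) (λ _ _ → 0#) (J ∙ P⁻¹ ᵗ ∙ J)

  record Uᴰ (n : ℕ) : Set where
    field
      matrix : Mat± n
      isUᴰ   : IsUᴰ matrix

  open Uᴰ public

  -- A set of labelled arcs with at most one label for each pair (i , j) is
  -- encoded by its label function, the label 0 meaning that there is no arc.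
  -- The same function is the matrix y_λ.
  Arc : ∀ {n} → Mat± n → Index n → Index n → F → Set
  Arc y i j a = y i j ≡ a × a ≢ 0#

  record IsDPartition {n} (y : Mat± n) : Set where
    field
      ordered    : ∀ i j a → Arc y i j a → i ≺ j
      ¬antipodal : ∀ i j a → Arc y i j a → j ≢ opp i
      symmetric  : ∀ i j a → Arc y i j a → Arc y (opp j) (opp i) (- a)
      nonNesting : ∀ i j a → Arc y i j a → ∀ k → i ≺ k → k ≺ j →
                   ∀ b → ¬ Arc y i k b × ¬ Arc y k j b

  record DPartition (n : ℕ) : Set where
    field
      label        : Mat± n
      isDPartition : IsDPartition label

  open DPartition public

  arc? : ∀ {n} (y : Mat± n) i j a → Dec (Arc y i j a)
  arc? y i j a = (y i j ≟ᶠ a) ×-dec ¬? (a ≟ᶠ 0#)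

  isDPartition? : ∀ {n} (y : Mat± n) → Dec (IsDPartition y)
  isDPartition? y = map′
    (λ (p , q , r , s) → record { ordered = p ; ¬antipodal = q ; symmetric = r ; nonNesting = s })
    (λ d → let open IsDPartition d in ordered , ¬antipodal , symmetric , nonNesting)
    (all? (λ i → all? λ j → allᶠ? λ a → arc? y i j a →-dec i ≺? j) ×-dec
     all? (λ i → all? λ j → allᶠ? λ a → arc? y i j a →-dec ¬? (j ≟ opp i)) ×-dec
     all? (λ i → all? λ j → allᶠ? λ a → arc? y i j a →-dec arc? y (opp j) (opp i) (- a)) ×-dec
     all? (λ i → all? λ j → allᶠ? λ a → arc? y i j a →-dec
       all? λ k → i ≺? k →-dec (k ≺? j →-dec
       allᶠ? λ b → ¬? (arc? y i k b) ×-dec ¬? (arc? y k j b))))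

  matrices : ∀ n → List (Mat± n)
  matrices n = Enumeration.indexFunctions n (Enumeration.indexFunctions n elements)

  matrices-complete : ∀ {n} (x : Mat± n) → Any (_≋ x) (matrices n)
  matrices-complete {n} x = Enumeration.indexFunctions-complete
    (Enumeration.indexFunctions-complete (λ a → Any.map sym (elements-complete a)) n) n x

  dPartitions : ∀ n → List (DPartition n)
  dPartitions n = mapMaybe
    (λ y → Maybe.map (λ d → record { label = y ; isDPartition = d }) (dec⇒maybe (isDPartition? y)))
    (matrices n)

  infix 4 _⊑_

  _⊑_ : ∀ {n} → DPartition n → DPartition n → Set
  lam ⊑ mu = ∀ i j a → Arc (label lam) i j a → Arc (label mu) i j a

  _⊑?_ : ∀ {n} (lam mu : DPartition n) → Dec (lam ⊑ mu)
  lam ⊑? mu = all? λ i → all? λ j → allᶠ? λ a → arc? (label lam) i j a →-dec arc? (label mu) i j a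

  -- V λ = U y_λ U and K λ = U^D ∩ (V λ + 1).
  _∈V_ : ∀ {n} → Mat± n → Mat± n → Set
  x ∈V y = ∃[ g ] ∃[ h ] IsUnitriangular _≺_ g × IsUnitriangular _≺_ h × x ≋ g · y · h

  _∈K_ : ∀ {n} → Uᴰ n → DPartition n → Set
  x ∈K lam = (λ i j → matrix x i j - I± i j) ∈V label lam

  -- K λ and K μ are disjoint for λ ≠ μ: needed for κ λ to be a superclass
  -- function.
  module Disjointness where

    open ≡-Reasoning

    sum±-cong : ∀ {n} {f g : Index n → F} → (∀ i → f i ≡ g i) → sum± f ≡ sum± g
    sum±-cong e = cong₂ _+_ (sum-cong-≗ (e ∘ pos)) (sum-cong-≗ (e ∘ neg))

    +-medial : ∀ a b c d → (a + b) + (c + d) ≡ (a + c) + (b + d)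
    +-medial a b c d = begin
      (a + b) + (c + d) ≡⟨ +-assoc a b (c + d) ⟩
      a + (b + (c + d)) ≡⟨ cong (a +_) (sym (+-assoc b c d)) ⟩
      a + ((b + c) + d) ≡⟨ cong (λ z → a + (z + d)) (+-comm b c) ⟩
      a + ((c + b) + d) ≡⟨ cong (a +_) (+-assoc c b d) ⟩
      a + (c + (b + d)) ≡⟨ sym (+-assoc a c (b + d)) ⟩
      (a + c) + (b + d) ∎

    sum±-+ : ∀ {n} (f g : Index n → F) → sum± (λ i → f i + g i) ≡ sum± f + sum± g
    sum±-+ f g = trans
      (cong₂ _+_ (∑-distrib-+ (f ∘ pos) (g ∘ pos)) (∑-distrib-+ (f ∘ neg) (g ∘ neg)))
      (+-medial _ _ _ _)

    sum±-*ˡ : ∀ {n} a (f : Index n → F) → a * sum± f ≡ sum± (λ i → a * f i)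
    sum±-*ˡ a f = trans (distribˡ a _ _)
      (cong₂ _+_ (*-distribˡ-sum a (f ∘ pos)) (*-distribˡ-sum a (f ∘ neg)))

    sum±-*ʳ : ∀ {n} a (f : Index n → F) → sum± f * a ≡ sum± (λ i → f i * a)
    sum±-*ʳ a f = trans (distribʳ a _ _)
      (cong₂ _+_ (*-distribʳ-sum a (f ∘ pos)) (*-distribʳ-sum a (f ∘ neg)))

    sum±-neg : ∀ {n} (f : Index n → F) → sum± (λ i → - f i) ≡ - sum± f
    sum±-neg f = begin
      sum± (λ i → - f i)      ≡⟨ sum±-cong (λ i → trans (cong -_ (sym (*-identityˡ (f i)))) (-‿distribˡ-* 1# (f i))) ⟩
      sum± (λ i → - 1# * f i) ≡⟨ sym (sum±-*ˡ (- 1#) f) ⟩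
      - 1# * sum± f           ≡⟨ sym (-‿distribˡ-* 1# _) ⟩
      - (1# * sum± f)         ≡⟨ cong -_ (*-identityˡ _) ⟩
      - sum± f                ∎

    sum±-swap : ∀ {n} (f : Index n → Index n → F) →
      sum± (λ i → sum± (f i)) ≡ sum± (λ j → sum± (λ i → f i j))
    sum±-swap f = trans
      (cong₂ _+_ (∑-distrib-+ (λ i → sum (f (pos i) ∘ pos)) (λ i → sum (f (pos i) ∘ neg)))
                 (∑-distrib-+ (λ i → sum (f (neg i) ∘ pos)) (λ i → sum (f (neg i) ∘ neg))))
      (trans (+-medial _ _ _ _)
      (trans (cong₂ _+_ (cong₂ _+_ (∑-comm (λ i j → f (pos i) (pos j))) (∑-comm (λ i j → f (neg i) (pos j))))
                        (cong₂ _+_ (∑-comm (λ i j → f (pos i) (neg j))) (∑-comm (λ i j → f (neg i) (neg j)))))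
        (sym (cong₂ _+_ (∑-distrib-+ (λ j → sum (λ i → f (pos i) (pos j))) (λ j → sum (λ i → f (neg i) (pos j))))
                        (∑-distrib-+ (λ j → sum (λ i → f (pos i) (neg j))) (λ j → sum (λ i → f (neg i) (neg j))))))))

    sum±-opp : ∀ {n} (f : Index n → F) → sum± (f ∘ opp) ≡ sum± f
    sum±-opp f = +-comm (sum (f ∘ neg)) (sum (f ∘ pos))

    sum-0 : ∀ {n} (f : Fin n → F) → (∀ i → f i ≡ 0#) → sum f ≡ 0#
    sum-0 {n} f e = trans (sum-cong-≗ e) (sum-replicate-zero n)

    sum-single : ∀ {n} (f : Fin n → F) r → (∀ i → i ≢ r → f i ≡ 0#) → sum f ≡ f r
    sum-single f zero e =
      trans (cong (f zero +_) (sum-0 (f ∘ suc) (λ i → e (suc i) λ ()))) (+-identityʳ _)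
    sum-single f (suc r) e =
      trans (cong₂ _+_ (e zero λ ())
              (sum-single (f ∘ suc) r (λ i i≢r → e (suc i) (i≢r ∘ Fin.suc-injective))))
        (+-identityˡ _)

    sum±-0 : ∀ {n} (f : Index n → F) → (∀ i → f i ≡ 0#) → sum± f ≡ 0#
    sum±-0 f e = trans (cong₂ _+_ (sum-0 _ (e ∘ pos)) (sum-0 _ (e ∘ neg))) (+-identityˡ 0#)

    sum±-single : ∀ {n} (f : Index n → F) r → (∀ i → i ≢ r → f i ≡ 0#) → sum± f ≡ f r
    sum±-single f (pos r) e = trans
      (cong₂ _+_ (sum-single (f ∘ pos) r (λ i i≢r → e (pos i) (i≢r ∘ pos-injective)))
                 (sum-0 (f ∘ neg) (λ i → e (neg i) λ ())))
      (+-identityʳ _)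
    sum±-single f (neg r) e = trans
      (cong₂ _+_ (sum-0 (f ∘ pos) (λ i → e (pos i) λ ()))
                 (sum-single (f ∘ neg) r (λ i i≢r → e (neg i) (i≢r ∘ neg-injective))))
      (+-identityˡ _)

    sum±-nonzero : ∀ {n} (f : Index n → F) → sum± f ≢ 0# → ∃[ i ] f i ≢ 0#
    sum±-nonzero f s≢0 with any? (λ i → ¬? (f i ≟ᶠ 0#))
    ... | yes p = p
    ... | no ¬p = contradiction
      (sum±-0 f (λ i → decidable-stable (f i ≟ᶠ 0#) (λ fi≢0 → ¬p (i , fi≢0)))) s≢0

    *-nonzeroˡ : ∀ a b → a * b ≢ 0# → a ≢ 0#
    *-nonzeroˡ a b ab≢0 a≡0 = ab≢0 (trans (cong (_* b) a≡0) (zeroˡ b))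

    *-nonzeroʳ : ∀ a b → a * b ≢ 0# → b ≢ 0#
    *-nonzeroʳ a b ab≢0 b≡0 = ab≢0 (trans (cong (a *_) b≡0) (zeroʳ a))

    module _ {n : ℕ} where

      private M = Mat± n

      ·-cong : {x x′ y y′ : M} → x ≋ x′ → y ≋ y′ → x · y ≋ x′ · y′
      ·-cong p q i j = sum±-cong (λ k → cong₂ _*_ (p i k) (q k j))

      ·-assoc : (x y z : M) → (x · y) · z ≋ x · (y · z)
      ·-assoc x y z i j = begin
        sum± (λ k → sum± (λ l → x i l * y l k) * z k j)
          ≡⟨ sum±-cong (λ k → sum±-*ʳ (z k j) (λ l → x i l * y l k)) ⟩
        sum± (λ k → sum± (λ l → x i l * y l k * z k j))
          ≡⟨ sum±-swap (λ k l → x i l * y l k * z k j) ⟩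
        sum± (λ l → sum± (λ k → x i l * y l k * z k j))
          ≡⟨ sum±-cong (λ l → sum±-cong (λ k → *-assoc (x i l) (y l k) (z k j))) ⟩
        sum± (λ l → sum± (λ k → x i l * (y l k * z k j)))
          ≡⟨ sum±-cong (λ l → sym (sum±-*ˡ (x i l) (λ k → y l k * z k j))) ⟩
        sum± (λ l → x i l * sum± (λ k → y l k * z k j)) ∎

      I±-diag : (i : Index n) → I± i i ≡ 1#
      I±-diag i with i ≟ i
      ... | yes _ = refl
      ... | no i≢i = contradiction refl i≢i

      I±-off : {i j : Index n} → i ≢ j → I± i j ≡ 0#
      I±-off {i} {j} i≢j with i ≟ j
      ... | yes i≡j = contradiction i≡j i≢j
      ... | no _ = refl

      ·-identityˡ : (x : M) → I± · x ≋ x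
      ·-identityˡ x i j = trans
        (sum±-single (λ k → I± i k * x k j) i
          (λ k k≢i → trans (cong (_* x k j) (I±-off (k≢i ∘ sym))) (zeroˡ (x k j))))
        (trans (cong (_* x i j) (I±-diag i)) (*-identityˡ _))

      ·-identityʳ : (x : M) → x · I± ≋ x
      ·-identityʳ x i j = trans
        (sum±-single (λ k → x i k * I± k j) j
          (λ k k≢j → trans (cong (x i k *_) (I±-off k≢j)) (zeroʳ (x i k))))
        (trans (cong (x i j *_) (I±-diag j)) (*-identityʳ _))

      Unitri : M → Set
      Unitri = IsUnitriangular _≺_

      Unitri-resp : {x y : M} → x ≋ y → Unitri x → Unitri y
      Unitri-resp e (d , l) = (λ i → trans (sym (e i i)) (d i)) , (λ i j p → trans (sym (e i j)) (l i j p))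

      unitri-nonzero : {x : M} → Unitri x → ∀ {i j} → x i j ≢ 0# → i ≡ j ⊎ i ≺ j
      unitri-nonzero (_ , l) {i} {j} x≢0 with i ≟ j
      ... | yes p = inj₁ p
      ... | no i≢j with ≺-connex i j i≢j
      ...   | inj₁ p = inj₂ p
      ...   | inj₂ p = contradiction (l i j p) x≢0

      product-zero : {x y : M} → Unitri x → Unitri y →
        ∀ i j k → (¬ ((i ≡ k ⊎ i ≺ k) × (k ≡ j ⊎ k ≺ j))) → x i k * y k j ≡ 0#
      product-zero {x} {y} ux uy i j k no-path = decidable-stable (_ ≟ᶠ 0#) λ p →
        no-path (unitri-nonzero ux (*-nonzeroˡ _ _ p) , unitri-nonzero uy (*-nonzeroʳ (x i k) _ p))

      ·-unitri : {x y : M} → Unitri x → Unitri y → Unitri (x · y)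
      ·-unitri {x} {y} ux uy =
        (λ i → trans (sum±-single _ i (λ k k≢i → product-zero ux uy i i k (noLoop i k k≢i)))
                 (trans (cong₂ _*_ (proj₁ ux i) (proj₁ uy i)) (*-identityˡ 1#))) ,
        (λ i j j≺i → sum±-0 _ (λ k → product-zero ux uy i j k (noPath i j k j≺i)))
        where
        noLoop : ∀ i k → k ≢ i → ¬ ((i ≡ k ⊎ i ≺ k) × (k ≡ i ⊎ k ≺ i))
        noLoop i k k≢i (_ , inj₁ k≡i) = k≢i k≡i
        noLoop i k k≢i (inj₁ i≡k , _) = k≢i (sym i≡k)
        noLoop i k k≢i (inj₂ p , inj₂ q) = ≺-irrefl (≺-trans p q)
        noPath : ∀ i j k → j ≺ i → ¬ ((i ≡ k ⊎ i ≺ k) × (k ≡ j ⊎ k ≺ j))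
        noPath i j k p (inj₁ refl , inj₁ refl) = ≺-irrefl p
        noPath i j k p (inj₁ refl , inj₂ q) = ≺-irrefl (≺-trans p q)
        noPath i j k p (inj₂ q , inj₁ refl) = ≺-irrefl (≺-trans p q)
        noPath i j k p (inj₂ q , inj₂ r) = ≺-irrefl (≺-trans p (≺-trans q r))

      record InverseRow (g : M) (i : Index n) : Set where
        field
          row      : Index n → F
          diagonal : row i ≡ 1#
          lower    : ∀ j → j ≺ i → row j ≡ 0#
          isRow    : ∀ j → sum± (λ k → row k * g k j) ≡ I± i j

      open InverseRow

      inverseRow : (g : M) → Unitri g → ∀ i → Acc (λ a b → b ≺ a) i → InverseRow g i
      inverseRow g (d , l) i (acc rec) = record
        { row = ρ
        ; diagonal = ρ-diag
        ; lower = ρ-lower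
        ; isRow = ρ-row
        }
        where
        c : Index n → F
        c k with i ≺? k
        ... | yes _ = g i k
        ... | no _  = 0#
        r : Index n → Index n → F
        r k with i ≺? k
        ... | yes p = row (inverseRow g (d , l) k (rec p))
        ... | no _  = λ _ → 0#
        ρ : Index n → F
        ρ j = I± i j - sum± (λ k → c k * r k j)
        term-0 : ∀ j → (j ≡ i ⊎ j ≺ i) → ∀ k → c k * r k j ≡ 0#
        term-0 j j≼i k with i ≺? k
        ... | no _ = zeroˡ 0#
        ... | yes p = trans (cong (g i k *_) (lower (inverseRow g (d , l) k (rec p)) j (below j≼i))) (zeroʳ (g i k))
          where
          below : (j ≡ i ⊎ j ≺ i) → j ≺ k
          below (inj₁ refl) = p
          below (inj₂ q) = ≺-trans q p
        ρ-≼ : ∀ j → (j ≡ i ⊎ j ≺ i) → ρ j ≡ I± i j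
        ρ-≼ j j≼i = trans (cong (λ z → I± i j - z) (sum±-0 _ (term-0 j j≼i)))
          (trans (cong (I± i j +_) -0#≈0#) (+-identityʳ _))
        ρ-diag : ρ i ≡ 1#
        ρ-diag = trans (ρ-≼ i (inj₁ refl)) (I±-diag i)
        ρ-lower : ∀ j → j ≺ i → ρ j ≡ 0#
        ρ-lower j p = trans (ρ-≼ j (inj₂ p)) (I±-off {i} {j} (λ { refl → ≺-irrefl p }))
        c-row : ∀ j k → c k * sum± (λ m → r k m * g m j) ≡ c k * I± k j
        c-row j k with i ≺? k
        ... | no _ = trans (zeroˡ _) (sym (zeroˡ (I± k j)))
        ... | yes p = cong (g i k *_) (isRow (inverseRow g (d , l) k (rec p)) j)
        g-c : ∀ j → g i j - c j ≡ I± i j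
        g-c j with i ≺? j
        ... | yes p = trans (-‿inverseʳ (g i j)) (sym (I±-off {i} {j} (λ { refl → ≺-irrefl p })))
        ... | no ¬p = trans (cong (g i j +_) -0#≈0#) (trans (+-identityʳ _) eq)
          where
          eq : g i j ≡ I± i j
          eq with i ≟ j
          ... | yes refl = d i
          ... | no i≢j with ≺-connex i j i≢j
          ...   | inj₁ q = contradiction q ¬p
          ...   | inj₂ q = l i j q
        ρ-row : ∀ j → sum± (λ m → ρ m * g m j) ≡ I± i j
        ρ-row j = begin
          sum± (λ m → ρ m * g m j)
            ≡⟨ sum±-cong (λ m → trans (distribʳ (g m j) (I± i m) _)
                 (cong (I± i m * g m j +_) (sym (-‿distribˡ-* (sum± (λ k → c k * r k m)) (g m j))))) ⟩
          sum± (λ m → I± i m * g m j + - (sum± (λ k → c k * r k m) * g m j))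
            ≡⟨ trans (sum±-+ (λ m → I± i m * g m j) (λ m → - (sum± (λ k → c k * r k m) * g m j)))
                (cong₂ _+_ (·-identityˡ g i j) (sum±-neg (λ m → sum± (λ k → c k * r k m) * g m j))) ⟩
          g i j - sum± (λ m → sum± (λ k → c k * r k m) * g m j)
            ≡⟨ cong (λ z → g i j - z) (·-assoc (λ _ → c) r g i j) ⟩
          g i j - sum± (λ k → c k * sum± (λ m → r k m * g m j))
            ≡⟨ cong (λ z → g i j - z) (trans (sum±-cong (c-row j)) (·-identityʳ (λ _ → c) i j)) ⟩
          g i j - c j
            ≡⟨ g-c j ⟩
          I± i j ∎

      leftInverse : (g : M) → Unitri g → ∃[ g′ ] Unitri g′ × g′ · g ≋ I±
      leftInverse g ug = (λ i → row (inv i)) , ((λ i → diagonal (inv i)) , (λ i → lower (inv i))) , (λ i → isRow (inv i))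
        where
        inv : ∀ i → InverseRow g i
        inv i = inverseRow g ug i (≻-wellFounded i)

      _† : M → M
      (x †) i j = x (opp j) (opp i)

      †-unitri : {x : M} → Unitri x → Unitri (x †)
      †-unitri (d , l) = (λ i → d (opp i)) , (λ i j p → l (opp j) (opp i) (opp-≺ p))

      rightInverse : (h : M) → Unitri h → ∃[ h′ ] Unitri h′ × h · h′ ≋ I±
      rightInverse h uh with leftInverse (h †) (†-unitri uh)
      ... | h′ , uh′ , e = h′ † , †-unitri uh′ , λ i j → begin
        sum± (λ k → h i k * h′ (opp j) (opp k))
          ≡⟨ sum±-cong (λ k → trans (*-comm _ _)
               (cong₂ (λ a b → h′ (opp j) (opp k) * h a b)
                 (sym (opp-involutive i)) (sym (opp-involutive k)))) ⟩
        sum± (λ k → h′ (opp j) (opp k) * h (opp (opp i)) (opp (opp k)))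
          ≡⟨ sum±-opp (λ k → h′ (opp j) k * h (opp (opp i)) (opp k)) ⟩
        sum± (λ k → h′ (opp j) k * h (opp (opp i)) (opp k))
          ≡⟨ e (opp j) (opp i) ⟩
        I± (opp j) (opp i)
          ≡⟨ I±-opp i j ⟩
        I± i j ∎
        where
        I±-opp : ∀ i j → I± (opp j) (opp i) ≡ I± i j
        I±-opp i j with i ≟ j
        ... | yes refl = I±-diag (opp i)
        ... | no i≢j = I±-off (λ p → i≢j
          (trans (sym (opp-involutive i)) (trans (cong opp (sym p)) (opp-involutive j))))

      record IsSparse (y : M) : Set where
        field
          rowwise    : ∀ {i j k} → y i j ≢ 0# → y i k ≢ 0# → j ≡ k
          columnwise : ∀ {i j k} → y i k ≢ 0# → y j k ≢ 0# → i ≡ j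

      open IsSparse

      dPartition-sparse : {y : M} → IsDPartition y → IsSparse y
      dPartition-sparse {y} D = record { rowwise = row-eq ; columnwise = col-eq }
        where
        open IsDPartition D
        row-eq : ∀ {i j k} → y i j ≢ 0# → y i k ≢ 0# → j ≡ k
        row-eq {i} {j} {k} p q with j ≟ k
        ... | yes j≡k = j≡k
        ... | no j≢k with ≺-connex j k j≢k
        ...   | inj₁ r = contradiction (refl , p)
          (proj₁ (nonNesting i k _ (refl , q) j (ordered i j _ (refl , p)) r _))
        ...   | inj₂ r = contradiction (refl , q)
          (proj₁ (nonNesting i j _ (refl , p) k (ordered i k _ (refl , q)) r _))
        col-eq : ∀ {i j k} → y i k ≢ 0# → y j k ≢ 0# → i ≡ j
        col-eq {i} {j} {k} p q with i ≟ j
        ... | yes i≡j = i≡j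
        ... | no i≢j with ≺-connex i j i≢j
        ...   | inj₁ r = contradiction (refl , q)
          (proj₂ (nonNesting i k _ (refl , p) j r (ordered j k _ (refl , q)) _))
        ...   | inj₂ r = contradiction (refl , p)
          (proj₂ (nonNesting j k _ (refl , q) i r (ordered i k _ (refl , p)) _))

      sparse-entries : {g h y z : M} → Unitri g → Unitri h → IsSparse y → IsSparse z →
        g · y ≋ z · h → ∀ j → Acc _≺_ j → ∀ i → y i j ≢ 0# → z i j ≡ y i j
      sparse-entries {g} {h} {y} {z} ug uh sy sz e j (acc rec) i yij≢0 = go
        where
        gy-entry : ∀ i j → y i j ≢ 0# → (g · y) i j ≡ y i j
        gy-entry i j p = trans
          (sum±-single (λ k → g i k * y k j) i (λ k k≢i → decidable-stable (_ ≟ᶠ 0#) λ q →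
            k≢i (columnwise sy (*-nonzeroʳ (g i k) _ q) p)))
          (trans (cong (_* y i j) (proj₁ ug i)) (*-identityˡ _))
        zh-entry : ∀ i j → z i j ≢ 0# → (z · h) i j ≡ z i j
        zh-entry i j p = trans
          (sum±-single (λ k → z i k * h k j) j (λ k k≢j → decidable-stable (_ ≟ᶠ 0#) λ q →
            k≢j (rowwise sz (*-nonzeroˡ _ _ q) p)))
          (trans (cong (z i j *_) (proj₁ uh j)) (*-identityʳ _))
        go : z i j ≡ y i j
        go with sum±-nonzero (λ k → z i k * h k j)
                  (λ p → yij≢0 (trans (sym (gy-entry i j yij≢0)) (trans (e i j) p)))
        ... | c , p with unitri-nonzero uh (*-nonzeroʳ (z i c) _ p)
        ...   | inj₁ refl = trans (sym (zh-entry i j (*-nonzeroˡ _ _ p)))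
                              (trans (sym (e i j)) (gy-entry i j yij≢0))
        ...   | inj₂ c≺j with sum±-nonzero (λ k → g i k * y k c)
                  (λ s → *-nonzeroˡ _ _ p (trans (sym (zh-entry i c (*-nonzeroˡ _ _ p)))
                                             (trans (sym (e i c)) s)))
        ...     | r , s with unitri-nonzero ug (*-nonzeroˡ _ _ s)
        ...       | inj₁ refl =
                    contradiction (subst (_≺ j) (rowwise sy (*-nonzeroʳ (g i r) _ s) yij≢0) c≺j) ≺-irrefl
        ...       | inj₂ i≺r = contradiction (subst (i ≺_) (sym i≡r) i≺r) ≺-irrefl
          where
          yrc≢0 : y r c ≢ 0#
          yrc≢0 = *-nonzeroʳ (g i r) _ s
          zrc≡yrc : z r c ≡ y r c
          zrc≡yrc = sparse-entries ug uh sy sz e c (rec c≺j) r yrc≢0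
          i≡r : i ≡ r
          i≡r = columnwise sz (*-nonzeroˡ _ _ p) (λ q → yrc≢0 (trans (sym zrc≡yrc) q))

      ∈V-entries : {x y z : M} → IsSparse y → IsSparse z → x ∈V y → x ∈V z →
        ∀ i j → y i j ≢ 0# → z i j ≡ y i j
      ∈V-entries {x} {y} {z} sy sz (g₁ , h₁ , ug₁ , uh₁ , e₁) (g₂ , h₂ , ug₂ , uh₂ , e₂) i j
        with leftInverse g₂ ug₂ | rightInverse h₁ uh₁
      ... | g₂′ , ug₂′ , inv₂ | h₁′ , uh₁′ , inv₁ =
        sparse-entries (·-unitri ug₂′ ug₁) (·-unitri uh₂ uh₁′) sy sz eq j (≺-wellFounded j) i
        where
        ≋-refl : {a : M} → a ≋ a
        ≋-refl _ _ = refl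
        left : (g₂′ · x) · h₁′ ≋ (g₂′ · g₁) · y
        left i j = begin
          ((g₂′ · x) · h₁′) i j
            ≡⟨ ·-cong (·-cong (≋-refl {g₂′}) e₁) (≋-refl {h₁′}) i j ⟩
          ((g₂′ · ((g₁ · y) · h₁)) · h₁′) i j
            ≡⟨ ·-assoc g₂′ ((g₁ · y) · h₁) h₁′ i j ⟩
          (g₂′ · (((g₁ · y) · h₁) · h₁′)) i j
            ≡⟨ ·-cong (≋-refl {g₂′}) (·-assoc (g₁ · y) h₁ h₁′) i j ⟩
          (g₂′ · ((g₁ · y) · (h₁ · h₁′))) i j
            ≡⟨ ·-cong (≋-refl {g₂′}) (·-cong (≋-refl {g₁ · y}) inv₁) i j ⟩
          (g₂′ · ((g₁ · y) · I±)) i j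
            ≡⟨ ·-cong (≋-refl {g₂′}) (·-identityʳ (g₁ · y)) i j ⟩
          (g₂′ · (g₁ · y)) i j
            ≡⟨ sym (·-assoc g₂′ g₁ y i j) ⟩
          ((g₂′ · g₁) · y) i j ∎
        right : (g₂′ · x) · h₁′ ≋ z · (h₂ · h₁′)
        right i j = begin
          ((g₂′ · x) · h₁′) i j
            ≡⟨ ·-cong (·-cong (≋-refl {g₂′}) e₂) (≋-refl {h₁′}) i j ⟩
          ((g₂′ · ((g₂ · z) · h₂)) · h₁′) i j
            ≡⟨ ·-cong (·-cong (≋-refl {g₂′}) (·-assoc g₂ z h₂)) (≋-refl {h₁′}) i j ⟩
          ((g₂′ · (g₂ · (z · h₂))) · h₁′) i j
            ≡⟨ ·-cong (λ i j → sym (·-assoc g₂′ g₂ (z · h₂) i j)) (≋-refl {h₁′}) i j ⟩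
          (((g₂′ · g₂) · (z · h₂)) · h₁′) i j
            ≡⟨ ·-cong (·-cong inv₂ (≋-refl {z · h₂})) (≋-refl {h₁′}) i j ⟩
          ((I± · (z · h₂)) · h₁′) i j
            ≡⟨ ·-cong (·-identityˡ (z · h₂)) (≋-refl {h₁′}) i j ⟩
          ((z · h₂) · h₁′) i j
            ≡⟨ ·-assoc z h₂ h₁′ i j ⟩
          (z · (h₂ · h₁′)) i j ∎
        eq : (g₂′ · g₁) · y ≋ z · (h₂ · h₁′)
        eq i j = trans (sym (left i j)) (right i j)

      ∈V-unique : {x y z : M} → IsSparse y → IsSparse z → x ∈V y → x ∈V z → y ≋ z
      ∈V-unique {y = y} {z} sy sz p q i j with y i j ≟ᶠ 0#
      ... | no y≢0 = sym (∈V-entries sy sz p q i j y≢0)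
      ... | yes y≡0 with z i j ≟ᶠ 0#
      ...   | no z≢0 = ∈V-entries sz sy q p i j z≢0
      ...   | yes z≡0 = trans y≡0 (sym z≡0)

      ∈V-resp : {x x′ y y′ : M} → x ≋ x′ → y ≋ y′ → x ∈V y → x′ ∈V y′
      ∈V-resp {y = y} {y′} p q (g , h , ug , uh , e) = g , h , ug , uh , λ i j →
        trans (sym (p i j)) (trans (e i j) (·-cong {g · y} {g · y′} {h} {h} (·-cong {g} {g} (λ _ _ → refl) q) (λ _ _ → refl) i j))

      ∃matrix? : {P : M → Set} → (∀ {x x′} → x ≋ x′ → P x → P x′) →
        (∀ x → Dec (P x)) → Dec (∃ P)
      ∃matrix? resp P? = map′ (λ p → Any.satisfied p)
        (λ (x , p) → Any.map (λ e → resp (λ i j → sym (e i j)) p) (matrices-complete x))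
        (Any.any? P? (matrices n))

      unitri? : (x : M) → Dec (Unitri x)
      unitri? x = all? (λ i → x i i ≟ᶠ 1#) ×-dec
        all? (λ i → all? λ j → j ≺? i →-dec (x i j ≟ᶠ 0#))

      ∈V? : (x y : M) → Dec (x ∈V y)
      ∈V? x y = ∃matrix?
        (λ {g} {g′} e (h , ug , uh , p) → h , Unitri-resp e ug , uh , λ i j →
          trans (p i j) (·-cong {g · y} {g′ · y} {h} {h}
            (·-cong {g} {g′} {y} {y} e (λ _ _ → refl)) (λ _ _ → refl) i j))
        (λ g → ∃matrix?
          (λ e (ug , uh , p) → ug , Unitri-resp e uh , λ i j →
            trans (p i j) (·-cong {g · y} {g · y} (λ _ _ → refl) e i j))
          (λ h → unitri? g ×-dec unitri? h ×-dec
            all? (λ i → all? λ j → x i j ≟ᶠ ((g · y) · h) i j)))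

  abstract
    _∈K?_ : ∀ {n} (x : Uᴰ n) (lam : DPartition n) → Dec (x ∈K lam)
    x ∈K? lam = Disjointness.∈V? (λ i j → matrix x i j - I± i j) (label lam)

  ∈K-resp : ∀ {n} {x x′ : Uᴰ n} lam → matrix x ≋ matrix x′ → x ∈K lam → x′ ∈K lam
  ∈K-resp lam e = Disjointness.∈V-resp {y = label lam} (λ i j → cong (_- I± i j) (e i j)) (λ _ _ → refl)

  ∈K-unique : ∀ {n} {x x′ : Uᴰ n} lam mu → x ∈K lam → x ∈K mu → x′ ∈K mu → x′ ∈K lam
  ∈K-unique {x′ = x′} lam mu p q = Disjointness.∈V-resp {x = λ i j → matrix x′ i j - I± i j} (λ _ _ → refl)
    (λ i j → sym (Disjointness.∈V-unique
      (Disjointness.dPartition-sparse (isDPartition lam))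
      (Disjointness.dPartition-sparse (isDPartition mu)) p q i j))

  module Shift (k l : ℕ) where

    ↑ˡ-mono : ∀ {i j : Fin k} → i Fin.< j → i ↑ˡ l Fin.< j ↑ˡ l
    ↑ˡ-mono {i} {j} = subst₂ ℕ._<_ (sym (Fin.toℕ-↑ˡ i l)) (sym (Fin.toℕ-↑ˡ j l))

    ↑ʳ-mono : ∀ {i j : Fin l} → i Fin.< j → k ↑ʳ i Fin.< k ↑ʳ j
    ↑ʳ-mono {i} {j} p = subst₂ ℕ._<_ (sym (Fin.toℕ-↑ʳ k i)) (sym (Fin.toℕ-↑ʳ k j)) (ℕ.+-monoʳ-< k p)

    inl : Index k → Index (k ℕ.+ l)
    inl = ±map (_↑ˡ l)

    inr : Index l → Index (k ℕ.+ l)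
    inr = ±map (k ↑ʳ_)

    module inl = ±map (_↑ˡ l) ↑ˡ-mono
    module inr = ±map (k ↑ʳ_) ↑ʳ-mono

    split : Index (k ℕ.+ l) → Index k ⊎ Index l
    split (pos i) = Sum.map pos pos (Fin.splitAt k i)
    split (neg i) = Sum.map neg neg (Fin.splitAt k i)

    split-inl : ∀ i → split (inl i) ≡ inj₁ i
    split-inl (pos i) rewrite Fin.splitAt-↑ˡ k i l = refl
    split-inl (neg i) rewrite Fin.splitAt-↑ˡ k i l = refl

    split-inr : ∀ i → split (inr i) ≡ inj₂ i
    split-inr (pos i) rewrite Fin.splitAt-↑ʳ k l i = refl
    split-inr (neg i) rewrite Fin.splitAt-↑ʳ k l i = refl

    data View : Index (k ℕ.+ l) → Set where
      left  : ∀ i → View (inl i)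
      right : ∀ i → View (inr i)

    view : ∀ i → View i
    view (pos i) with Fin.splitAt k i in eq
    ... | inj₁ j = subst (View ∘ pos) (Fin.splitAt⁻¹-↑ˡ eq) (left (pos j))
    ... | inj₂ j = subst (View ∘ pos) (Fin.splitAt⁻¹-↑ʳ eq) (right (pos j))
    view (neg i) with Fin.splitAt k i in eq
    ... | inj₁ j = subst (View ∘ neg) (Fin.splitAt⁻¹-↑ˡ eq) (left (neg j))
    ... | inj₂ j = subst (View ∘ neg) (Fin.splitAt⁻¹-↑ʳ eq) (right (neg j))

    unionLabel : Mat± k → Mat± l → Mat± (k ℕ.+ l)
    unionLabel y z i j = on (split i) (split j)
      where
      on : Index k ⊎ Index l → Index k ⊎ Index l → F
      on (inj₁ i) (inj₁ j) = y i j
      on (inj₂ i) (inj₂ j) = z i j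
      on _        _        = 0#

    module _ (y : Mat± k) (z : Mat± l) where

      data UnionArc (i j : Index (k ℕ.+ l)) (a : F) : Set where
        arcˡ : ∀ i′ j′ → i ≡ inl i′ → j ≡ inl j′ → Arc y i′ j′ a → UnionArc i j a
        arcʳ : ∀ i′ j′ → i ≡ inr i′ → j ≡ inr j′ → Arc z i′ j′ a → UnionArc i j a

      arc⇒union : ∀ i j a → Arc (unionLabel y z) i j a → UnionArc i j a
      arc⇒union i j a (p , a≢0) with view i | view j
      ... | left i′  | left j′  rewrite split-inl i′ | split-inl j′ = arcˡ i′ j′ refl refl (p , a≢0)
      ... | right i′ | right j′ rewrite split-inr i′ | split-inr j′ = arcʳ i′ j′ refl refl (p , a≢0)
      ... | left i′  | right j′ rewrite split-inl i′ | split-inr j′ = contradiction (sym p) a≢0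
      ... | right i′ | left j′  rewrite split-inr i′ | split-inl j′ = contradiction (sym p) a≢0

      union⇒arc : ∀ i j a → UnionArc i j a → Arc (unionLabel y z) i j a
      union⇒arc _ _ a (arcˡ i j refl refl p) rewrite split-inl i | split-inl j = p
      union⇒arc _ _ a (arcʳ i j refl refl p) rewrite split-inr i | split-inr j = p

      inl≢inr : ∀ {i j} → inl i ≢ inr j
      inl≢inr {i} {j} e with trans (sym (split-inl i)) (trans (cong split e) (split-inr j))
      ... | ()

      union-isDPartition : IsDPartition y → IsDPartition z → IsDPartition (unionLabel y z)
      union-isDPartition Y Z = record
        { ordered = λ i j a p → ordered i j (arc⇒union i j a p)
        ; ¬antipodal = λ i j a p → ¬antipodal i j (arc⇒union i j a p)
        ; symmetric = λ i j a p → union⇒arc _ _ _ (symmetric i j (arc⇒union i j a p))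
        ; nonNesting = λ i j a p m i≺m m≺j b →
            (λ q → nestˡ i j m (arc⇒union i j a p) (arc⇒union i m b q) i≺m m≺j) ,
            (λ q → nestʳ i j m (arc⇒union i j a p) (arc⇒union m j b q) i≺m m≺j)
        }
        where
        module Y = IsDPartition Y
        module Z = IsDPartition Z
        ordered : ∀ i j {a} → UnionArc i j a → i ≺ j
        ordered _ _ (arcˡ i j refl refl p) = inl.±map-≺ (Y.ordered i j _ p)
        ordered _ _ (arcʳ i j refl refl p) = inr.±map-≺ (Z.ordered i j _ p)
        ¬antipodal : ∀ i j {a} → UnionArc i j a → j ≢ opp i
        ¬antipodal _ _ (arcˡ i j refl refl p) e =
          Y.¬antipodal i j _ p (inl.±map-injective (trans e (sym (inl.±map-opp i))))
        ¬antipodal _ _ (arcʳ i j refl refl p) e =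
          Z.¬antipodal i j _ p (inr.±map-injective (trans e (sym (inr.±map-opp i))))
        symmetric : ∀ i j {a} → UnionArc i j a → UnionArc (opp j) (opp i) (- a)
        symmetric _ _ (arcˡ i j refl refl p) =
          arcˡ _ _ (sym (inl.±map-opp j)) (sym (inl.±map-opp i)) (Y.symmetric i j _ p)
        symmetric _ _ (arcʳ i j refl refl p) =
          arcʳ _ _ (sym (inr.±map-opp j)) (sym (inr.±map-opp i)) (Z.symmetric i j _ p)
        nestˡ : ∀ i j m {a b} → UnionArc i j a → UnionArc i m b → i ≺ m → ¬ m ≺ j
        nestˡ _ _ _ (arcˡ i j refl refl p) (arcˡ i′ m e refl q) i≺m m≺j
          with refl ← inl.±map-injective e =
          proj₁ (Y.nonNesting i j _ p m (inl.±map-≺⁻¹ i≺m) (inl.±map-≺⁻¹ m≺j) _) q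
        nestˡ _ _ _ (arcʳ i j refl refl p) (arcʳ i′ m e refl q) i≺m m≺j
          with refl ← inr.±map-injective e =
          proj₁ (Z.nonNesting i j _ p m (inr.±map-≺⁻¹ i≺m) (inr.±map-≺⁻¹ m≺j) _) q
        nestˡ _ _ _ (arcˡ i j refl refl p) (arcʳ i′ m e refl q) _ _ = inl≢inr e
        nestˡ _ _ _ (arcʳ i j refl refl p) (arcˡ i′ m e refl q) _ _ = inl≢inr (sym e)
        nestʳ : ∀ i j m {a b} → UnionArc i j a → UnionArc m j b → i ≺ m → ¬ m ≺ j
        nestʳ _ _ _ (arcˡ i j refl refl p) (arcˡ m j′ refl e q) i≺m m≺j
          with refl ← inl.±map-injective e =
          proj₂ (Y.nonNesting i j _ p m (inl.±map-≺⁻¹ i≺m) (inl.±map-≺⁻¹ m≺j) _) q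
        nestʳ _ _ _ (arcʳ i j refl refl p) (arcʳ m j′ refl e q) i≺m m≺j
          with refl ← inr.±map-injective e =
          proj₂ (Z.nonNesting i j _ p m (inr.±map-≺⁻¹ i≺m) (inr.±map-≺⁻¹ m≺j) _) q
        nestʳ _ _ _ (arcˡ i j refl refl p) (arcʳ m j′ refl e q) _ _ = inl≢inr e
        nestʳ _ _ _ (arcʳ i j refl refl p) (arcˡ m j′ refl e q) _ _ = inl≢inr (sym e)

  infixl 6 _⊔↑_

  -- μ ⊔↑ ν = μ ⊔ ν↑ᵏ for μ a D-partition of [±k].
  _⊔↑_ : ∀ {k l} → DPartition k → DPartition l → DPartition (k ℕ.+ l)
  _⊔↑_ {k} {l} mu nu = record
    { label = Shift.unionLabel k l (label mu) (label nu)
    ; isDPartition = Shift.union-isDPartition k l (label mu) (label nu) (isDPartition mu) (isDPartition nu)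
    }

  -- The increasing bijection from {1 , … , ∣A∣} to A; ±map (embed A) is the
  -- inverse of st_A.
  embed : ∀ {n} (A : Subset n) → Fin (card A) → Fin n
  embed (inside  ∷ᵛ A) zero    = zero
  embed (inside  ∷ᵛ A) (suc i) = suc (embed A i)
  embed (outside ∷ᵛ A) i       = suc (embed A i)

  embed-mono : ∀ {n} (A : Subset n) {i j} → i Fin.< j → embed A i Fin.< embed A j
  embed-mono (inside  ∷ᵛ A) {zero}  {suc j} p = ℕ.z<s
  embed-mono (inside  ∷ᵛ A) {suc i} {suc j} (ℕ.s≤s p) = ℕ.s≤s (embed-mono A p)
  embed-mono (outside ∷ᵛ A) p = ℕ.s≤s (embed-mono A p)

  -- st_A (λ|_A)
  st : ∀ {n} (A : Subset n) → DPartition n → DPartition (card A)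
  st A lam = record
    { label = λ i j → label lam (e i) (e j)
    ; isDPartition = record
      { ordered = λ i j a p → ±map-≺⁻¹ (ordered (e i) (e j) a p)
      ; ¬antipodal = λ i j a p q → ¬antipodal (e i) (e j) a p (trans (cong e q) (±map-opp i))
      ; symmetric = λ i j a p → subst₂ (λ i j → Arc (label lam) i j (- a))
          (sym (±map-opp j)) (sym (±map-opp i)) (symmetric (e i) (e j) a p)
      ; nonNesting = λ i j a p k i≺k k≺j b →
          nonNesting (e i) (e j) a p (e k) (±map-≺ i≺k) (±map-≺ k≺j) b
      }
    }
    where
    e : Index (card A) → Index _
    e = ±map (embed A)
    open ±map (embed A) (embed-mono A)
    open IsDPartition (isDPartition lam)

  infix 4 _∈±_

  _∈±_ : ∀ {n} → Index n → Subset n → Set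
  pos i ∈± A = i ∈ˢ A
  neg i ∈± A = i ∈ˢ A

  _∈±?_ : ∀ {n} (i : Index n) (A : Subset n) → Dec (i ∈± A)
  pos i ∈±? A = i ∈ˢ? A
  neg i ∈±? A = i ∈ˢ? A

  -- The arcs of λ|_A, as arcs on [±n].
  RestrictedArc : ∀ {n} → DPartition n → Subset n → Index n → Index n → F → Set
  RestrictedArc lam A i j a = Arc (label lam) i j a × i ∈± A × j ∈± A

  -- λ = λ|_A ⊔ λ|_{Aᶜ}; the other inclusion holds for every A.
  SplitsAlong : ∀ {n} → DPartition n → Subset n → Set
  SplitsAlong lam A = ∀ i j a → Arc (label lam) i j a →
    RestrictedArc lam A i j a ⊎ RestrictedArc lam (∁ A) i j a

  splitsAlong? : ∀ {n} (lam : DPartition n) A → Dec (SplitsAlong lam A)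
  splitsAlong? lam A = all? λ i → all? λ j → allᶠ? λ a → arc? (label lam) i j a →-dec
    ((arc? (label lam) i j a ×-dec i ∈±? A ×-dec j ∈±? A) ⊎-dec
     (arc? (label lam) i j a ×-dec i ∈±? ∁ A ×-dec j ∈±? ∁ A))

  subsets : ∀ n → List (Subset n)
  subsets ℕ.zero    = [ []ᵛ ]
  subsets (ℕ.suc n) = map (inside ∷ᵛ_) (subsets n) ++ map (outside ∷ᵛ_) (subsets n)

  ∅ᴰ : DPartition 0
  ∅ᴰ = record
    { label = λ { (pos ()) ; (neg ()) }
    ; isDPartition = record
      { ordered = λ { (pos ()) ; (neg ()) }
      ; ¬antipodal = λ { (pos ()) ; (neg ()) }
      ; symmetric = λ { (pos ()) ; (neg ()) }
      ; nonNesting = λ { (pos ()) ; (neg ()) }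
      }
    }

  1ᵁ₀ : Uᴰ 0
  1ᵁ₀ = record
    { matrix = I±
    ; isUᴰ = record
      { P = I ; P⁻¹ = I ; Q = I
      ; P∈U = (λ ()) , (λ ())
      ; P∙P⁻¹ = λ () ; P⁻¹∙P = λ () ; JQᵗJ = λ ()
      ; blocks = λ { (pos ()) ; (neg ()) }
      }
    }

module SuperclassFunctions {q : ℕ} (𝔽 : FiniteField q) (R : CommutativeRing 0ℓ 0ℓ) where

  open Group 𝔽 public
    using (Mat±; _≋_; Uᴰ; matrix; DPartition; Arc; dPartitions; _⊑_; _⊑?_; _∈K_; _∈K?_; ∈K-resp; ∈K-unique;
           _⊔↑_; st; SplitsAlong; splitsAlong?; subsets; ∅ᴰ; 1ᵁ₀)
  open Linear R public
  private module R = CommutativeRing R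

  record SuperclassFunction (n : ℕ) : Set where
    field
      fn       : Uᴰ n → R.Carrier
      fn-cong  : ∀ x y → matrix x ≋ matrix y → fn x R.≈ fn y
      constant : ∀ lam x y → x ∈K lam → y ∈K lam → fn x R.≈ fn y

  open SuperclassFunction public

  SCᴰ₂ : ℕ → Mod
  SCᴰ₂ n = record
    { Carrierᴹ = SuperclassFunction n
    ; _≈ᴹ_ = λ f g → ∀ x → fn f x R.≈ fn g x
    ; _+ᴹ_ = λ f g → record
        { fn = λ x → fn f x R.+ fn g x
        ; fn-cong = λ x y e → R.+-cong (fn-cong f x y e) (fn-cong g x y e)
        ; constant = λ lam x y p q → R.+-cong (constant f lam x y p q) (constant g lam x y p q) }
    ; _*ₗ_ = λ r f → record
        { fn = λ x → r R.* fn f x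
        ; fn-cong = λ x y e → R.*-congˡ (fn-cong f x y e)
        ; constant = λ lam x y p q → R.*-congˡ (constant f lam x y p q) }
    ; 0ᴹ = record
        { fn = λ _ → R.0# ; fn-cong = λ _ _ _ → R.refl ; constant = λ _ _ _ _ _ → R.refl }
    ; -ᴹ_ = λ f → record
        { fn = λ x → R.- fn f x
        ; fn-cong = λ x y e → R.-‿cong (fn-cong f x y e)
        ; constant = λ lam x y p q → R.-‿cong (constant f lam x y p q) }
    ; isLeftModule = record
      { isLeftSemimodule = record
        { +ᴹ-isCommutativeMonoid = record
          { isMonoid = record
            { isSemigroup = record
              { isMagma = record
                { isEquivalence = record
                  { refl = λ _ → R.refl
                  ; sym = λ e x → R.sym (e x)
                  ; trans = λ e e′ x → R.trans (e x) (e′ x)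
                  }
                ; ∙-cong = λ e e′ x → R.+-cong (e x) (e′ x)
                }
              ; assoc = λ f g h x → R.+-assoc (fn f x) (fn g x) (fn h x)
              }
            ; identity = (λ f x → R.+-identityˡ (fn f x)) , (λ f x → R.+-identityʳ (fn f x))
            }
          ; comm = λ f g x → R.+-comm (fn f x) (fn g x)
          }
        ; isPreleftSemimodule = record
          { *ₗ-cong = λ r≈s e x → R.*-cong r≈s (e x)
          ; *ₗ-zeroˡ = λ f x → R.zeroˡ (fn f x)
          ; *ₗ-distribʳ = λ f r s x → R.distribʳ (fn f x) r s
          ; *ₗ-identityˡ = λ f x → R.*-identityˡ (fn f x)
          ; *ₗ-assoc = λ r s f x → R.*-assoc r s (fn f x)
          ; *ₗ-zeroʳ = λ r x → R.zeroʳ r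
          ; *ₗ-distribˡ = λ r f g x → R.distribˡ r (fn f x) (fn g x)
          }
        }
      ; -ᴹ‿cong = λ e x → R.-‿cong (e x)
      ; -ᴹ‿inverse = (λ f x → R.-‿inverseˡ (fn f x)) , (λ f x → R.-‿inverseʳ (fn f x))
      }
    }

  κ : ∀ {n} → DPartition n → SuperclassFunction n
  κ lam = record
    { fn = λ x → indicator (x ∈K? lam)
    ; fn-cong = λ x y e → indicator-cong (x ∈K? lam) (y ∈K? lam) (∈K-resp {x = x} {y} lam e)
                            (∈K-resp {x = y} {x} lam (λ i j → sym (e i j)))
    ; constant = λ mu x y p q → indicator-cong (x ∈K? lam) (y ∈K? lam) (λ r → ∈K-unique {x = x} {y} lam mu r p q)
                                           (λ r → ∈K-unique {x = y} {x} lam mu r q p)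
    }
    where
    indicator : {A : Set} → Dec A → R.Carrier
    indicator d = Bool.if does d then R.1# else R.0#
    indicator-cong : {A B : Set} (d : Dec A) (e : Dec B) → (A → B) → (B → A) →
                     indicator d R.≈ indicator e
    indicator-cong (yes _) (yes _) f g = R.refl
    indicator-cong (yes p) (no ¬q) f g = contradiction (f p) ¬q
    indicator-cong (no ¬p) (yes q) f g = contradiction (g q) ¬p
    indicator-cong (no _)  (no _)  f g = R.refl

  SCᴰ : Mod
  SCᴰ = ⨁ SCᴰ₂

  -- For n fixed, P λ = Σ_{μ ⊇ λ} κ μ.
  P₂ : ∀ {n} → DPartition n → SuperclassFunction n
  P₂ {n} lam = sumᴸ (SCᴰ₂ n) (filter (lam ⊑?_) (dPartitions n)) κ

  P : ∀ {n} → DPartition n → ∣ SCᴰ ∣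
  P {n} lam = ι SCᴰ₂ n (P₂ lam)

  unit : ∣ SCᴰ ∣
  unit = ι SCᴰ₂ 0 (κ ∅ᴰ)

  -- A function f on the trivial group U^D_0 equals f(1) κ_∅.
  counit : SCᴰ ⟶ 𝕂
  counit = linear {SCᴰ} {𝕂} (λ f → fn (component f 0) 1ᵁ₀) (λ e → e 0 1ᵁ₀)
    (λ _ _ → R.refl) (λ _ _ → R.refl)

  ProductRule : (SCᴰ ⊗ᴹ SCᴰ ⟶ SCᴰ) → Set
  ProductRule m = ∀ {k l} (mu : DPartition k) (nu : DPartition l) →
    (m $ P mu ⊗ P nu) ≈[ SCᴰ ] P (mu ⊔↑ nu)

  CoproductRule : (SCᴰ ⟶ SCᴰ ⊗ᴹ SCᴰ) → Set
  CoproductRule Δ = ∀ {n} (lam : DPartition n) →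
    (Δ $ P lam) ≈[ SCᴰ ⊗ᴹ SCᴰ ]
    sumᴸ (SCᴰ ⊗ᴹ SCᴰ) (filter (splitsAlong? lam) (subsets n)) (λ A → P (st A lam) ⊗ P (st (∁ A) lam))

{-# OPTIONS --safe #-}
module Submission where

open import Algebra.Bundles using (Ring; CommutativeRing; CommutativeMonoid)
open import Algebra.Module.Bundles using (LeftModule)
import Algebra.Properties.CommutativeSemigroup as CommutativeSemigroupProperties
import Algebra.Properties.Group as GroupProperties
import Algebra.Properties.Monoid.Mult as MonoidMult
import Algebra.Properties.Ring as RingProperties
import Algebra.Properties.Semiring.Sum as SemiringSum
open import Data.Bool.Base as Bool using (Bool; true; false; not)
open import Data.Bool.Properties using (not-injective)
open import Data.Fin.Base as Fin using (Fin; zero; suc; toℕ; inject₁; opposite; _↑ˡ_; _↑ʳ_)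
import Data.Fin.Induction as Fin
import Data.Fin.Properties as Fin
open import Data.Fin.Subset using (Subset; inside; outside; ∁; ⊤; ⊥) renaming (∣_∣ to card)
open import Data.Fin.Subset.Properties using (∣⊥∣≡0; ∣p∣≤n; ∣∁p∣≡n∸∣p∣)
open import Data.List.Base using (List; []; _∷_; _++_; map; filter; length; mapMaybe)
open import Data.List.Properties using (length-filter)
open import Data.List.Relation.Unary.All using (All; []; _∷_)
open import Data.List.Relation.Unary.AllPairs as AllPairs using (AllPairs; []; _∷_)
open import Data.List.Relation.Unary.Any as Any using (Any; here; there)
import Data.List.Relation.Unary.Any.Properties as Any
import Data.List.Relation.Unary.Unique.Propositional.Properties as UniqueP
import Data.List.Relation.Unary.Unique.Setoid as Unique
import Data.List.Relation.Unary.Unique.Setoid.Properties as Unique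
open import Data.Maybe.Base as Maybe using (Maybe; just; nothing)
import Data.Maybe.Relation.Unary.Any as MAny
open import Data.Nat.Base as ℕ using (ℕ; zero; suc; _≤_; _^_; s≤s; z≤n)
open import Data.Nat.Divisibility using (_∤_; m%n≡0⇒n∣m; ∣1⇒≡1)
open import Data.Nat.DivMod using (m≡m%n+[m/n]*n; m%n<n)
open import Data.Nat.Primality using (Prime; euclidsLemma; prime[2]; prime⇒irreducible)
import Data.Nat.Properties as ℕ
open import Data.Product.Base using (∃; ∃-syntax; Σ-syntax; _×_; _,_; proj₁; proj₂)
open import Data.Sum.Base using (_⊎_; inj₁; inj₂)
open import Data.Vec.Base as Vec using (Vec; lookup) renaming ([] to []ᵛ; _∷_ to _∷ᵛ_; _++_ to _++ᵛ_)
import Data.Vec.Functional as Vector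
import Data.Vec.Properties as Vec
open import Function.Base using (_∘_; case_of_; id)
open import Function.Bundles using (_↔_; Inverse; mk↔ₛ′)
open import Function.Construct.Composition using (_↔-∘_)
open import Function.Construct.Symmetry using (↔-sym)
open import Induction.WellFounded using (Acc; acc)
open import Level using (0ℓ)
open import Relation.Binary.Bundles using (Setoid)
open import Relation.Binary.Definitions using (tri<; tri≈; tri>)
open import Relation.Binary.PropositionalEquality
  using (_≡_; _≢_; refl; sym; trans; cong; cong₂; subst; subst₂; module ≡-Reasoning)
open import Relation.Binary.PropositionalEquality.Properties using () renaming (setoid to ≡-setoid)
import Relation.Binary.Reasoning.Setoid as SetoidReasoning
open import Relation.Nullary using (Dec; yes; no; does; ¬_; contradiction; ¬?)
open import Relation.Nullary.Decidable using (_×-dec_; _→-dec_; decidable-stable; dec⇒maybe)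
open import Defs

-- The superclass K λ is nonempty since it contains the Cayley transform
-- (1 + y/2)(1 - y/2)⁻¹ of y = y_λ.  The superclasses cover the group: Gaussian
-- elimination writes x - 1 = g y h with g, h unitriangular and y having at most
-- one nonzero entry in each row and column, and x† = x⁻¹ for the adjoint † of the
-- form gives x - 1 = - x (x - 1)†, so - y† is another such normal form and y = - y†,
-- which makes y a D-partition.  Hence the κ λ, and by Möbius inversion the P λ,
-- form a basis, and every identity of linear maps can be checked on the P λ.
-- There the bialgebra axioms are bijections between families of subsets of [n];
-- coassociativity compares two descriptions of the 3-colourings of [n] that are
-- constant on arcs.  The antipode is the inverse of the identity in the convolution
-- ring, a geometric series that is finite in each degree since id - ηε kills degree 0.

-- Finite sums, Möbius inversion and direct sums of modules

-- Odd characteristic enters only through an element `half` with half + half = 1. It makes the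
-- Cayley transform possible, and it turns y = - y† into the absence of arcs from i to -i, whose
-- labels would equal their own negatives. Besides their disjointness, two facts about superclasses
-- suffice for the rest, that they cover the group and are nonempty: a point chosen in each K λ
-- makes the coefficients of a function in the basis κ its values at these points. From there on the
-- coefficients may come from any commutative ring, and no equality of coefficients is ever decided.
-- Two weak forms of equality shape the bookkeeping. Label functions are compared only pointwise, so
-- lists of D-partitions are complete and free of repetitions up to `≃`, and every map prescribed on
-- the basis must respect it. And a restriction to A lives on card A letters, while the same set
-- reached through two successive restrictions has a size that is equal only propositionally. Such
-- restrictions are compared by `≅`, which holds because both are pulled back along increasing maps
-- with the same image.

module Sums (R : CommutativeRing 0ℓ 0ℓ) where

  open Linear R
  private module R = CommutativeRing R

  module SumsIn (M : Mod) where

    open LeftModule M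
    open SetoidReasoning ≈ᴹ-setoid
    open CommutativeSemigroupProperties
      (CommutativeMonoid.commutativeSemigroup +ᴹ-commutativeMonoid) using (interchange)

    Σ : {A : Set} → List A → (A → ∣ M ∣) → ∣ M ∣
    Σ = sumᴸ M

    when : {P : Set} → Dec P → ∣ M ∣ → ∣ M ∣
    when d x = Bool.if does d then x else 0ᴹ

    when-yes : {P : Set} (d : Dec P) → P → ∀ x → when d x ≈ᴹ x
    when-yes (yes _) p x = ≈ᴹ-refl
    when-yes (no ¬p) p x = contradiction p ¬p

    when-no : {P : Set} (d : Dec P) → ¬ P → ∀ x → when d x ≈ᴹ 0ᴹ
    when-no (yes p) ¬p x = contradiction p ¬p
    when-no (no _)  ¬p x = ≈ᴹ-refl

    when-0 : {P : Set} (d : Dec P) → ∀ {x} → x ≈ᴹ 0ᴹ → when d x ≈ᴹ 0ᴹ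
    when-0 (yes _) e = e
    when-0 (no _)  e = ≈ᴹ-refl

    when-cong : {P Q : Set} (d : Dec P) (e : Dec Q) → (P → Q) → (Q → P) →
      ∀ {x y} → (P → x ≈ᴹ y) → when d x ≈ᴹ when e y
    when-cong (yes p) (yes _) f g x≈y = x≈y p
    when-cong (yes p) (no ¬q) f g x≈y = contradiction (f p) ¬q
    when-cong (no ¬p) (yes q) f g x≈y = contradiction (g q) ¬p
    when-cong (no _)  (no _)  f g x≈y = ≈ᴹ-refl

    module _ {A : Set} where

      Σ-cong : (xs : List A) {f g : A → ∣ M ∣} → (∀ a → f a ≈ᴹ g a) → Σ xs f ≈ᴹ Σ xs g
      Σ-cong []       e = ≈ᴹ-refl
      Σ-cong (x ∷ xs) e = +ᴹ-cong (e x) (Σ-cong xs e)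

      Σ-0 : (xs : List A) {f : A → ∣ M ∣} → (∀ a → f a ≈ᴹ 0ᴹ) → Σ xs f ≈ᴹ 0ᴹ
      Σ-0 []       e = ≈ᴹ-refl
      Σ-0 (x ∷ xs) e = ≈ᴹ-trans (+ᴹ-cong (e x) (Σ-0 xs e)) (+ᴹ-identityˡ 0ᴹ)

      Σ-++ : (xs ys : List A) (f : A → ∣ M ∣) → Σ (xs ++ ys) f ≈ᴹ Σ xs f +ᴹ Σ ys f
      Σ-++ []       ys f = ≈ᴹ-sym (+ᴹ-identityˡ _)
      Σ-++ (x ∷ xs) ys f = ≈ᴹ-trans (+ᴹ-congˡ (Σ-++ xs ys f)) (≈ᴹ-sym (+ᴹ-assoc _ _ _))

      Σ-+ : (xs : List A) (f g : A → ∣ M ∣) → Σ xs (λ a → f a +ᴹ g a) ≈ᴹ Σ xs f +ᴹ Σ xs g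
      Σ-+ []       f g = ≈ᴹ-sym (+ᴹ-identityˡ 0ᴹ)
      Σ-+ (x ∷ xs) f g = ≈ᴹ-trans (+ᴹ-congˡ (Σ-+ xs f g)) (interchange _ _ _ _)

      Σ-* : ∀ (xs : List A) r (f : A → ∣ M ∣) → Σ xs (λ a → r *ₗ f a) ≈ᴹ r *ₗ Σ xs f
      Σ-* []       r f = ≈ᴹ-sym (*ₗ-zeroʳ r)
      Σ-* (x ∷ xs) r f = ≈ᴹ-trans (+ᴹ-congˡ (Σ-* xs r f)) (≈ᴹ-sym (*ₗ-distribˡ r _ _))

      Σ-filter : {P : A → Set} (P? : ∀ a → Dec (P a)) (xs : List A) (f : A → ∣ M ∣) →
        Σ (filter P? xs) f ≈ᴹ Σ xs (λ a → when (P? a) (f a))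
      Σ-filter P? []       f = ≈ᴹ-refl
      Σ-filter P? (x ∷ xs) f with P? x
      ... | yes _ = +ᴹ-congˡ (Σ-filter P? xs f)
      ... | no _  = ≈ᴹ-trans (Σ-filter P? xs f) (≈ᴹ-sym (+ᴹ-identityˡ _))

    Σ-map : {A B : Set} (h : A → B) (xs : List A) (f : B → ∣ M ∣) → Σ (map h xs) f ≈ᴹ Σ xs (f ∘ h)
    Σ-map h []       f = ≈ᴹ-refl
    Σ-map h (x ∷ xs) f = +ᴹ-congˡ (Σ-map h xs f)

    when-Σ : {P A : Set} (d : Dec P) (xs : List A) (f : A → ∣ M ∣) →
      when d (Σ xs f) ≈ᴹ Σ xs (λ a → when d (f a))
    when-Σ (yes _) xs f = ≈ᴹ-refl
    when-Σ (no _)  xs f = ≈ᴹ-sym (Σ-0 xs (λ _ → ≈ᴹ-refl))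

    when-× : {P Q : Set} (d : Dec P) (e : Dec Q) → ∀ x → when d (when e x) ≈ᴹ when (d ×-dec e) x
    when-× (yes _) (yes _) x = ≈ᴹ-refl
    when-× (yes _) (no _)  x = ≈ᴹ-refl
    when-× (no _)  e       x = ≈ᴹ-refl

    when-split : {P Q : Set} (d : Dec P) (e : Dec Q) → ∀ x →
      when d x ≈ᴹ when (d ×-dec e) x +ᴹ when (d ×-dec ¬? e) x
    when-split (yes _) (yes _) x = ≈ᴹ-sym (+ᴹ-identityʳ x)
    when-split (yes _) (no _)  x = ≈ᴹ-sym (+ᴹ-identityˡ x)
    when-split (no _)  e       x = ≈ᴹ-sym (+ᴹ-identityʳ 0ᴹ)

    -- Only one term survives. The relation `_~_` stands in for equality because D-partitions are
    -- listed without repetition only up to pointwise equality of labels.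
    Σ-single : {A : Set} {_~_ : A → A → Set} → (∀ {a b} → a ~ b → b ~ a) → (∀ {a b c} → a ~ b → b ~ c → a ~ c) →
      ∀ {xs a} → AllPairs (λ b c → ¬ b ~ c) xs → Any (_~ a) xs →
      ∀ {f v} → (∀ b → b ~ a → f b ≈ᴹ v) → (∀ b → ¬ b ~ a → f b ≈ᴹ 0ᴹ) → Σ xs f ≈ᴹ v
    Σ-single {A} {_~_} ~-sym ~-trans {a = a} = go
      where
      zeros : ∀ {b xs} → All (λ c → ¬ b ~ c) xs → b ~ a → ∀ {f} → (∀ b → ¬ b ~ a → f b ≈ᴹ 0ᴹ) → Σ xs f ≈ᴹ 0ᴹ
      zeros []        b~a off = ≈ᴹ-refl
      zeros (¬p ∷ ps) b~a off = ≈ᴹ-trans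
        (+ᴹ-cong (off _ (λ c~a → ¬p (~-trans b~a (~-sym c~a)))) (zeros ps b~a off)) (+ᴹ-identityˡ 0ᴹ)
      apart : ∀ {b xs} → All (λ c → ¬ b ~ c) xs → Any (_~ a) xs → ¬ b ~ a
      apart (¬p ∷ _) (here c~a) b~a = ¬p (~-trans b~a (~-sym c~a))
      apart (_ ∷ ps) (there q)  b~a = apart ps q b~a
      go : ∀ {xs} → AllPairs (λ b c → ¬ b ~ c) xs → Any (_~ a) xs →
        ∀ {f v} → (∀ b → b ~ a → f b ≈ᴹ v) → (∀ b → ¬ b ~ a → f b ≈ᴹ 0ᴹ) → Σ xs f ≈ᴹ v
      go (ps ∷ _)  (here b~a) on off = ≈ᴹ-trans (+ᴹ-cong (on _ b~a) (zeros ps b~a off)) (+ᴹ-identityʳ _)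
      go (ps ∷ us) (there q)  on off = ≈ᴹ-trans (+ᴹ-cong (off _ (apart ps q)) (go us q on off)) (+ᴹ-identityˡ _)

  module _ {M N : Mod} (f : M ⟶ N) where

    private
      module M = SumsIn M
      module N = SumsIn N
      module f = _⟶_ f
    open LeftModule N

    Σ-homo : {A : Set} (xs : List A) (g : A → ∣ M ∣) → (f $ M.Σ xs g) ≈ᴹ N.Σ xs (λ a → f $ g a)
    Σ-homo []       g = f.0ᴹ-homo
    Σ-homo (x ∷ xs) g = ≈ᴹ-trans (f.+ᴹ-homo _ _) (+ᴹ-congˡ (Σ-homo xs g))

  -- `⊑` is a preorder here, with `≃` its induced equivalence. The sums are inverted by recursion
  -- from the top, measured by `height`, instead of through an explicit Möbius function.
  module MöbiusInversion {A : Set} {_⊑_ : A → A → Set} (_⊑?_ : ∀ a b → Dec (a ⊑ b))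
    (⊑-refl : ∀ {a} → a ⊑ a) (⊑-trans : ∀ {a b c} → a ⊑ b → b ⊑ c → a ⊑ c) (xs : List A)
    (complete : ∀ a → Any (λ b → b ⊑ a × a ⊑ b) xs)
    (unique : AllPairs (λ a b → ¬ (a ⊑ b × b ⊑ a)) xs) where

    _≃_ : A → A → Set
    a ≃ b = a ⊑ b × b ⊑ a

    ≃-sym : ∀ {a b} → a ≃ b → b ≃ a
    ≃-sym (p , q) = q , p

    ≃-trans : ∀ {a b c} → a ≃ b → b ≃ c → a ≃ c
    ≃-trans (p , q) (p′ , q′) = ⊑-trans p p′ , ⊑-trans q′ q

    _⊏?_ : ∀ a b → Dec (a ⊑ b × ¬ b ⊑ a)
    a ⊏? b = (a ⊑? b) ×-dec ¬? (b ⊑? a)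

    count : List A → A → ℕ
    count ys a = length (filter (a ⊑?_) ys)

    height : A → ℕ
    height = count xs

    count-≤ : ∀ ys {a b} → a ⊑ b → count ys b ℕ.≤ count ys a
    count-≤ [] p = z≤n
    count-≤ (y ∷ ys) {a} {b} p with a ⊑? y | b ⊑? y
    ... | yes _ | yes _ = s≤s (count-≤ ys p)
    ... | yes _ | no _  = ℕ.m≤n⇒m≤1+n (count-≤ ys p)
    ... | no ¬q | yes q = contradiction (⊑-trans p q) ¬q
    ... | no _  | no _  = count-≤ ys p

    -- The entry equivalent to a is counted for a but not for b, while everything counted for b is
    -- counted for a by transitivity.
    count-< : ∀ ys {a b} → a ⊑ b → ¬ b ⊑ a → Any (_≃ a) ys → count ys b ℕ.< count ys a
    count-< (y ∷ ys) {a} {b} p ¬p (here (y⊑a , a⊑y)) with a ⊑? y | b ⊑? y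
    ... | _      | yes q = contradiction (⊑-trans q y⊑a) ¬p
    ... | yes _  | no _  = s≤s (count-≤ ys p)
    ... | no ¬q  | no _  = contradiction a⊑y ¬q
    count-< (y ∷ ys) {a} {b} p ¬p (there q) with a ⊑? y | b ⊑? y
    ... | yes _ | yes _ = s≤s (count-< ys p ¬p q)
    ... | yes _ | no _  = ℕ.m≤n⇒m≤1+n (count-< ys p ¬p q)
    ... | no ¬r | yes r = contradiction (⊑-trans p r) ¬r
    ... | no _  | no _  = count-< ys p ¬p q

    height-< : ∀ {a b} → a ⊑ b × ¬ b ⊑ a → height b ℕ.< height a
    height-< {a} (p , ¬p) = count-< xs p ¬p (complete a)

    module _ (M : Mod) where

      open LeftModule M
      open SumsIn M
      open SetoidReasoning ≈ᴹ-setoid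
      open GroupProperties +ᴹ-group using (∙-cancelʳ)

      above strictlyAbove : (A → ∣ M ∣) → A → ∣ M ∣
      above h a = Σ xs (λ b → when (a ⊑? b) (h b))
      strictlyAbove h a = Σ xs (λ b → when (a ⊏? b) (h b))

      Respects : (A → ∣ M ∣) → Set
      Respects h = ∀ {a b} → a ≃ b → h a ≈ᴹ h b

      strictlyAbove-cong : ∀ {g h} a b → a ≃ b → (∀ c → a ⊑ c × ¬ c ⊑ a → g c ≈ᴹ h c) →
        strictlyAbove g a ≈ᴹ strictlyAbove h b
      strictlyAbove-cong a b (p , q) e = Σ-cong xs λ c → when-cong (a ⊏? c) (b ⊏? c)
        (λ (r , ¬r) → ⊑-trans q r , λ s → ¬r (⊑-trans s q))
        (λ (r , ¬r) → ⊑-trans p r , λ s → ¬r (⊑-trans s p)) (e c)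

      -- Among the elements above a, those also below a form the class of a, which the list meets
      -- exactly once.
      above-split : ∀ {h} → Respects h → ∀ a → above h a ≈ᴹ h a +ᴹ strictlyAbove h a
      above-split {h} resp a = begin
        above h a
          ≈⟨ Σ-cong xs (λ b → when-split (a ⊑? b) (b ⊑? a) (h b)) ⟩
        Σ xs (λ b → when ((a ⊑? b) ×-dec (b ⊑? a)) (h b) +ᴹ when (a ⊏? b) (h b))
          ≈⟨ Σ-+ xs _ _ ⟩
        Σ xs (λ b → when ((a ⊑? b) ×-dec (b ⊑? a)) (h b)) +ᴹ strictlyAbove h a
          ≈⟨ +ᴹ-congʳ (Σ-single ≃-sym ≃-trans unique (complete a)
               (λ b b≃a → ≈ᴹ-trans (when-yes ((a ⊑? b) ×-dec (b ⊑? a)) (≃-sym b≃a) (h b)) (resp b≃a))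
               (λ b b≄a → when-no ((a ⊑? b) ×-dec (b ⊑? a)) (b≄a ∘ ≃-sym) (h b))) ⟩
        h a +ᴹ strictlyAbove h a ∎

      module _ (g : A → ∣ M ∣) (g-resp : Respects g) where

        -- Unrolls the recursion h a = g a - (sum of h over the elements strictly above a) to depth
        -- s, starting from g.
        approx : ℕ → A → ∣ M ∣
        approx zero    a = g a
        approx (suc s) a = g a +ᴹ -ᴹ strictlyAbove (approx s) a

        approx-resp : ∀ s → Respects (approx s)
        approx-resp zero    a≃b = g-resp a≃b
        approx-resp (suc s) {a} {b} a≃b = +ᴹ-cong (g-resp a≃b)
          (-ᴹ‿cong (strictlyAbove-cong a b a≃b (λ _ _ → ≈ᴹ-refl)))

        -- Elements strictly above a have smaller height, so depth s suffices once s reaches the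
        -- height of a. No height exceeds the length of the list, hence the depth chosen in
        -- `inversion`.
        approx-stable : ∀ s a → height a ℕ.≤ s → approx s a ≈ᴹ approx (suc s) a
        approx-stable zero a h≤0 = ≈ᴹ-sym (≈ᴹ-trans (+ᴹ-congˡ (≈ᴹ-trans (-ᴹ‿cong (Σ-0 xs λ b →
          when-no (a ⊏? b) (λ p → case ℕ.≤-trans (height-< p) h≤0 of λ ()) (g b)))
          (GroupProperties.ε⁻¹≈ε +ᴹ-group))) (+ᴹ-identityʳ (g a)))
        approx-stable (suc s) a h≤s = +ᴹ-congˡ (-ᴹ‿cong (strictlyAbove-cong a a (⊑-refl , ⊑-refl)
          (λ b p → approx-stable s b (ℕ.≤-pred (ℕ.≤-trans (height-< p) h≤s)))))

        inversion : A → ∣ M ∣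
        inversion = approx (length xs)

        inversion-resp : Respects inversion
        inversion-resp = approx-resp (length xs)

        above-inversion : ∀ a → above inversion a ≈ᴹ g a
        above-inversion a = begin
          above inversion a
            ≈⟨ above-split inversion-resp a ⟩
          inversion a +ᴹ strictlyAbove inversion a
            ≈⟨ +ᴹ-congʳ (approx-stable (length xs) a (length-filter (a ⊑?_) xs)) ⟩
          g a +ᴹ -ᴹ strictlyAbove inversion a +ᴹ strictlyAbove inversion a
            ≈⟨ ≈ᴹ-trans (+ᴹ-assoc _ _ _) (≈ᴹ-trans (+ᴹ-congˡ (-ᴹ‿inverseˡ _)) (+ᴹ-identityʳ _)) ⟩
          g a ∎

      -- Downward induction: once g and h agree strictly above a, these parts cancel from the two
      -- equal sums and leave g a and h a.
      above-injective : ∀ {g h} → Respects g → Respects h →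
        (∀ a → above g a ≈ᴹ above h a) → ∀ a → g a ≈ᴹ h a
      above-injective {g} {h} g-resp h-resp e a = go (height a) a ℕ.≤-refl
        where
        go : ∀ s a → height a ℕ.≤ s → g a ≈ᴹ h a
        go s a h≤s = ∙-cancelʳ (strictlyAbove h a) (g a) (h a) (begin
          g a +ᴹ strictlyAbove h a
            ≈⟨ +ᴹ-congˡ (strictlyAbove-cong a a (⊑-refl , ⊑-refl) (below s h≤s)) ⟨
          g a +ᴹ strictlyAbove g a
            ≈⟨ above-split g-resp a ⟨
          above g a ≈⟨ e a ⟩
          above h a
            ≈⟨ above-split h-resp a ⟩
          h a +ᴹ strictlyAbove h a ∎)
          where
          below : ∀ s → height a ℕ.≤ s → ∀ b → a ⊑ b × ¬ b ⊑ a → g b ≈ᴹ h b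
          below zero    h≤s b p = case ℕ.≤-trans (height-< p) h≤s of λ ()
          below (suc s) h≤s b p = go s b (ℕ.≤-pred (ℕ.≤-trans (height-< p) h≤s))

  module DirectSums (M : ℕ → Mod) where

    private module M n = LeftModule (M n)

    ι-at : ∀ n (x : ∣ M n ∣) → component (ι M n x) n ≈[ M n ] x
    ι-at n x with n ℕ.≟ n
    ... | yes refl = M.≈ᴹ-refl n
    ... | no n≢n = contradiction refl n≢n

    ι-off : ∀ n m (x : ∣ M n ∣) → n ≢ m → component (ι M n x) m ≈[ M m ] M.0ᴹ m
    ι-off n m x n≢m with n ℕ.≟ m
    ... | yes n≡m = contradiction n≡m n≢m
    ... | no _ = M.≈ᴹ-refl m

    ιᴸ : ∀ n → M n ⟶ ⨁ M
    ιᴸ n = linear {M n} {⨁ M} (ι M n) ι-cong ι-+ ι-*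
      where
      ι-cong : ∀ {x y} → x ≈[ M n ] y → ι M n x ≈[ ⨁ M ] ι M n y
      ι-cong e m with n ℕ.≟ m
      ... | yes refl = e
      ... | no _ = M.≈ᴹ-refl m
      ι-+ : ∀ x y → ι M n (M._+ᴹ_ n x y) ≈[ ⨁ M ] LeftModule._+ᴹ_ (⨁ M) (ι M n x) (ι M n y)
      ι-+ x y m with n ℕ.≟ m
      ... | yes refl = M.≈ᴹ-refl m
      ... | no _ = M.≈ᴹ-sym m (M.+ᴹ-identityˡ m _)
      ι-* : ∀ r x → ι M n (M._*ₗ_ n r x) ≈[ ⨁ M ] LeftModule._*ₗ_ (⨁ M) r (ι M n x)
      ι-* r x m with n ℕ.≟ m
      ... | yes refl = M.≈ᴹ-refl m
      ... | no _ = M.≈ᴹ-sym m (M.*ₗ-zeroʳ m r)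

    module _ (N : Mod) where

      open LeftModule N
      open CommutativeSemigroupProperties
        (CommutativeMonoid.commutativeSemigroup +ᴹ-commutativeMonoid) using (interchange)

      sumBelow : ℕ → (ℕ → ∣ N ∣) → ∣ N ∣
      sumBelow zero    f = 0ᴹ
      sumBelow (suc b) f = f b +ᴹ sumBelow b f

      sumBelow-cong : ∀ b {f g} → (∀ n → f n ≈ᴹ g n) → sumBelow b f ≈ᴹ sumBelow b g
      sumBelow-cong zero    e = ≈ᴹ-refl
      sumBelow-cong (suc b) e = +ᴹ-cong (e b) (sumBelow-cong b e)

      sumBelow-+ : ∀ b f g → sumBelow b (λ n → f n +ᴹ g n) ≈ᴹ sumBelow b f +ᴹ sumBelow b g
      sumBelow-+ zero    f g = ≈ᴹ-sym (+ᴹ-identityˡ 0ᴹ)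
      sumBelow-+ (suc b) f g = ≈ᴹ-trans (+ᴹ-congˡ (sumBelow-+ b f g)) (interchange _ _ _ _)

      sumBelow-* : ∀ b r f → sumBelow b (λ n → r *ₗ f n) ≈ᴹ r *ₗ sumBelow b f
      sumBelow-* zero    r f = ≈ᴹ-sym (*ₗ-zeroʳ r)
      sumBelow-* (suc b) r f = ≈ᴹ-trans (+ᴹ-congˡ (sumBelow-* b r f)) (≈ᴹ-sym (*ₗ-distribˡ r _ _))

      sumBelow-0 : ∀ b f → (∀ n → n ℕ.< b → f n ≈ᴹ 0ᴹ) → sumBelow b f ≈ᴹ 0ᴹ
      sumBelow-0 zero    f e = ≈ᴹ-refl
      sumBelow-0 (suc b) f e = ≈ᴹ-trans
        (+ᴹ-cong (e b ℕ.≤-refl) (sumBelow-0 b f (λ n p → e n (ℕ.m<n⇒m<1+n p)))) (+ᴹ-identityˡ 0ᴹ)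

      sumBelow-stable : ∀ {b c} → b ℕ.≤′ c → ∀ f → (∀ n → b ℕ.≤ n → f n ≈ᴹ 0ᴹ) → sumBelow c f ≈ᴹ sumBelow b f
      sumBelow-stable ℕ.≤′-refl       f e = ≈ᴹ-refl
      sumBelow-stable (ℕ.≤′-step b≤c) f e = ≈ᴹ-trans
        (+ᴹ-cong (e _ (ℕ.≤′⇒≤ b≤c)) (sumBelow-stable b≤c f e)) (+ᴹ-identityˡ _)

      sumBelow-single : ∀ {m b} → m ℕ.< b → ∀ f → (∀ n → n ≢ m → f n ≈ᴹ 0ᴹ) → sumBelow b f ≈ᴹ f m
      sumBelow-single {m} m<b f e = ≈ᴹ-trans
        (sumBelow-stable (ℕ.≤⇒≤′ m<b) f (λ n m<n → e n (λ n≡m → ℕ.<-irrefl (sym n≡m) m<n)))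
        (≈ᴹ-trans (+ᴹ-congˡ (sumBelow-0 m f (λ n n<m → e n (λ n≡m → ℕ.<-irrefl n≡m n<m)))) (+ᴹ-identityʳ _))

      module _ (g : ∀ n → M n ⟶ N) where

        private module g n = _⟶_ (g n)

        terms : ∣ ⨁ M ∣ → ℕ → ∣ N ∣
        terms x n = g n $ component x n

        total : ∣ ⨁ M ∣ → ∣ N ∣
        total x = sumBelow (bound x) (terms x)

        -- A `bound` is only some bound, and equal elements may carry different ones. Beyond it the
        -- components vanish, so summing further changes nothing.
        extend : ∀ x {c} → bound x ℕ.≤ c → sumBelow c (terms x) ≈ᴹ total x
        extend x b≤c = sumBelow-stable (ℕ.≤⇒≤′ b≤c) (terms x)
          (λ n b≤n → ≈ᴹ-trans (g.⟦⟧-cong n (vanishes x n b≤n)) (g.0ᴹ-homo n))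

        total-cong : ∀ {x y} → x ≈[ ⨁ M ] y → total x ≈ᴹ total y
        total-cong {x} {y} e = ≈ᴹ-trans (≈ᴹ-sym (extend x (ℕ.m≤m⊔n (bound x) (bound y))))
          (≈ᴹ-trans (sumBelow-cong (bound x ℕ.⊔ bound y) (λ n → g.⟦⟧-cong n (e n)))
                    (extend y (ℕ.m≤n⊔m (bound x) (bound y))))

        fromSummands : ⨁ M ⟶ N
        fromSummands = linear {⨁ M} {N} total (λ {x} {y} → total-cong {x} {y})
          (λ x y → ≈ᴹ-trans (sumBelow-cong (bound x ℕ.⊔ bound y) (λ n → g.+ᴹ-homo n _ _))
            (≈ᴹ-trans (sumBelow-+ (bound x ℕ.⊔ bound y) (terms x) (terms y))
              (+ᴹ-cong (extend x (ℕ.m≤m⊔n (bound x) (bound y))) (extend y (ℕ.m≤n⊔m (bound x) (bound y))))))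
          (λ r x → ≈ᴹ-trans (sumBelow-cong (bound x) (λ n → g.*ₗ-homo n r _)) (sumBelow-* (bound x) r (terms x)))

        fromSummands-ι : ∀ n x → (fromSummands $ ι M n x) ≈ᴹ (g n $ x)
        fromSummands-ι n x = ≈ᴹ-trans
          (sumBelow-single ℕ.≤-refl (terms (ι M n x)) (λ m m≢n →
            ≈ᴹ-trans (g.⟦⟧-cong m (ι-off n m x (m≢n ∘ sym))) (g.0ᴹ-homo m)))
          (g.⟦⟧-cong n (ι-at n x))

    sumBelow-component : ∀ b f m →
      component (sumBelow (⨁ M) b f) m ≈[ M m ] sumBelow (M m) b (λ n → component (f n) m)
    sumBelow-component zero    f m = M.≈ᴹ-refl m
    sumBelow-component (suc b) f m = M.+ᴹ-congˡ m (sumBelow-component b f m)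

    decompose : ∀ x → x ≈[ ⨁ M ] sumBelow (⨁ M) (bound x) (λ n → ι M n (component x n))
    decompose x m = M.≈ᴹ-sym m (M.≈ᴹ-trans m (sumBelow-component (bound x) (λ n → ι M n (component x n)) m) eq)
      where
      eq : sumBelow (M m) (bound x) (λ n → component (ι M n (component x n)) m) ≈[ M m ] component x m
      eq with m ℕ.<? bound x
      ... | yes m<b = M.≈ᴹ-trans m
        (sumBelow-single (M m) m<b _ (λ n n≢m → ι-off n m _ n≢m)) (ι-at m _)
      ... | no m≮b = M.≈ᴹ-trans m
        (sumBelow-0 (M m) (bound x) _ (λ n n<b → ι-off n m _ (λ { refl → m≮b n<b })))
        (M.≈ᴹ-sym m (vanishes x m (ℕ.≮⇒≥ m≮b)))

    ⨁-ext : ∀ {N} (f g : ⨁ M ⟶ N) → (∀ n x → (f $ ι M n x) ≈[ N ] (g $ ι M n x)) → f ⟶≈ g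
    ⨁-ext {N} f g e x = N.≈ᴹ-trans (f.⟦⟧-cong {x} (decompose x))
      (N.≈ᴹ-trans (go (bound x)) (N.≈ᴹ-sym (g.⟦⟧-cong {x} (decompose x))))
      where
      module N = LeftModule N
      module f = _⟶_ f
      module g = _⟶_ g
      y : ℕ → ∣ ⨁ M ∣
      y n = ι M n (component x n)
      go : ∀ b → (f $ sumBelow (⨁ M) b y) N.≈ᴹ (g $ sumBelow (⨁ M) b y)
      go zero    = N.≈ᴹ-trans f.0ᴹ-homo (N.≈ᴹ-sym g.0ᴹ-homo)
      go (suc b) = N.≈ᴹ-trans (f.+ᴹ-homo _ _)
        (N.≈ᴹ-trans (N.+ᴹ-cong (e b _) (go b)) (N.≈ᴹ-sym (g.+ᴹ-homo _ _)))

-- Sparse normal forms and the orthogonal group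

module SparseReduction {q : ℕ} (𝔽 : FiniteField q) {n : ℕ} where

  open Group 𝔽
  open Group.Disjointness 𝔽
  open CommutativeRing (FiniteField.commutativeRing 𝔽)
    using (ring; _-_; +-identityʳ; +-assoc; *-identityʳ; *-assoc; *-comm;
           *-identityˡ; zeroˡ; zeroʳ; distribʳ; -‿inverseʳ; -‿inverseˡ)
  open RingProperties ring using (-0#≈0#)
  open IndexProperties
  open ≡-Reasoning

  private M = Mat± n

  -- Used with both orders: reversed, for the lowest nonzero entry of a column, and as it is, for
  -- the leftmost column not yet cleared.
  extremal : {_⊏_ : Index n → Index n → Set} → (∀ i j → Dec (i ⊏ j)) →
    {Q : Index n → Set} → (∀ i → Dec (Q i)) → ∀ i → Acc _⊏_ i → Q i →
    ∃[ m ] Q m × (∀ k → k ⊏ m → ¬ Q k)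
  extremal _⊏?_ Q? i (acc rec) qi with any? (λ k → (k ⊏? i) ×-dec Q? k)
  ... | yes (k , k⊏i , qk) = extremal _⊏?_ Q? k (rec k⊏i) qk
  ... | no ¬p = i , qi , λ k k⊏i qk → ¬p (k , k⊏i , qk)

  I±-unitri : Unitri (I± {n})
  I±-unitri = I±-diag , λ i j j≺i → I±-off {i = i} {j} λ { refl → ≺-irrefl j≺i }

  ∈V-refl : (x : M) → x ∈V x
  ∈V-refl x = I± , I± , I±-unitri , I±-unitri , λ i j →
    sym (trans (·-identityʳ (I± · x) i j) (·-identityˡ x i j))

  ∈V-trans : ∀ x y z → x ∈V y → y ∈V z → x ∈V z
  ∈V-trans x y z (g , h , ug , uh , p) (g′ , h′ , ug′ , uh′ , p′) =
    g · g′ , h′ · h , ·-unitri ug ug′ , ·-unitri uh′ uh , λ i j → begin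
      x i j                               ≡⟨ p i j ⟩
      (g · y · h) i j                     ≡⟨ ·-cong (·-cong (≋-refl {g}) p′) (≋-refl {h}) i j ⟩
      (g · (g′ · z · h′) · h) i j         ≡⟨ ·-cong (λ i j → sym (·-assoc g (g′ · z) h′ i j)) (≋-refl {h}) i j ⟩
      (g · (g′ · z) · h′ · h) i j         ≡⟨ ·-assoc (g · (g′ · z)) h′ h i j ⟩
      (g · (g′ · z) · (h′ · h)) i j       ≡⟨ ·-cong (λ i j → sym (·-assoc g g′ z i j)) (≋-refl {h′ · h}) i j ⟩
      (g · g′ · z · (h′ · h)) i j         ∎
    where
    ≋-refl : {a : M} → a ≋ a
    ≋-refl _ _ = refl

  -- Since u vanishes at i, row i itself does not change, and `G`, the identity with u added in
  -- column i, puts the subtracted multiples of row i back. The support condition places u strictly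
  -- above the diagonal.
  rowOperation : ∀ (y : M) i (u : Index n → F) → (∀ a → u a ≢ 0# → a ≺ i) →
    y ∈V (λ a b → y a b - u a * y i b)
  rowOperation y i u supp = G , I± , G-unitri , I±-unitri , λ a b →
    sym (trans (·-identityʳ (G · y′) a b) (G-entry a b))
    where
    y′ G : M
    y′ a b = y a b - u a * y i b
    G a c = I± a c + u a * I± i c
    u-0 : ∀ a → ¬ a ≺ i → u a ≡ 0#
    u-0 a ¬p = decidable-stable (u a ≟ᶠ 0#) (¬p ∘ supp a)
    G-off : ∀ a c → ¬ (a ≺ i × c ≡ i) → G a c ≡ I± a c
    G-off a c ¬p with u a ≟ᶠ 0#
    ... | yes e = trans (cong (I± a c +_) (trans (cong (_* I± i c) e) (zeroˡ _))) (+-identityʳ _)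
    ... | no u≢0 = trans (cong (I± a c +_) (trans (cong (u a *_) (I±-off {i = i} {c} (λ e → ¬p (supp a u≢0 , sym e)))) (zeroʳ (u a)))) (+-identityʳ _)
    G-unitri : Unitri G
    G-unitri = (λ a → trans (G-off a a λ { (p , refl) → ≺-irrefl p }) (I±-diag a)) ,
      (λ a c c≺a → trans (G-off a c λ { (p , refl) → ≺-irrefl (≺-trans p c≺a) })
                     (proj₂ I±-unitri a c c≺a))
    y′-i : ∀ b → y′ i b ≡ y i b
    y′-i b = trans (cong (λ z → y i b - z * y i b) (u-0 i ≺-irrefl))
      (trans (cong (λ z → y i b - z) (zeroˡ _)) (trans (cong (y i b +_) -0#≈0#) (+-identityʳ _)))
    G-entry : ∀ a b → (G · y′) a b ≡ y a b
    G-entry a b = begin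
      sum± (λ c → (I± a c + u a * I± i c) * y′ c b)
        ≡⟨ sum±-cong (λ c → trans (distribʳ (y′ c b) _ _) (cong (I± a c * y′ c b +_) (*-assoc (u a) (I± i c) (y′ c b)))) ⟩
      sum± (λ c → I± a c * y′ c b + u a * (I± i c * y′ c b))
        ≡⟨ sum±-+ (λ c → I± a c * y′ c b) (λ c → u a * (I± i c * y′ c b)) ⟩
      (I± · y′) a b + sum± (λ c → u a * (I± i c * y′ c b))
        ≡⟨ cong₂ _+_ (·-identityˡ y′ a b) (sym (sum±-*ˡ (u a) (λ c → I± i c * y′ c b))) ⟩
      y′ a b + u a * (I± · y′) i b
        ≡⟨ cong (λ z → y′ a b + u a * z) (trans (·-identityˡ y′ i b) (y′-i b)) ⟩
      y a b - u a * y i b + u a * y i b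
        ≡⟨ trans (+-assoc _ _ _) (trans (cong (y a b +_) (-‿inverseˡ _)) (+-identityʳ _)) ⟩
      y a b ∎

  †-anti : (x y : M) → (x · y) † ≋ y † · x †
  †-anti x y i j = trans (sum±-cong (λ k → *-comm (x (opp j) k) (y k (opp i))))
    (sym (sum±-opp (λ k → y k (opp i) * x (opp j) k)))

  †-involutive : (x : M) → x † † ≋ x
  †-involutive x i j = cong₂ x (opp-involutive i) (opp-involutive j)

  ∈V-† : ∀ x y → x ∈V y → (x †) ∈V (y †)
  ∈V-† x y (g , h , ug , uh , p) = h † , g † , †-unitri uh , †-unitri ug , λ i j → begin
    (x †) i j                 ≡⟨ p (opp j) (opp i) ⟩
    ((g · y · h) †) i j       ≡⟨ †-anti (g · y) h i j ⟩
    (h † · (g · y) †) i j     ≡⟨ ·-cong {x = h †} (λ _ _ → refl) (†-anti g y) i j ⟩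
    (h † · (y † · g †)) i j   ≡⟨ sym (·-assoc (h †) (y †) (g †) i j) ⟩
    (h † · y † · g †) i j     ∎

  -- The reflection `†` exchanges rows and columns, reverses products and preserves
  -- unitriangularity, so this is `rowOperation` for y†, reflected back.
  columnOperation : ∀ (y : M) j (v : Index n → F) → (∀ b → v b ≢ 0# → j ≺ b) →
    y ∈V (λ a b → y a b - y a j * v b)
  columnOperation y j v supp = ∈V-resp (†-involutive y) eq
    (∈V-† (y †) (λ a b → (y †) a b - v (opp a) * (y †) (opp j) b) (rowOperation (y †) (opp j) (v ∘ opp)
      (λ a p → subst (_≺ opp j) (opp-involutive a) (opp-≺ (supp (opp a) p)))))
    where
    eq : (λ a b → (y †) a b - v (opp a) * (y †) (opp j) b) † ≋ (λ a b → y a b - y a j * v b)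
    eq a b rewrite opp-involutive a | opp-involutive b | opp-involutive j =
      cong (λ z → y a b - z) (*-comm (v b) (y a j))

  -- The invariant of the elimination, which runs through the columns from left to right. Requiring
  -- the whole row of an entry to be clear is what forces a later pivot row to vanish in all earlier
  -- columns.
  Resolved : M → Index n → Set
  Resolved y b = ∀ i → y i b ≢ 0# → (∀ i′ → y i′ b ≢ 0# → i′ ≡ i) × (∀ b′ → y i b′ ≢ 0# → b′ ≡ b)

  resolved? : ∀ y b → Dec (Resolved y b)
  resolved? y b = all? λ i → ¬? (y i b ≟ᶠ 0#) →-dec
    (all? (λ i′ → ¬? (y i′ b ≟ᶠ 0#) →-dec (i′ ≟ i)) ×-dec
     all? (λ b′ → ¬? (y i b′ ≟ᶠ 0#) →-dec (b′ ≟ b)))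

  resolved⇒sparse : ∀ {y} → (∀ b → Resolved y b) → IsSparse y
  resolved⇒sparse r = record
    { rowwise    = λ {i} {j} {k} p q → sym (proj₂ (r j i p) k q)
    ; columnwise = λ {i} {j} {k} p q → sym (proj₁ (r k i p) j q)
    }

  -- Entries left of and below the pivot (i , j) vanish, so clearing the rest
  -- of its row and column takes only unitriangular operations.
  module Pivot (y : M) (j i : Index n) (left-resolved : ∀ b → b ≺ j → Resolved y b)
               (p≢0 : y i j ≢ 0#) (below : ∀ a → i ≺ a → y a j ≡ 0#) where

    p p⁻¹ : F
    p = y i j
    p⁻¹ = proj₁ (inverse p p≢0)

    pp⁻¹ : p * p⁻¹ ≡ 1#
    pp⁻¹ = proj₂ (inverse p p≢0)

    left-0 : ∀ b → b ≺ j → y i b ≡ 0#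
    left-0 b b≺j = decidable-stable (y i b ≟ᶠ 0#) λ y≢0 →
      ≺-irrefl (subst (b ≺_) (proj₂ (left-resolved b b≺j i y≢0) j p≢0) b≺j)

    u v : Index n → F
    y₁ y₂ : M
    u a with a ≺? i
    ... | yes _ = y a j * p⁻¹
    ... | no _  = 0#
    y₁ a b = y a b - u a * y i b
    v b with j ≺? b
    ... | yes _ = p⁻¹ * y₁ i b
    ... | no _  = 0#
    y₂ a b = y₁ a b - y₁ a j * v b

    u-supp : ∀ a → u a ≢ 0# → a ≺ i
    u-supp a u≢0 with a ≺? i
    ... | yes q = q
    ... | no _  = contradiction refl u≢0

    v-supp : ∀ b → v b ≢ 0# → j ≺ b
    v-supp b v≢0 with j ≺? b
    ... | yes q = q
    ... | no _  = contradiction refl v≢0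

    y∈Vy₂ : y ∈V y₂
    y∈Vy₂ = ∈V-trans y y₁ y₂ (rowOperation y i u u-supp) (columnOperation y₁ j v v-supp)

    minus-0 : ∀ a {b} → b ≡ 0# → a - b ≡ a
    minus-0 a refl = trans (cong (a +_) -0#≈0#) (+-identityʳ a)

    y₁-col : ∀ a → a ≢ i → y₁ a j ≡ 0#
    y₁-col a a≢i with a ≺? i
    ... | yes _ = trans (cong (λ z → y a j - z) (trans (*-assoc _ _ _)
                    (trans (cong (y a j *_) (trans (*-comm _ _) pp⁻¹)) (*-identityʳ _)))) (-‿inverseʳ _)
    ... | no ¬a≺i with ≺-connex a i a≢i
    ...   | inj₁ a≺i = contradiction a≺i ¬a≺i
    ...   | inj₂ i≺a = trans (minus-0 _ (zeroˡ _)) (below a i≺a)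

    y₁-i : ∀ b → y₁ i b ≡ y i b
    y₁-i b = minus-0 _ (trans (cong (_* y i b) (decidable-stable (u i ≟ᶠ 0#) (≺-irrefl ∘ u-supp i))) (zeroˡ _))

    v-0 : ∀ b → ¬ j ≺ b → v b ≡ 0#
    v-0 b ¬p = decidable-stable (v b ≟ᶠ 0#) (¬p ∘ v-supp b)

    y₂-col : ∀ a → a ≢ i → y₂ a j ≡ 0#
    y₂-col a a≢i = trans (minus-0 _ (trans (cong (y₁ a j *_) (v-0 j ≺-irrefl)) (zeroʳ _))) (y₁-col a a≢i)

    y₂-row : ∀ b → b ≢ j → y₂ i b ≡ 0#
    y₂-row b b≢j with j ≺? b
    ... | yes _ = trans (cong (λ z → y₁ i b - z) (trans (cong (_* (p⁻¹ * y₁ i b)) (y₁-i j))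
                    (trans (sym (*-assoc _ _ _)) (trans (cong (_* y₁ i b) pp⁻¹) (*-identityˡ _))))) (-‿inverseʳ _)
    ... | no ¬j≺b with ≺-connex j b (b≢j ∘ sym)
    ...   | inj₁ j≺b = contradiction j≺b ¬j≺b
    ...   | inj₂ b≺j = trans (minus-0 _ (zeroʳ _)) (trans (y₁-i b) (left-0 b b≺j))

    -- Row i, whose multiples are subtracted, is zero left of column j, and the column operation
    -- changes only columns to the right of j.
    y₂-left : ∀ a b → b ≺ j → y₂ a b ≡ y a b
    y₂-left a b b≺j = trans
      (minus-0 _ (trans (cong (y₁ a j *_) (v-0 b (λ j≺b → ≺-irrefl (≺-trans b≺j j≺b)))) (zeroʳ _)))
      (minus-0 _ (trans (cong (u a *_) (left-0 b b≺j)) (zeroʳ _)))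

    -- A row that owns an entry in an earlier resolved column is zero in column j. Neither operation
    -- touches such rows, so earlier columns stay resolved.
    y₂-zero : ∀ a → y a j ≡ 0# → ∀ b → y₂ a b ≡ y a b
    y₂-zero a yaj≡0 b = trans
      (minus-0 _ (trans (cong (_* v b) (trans (row j) yaj≡0)) (zeroˡ _))) (row b)
      where
      ua≡0 : u a ≡ 0#
      ua≡0 with a ≺? i
      ... | yes _ = trans (cong (_* p⁻¹) yaj≡0) (zeroˡ _)
      ... | no _  = refl
      row : ∀ b → y₁ a b ≡ y a b
      row b = minus-0 _ (trans (cong (_* y i b) ua≡0) (zeroˡ _))

    y₂-resolved : ∀ b → b ≡ j ⊎ b ≺ j → Resolved y₂ b
    y₂-resolved b (inj₁ refl) a y₂≢0 with a ≟ i
    ... | no a≢i = contradiction (y₂-col a a≢i) y₂≢0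
    ... | yes refl = (λ i′ q → decidable-stable (i′ ≟ i) (q ∘ y₂-col i′)) ,
                     (λ b′ q → decidable-stable (b′ ≟ j) (q ∘ y₂-row b′))
    y₂-resolved b (inj₂ b≺j) a y₂≢0 =
      (λ i′ q → proj₁ old i′ (subst (_≢ 0#) (y₂-left i′ b b≺j) q)) ,
      (λ b′ q → proj₂ old b′ (subst (_≢ 0#) (y₂-zero a yaj≡0 b′) q))
      where
      old = left-resolved b b≺j a (subst (_≢ 0#) (y₂-left a b b≺j) y₂≢0)
      yaj≡0 : y a j ≡ 0#
      yaj≡0 = decidable-stable (y a j ≟ᶠ 0#) λ q → ≺-irrefl (subst (b ≺_) (proj₂ old j q) b≺j)

  resolveColumn : ∀ y j → (∀ b → b ≺ j → Resolved y b) → ∃[ i ] y i j ≢ 0# →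
    ∃[ y₂ ] y ∈V y₂ × (∀ b → b ≡ j ⊎ b ≺ j → Resolved y₂ b)
  resolveColumn y j left (i₀ , q₀)
    -- The reversed order picks the lowest nonzero entry, since unitriangular row operations reach
    -- only the rows above the pivot.
    with extremal (λ a b → b ≺? a) (λ i → ¬? (y i j ≟ᶠ 0#)) i₀ (≻-wellFounded i₀) q₀
  ... | i , q , below = y₂ , y∈Vy₂ , y₂-resolved
    where open Pivot y j i left q (λ a i≺a → decidable-stable (y a j ≟ᶠ 0#) (below a i≺a))

  sparseOrLeastUnresolved : ∀ y → IsSparse y ⊎
    ∃[ j ] (∀ b → b ≺ j → Resolved y b) × ¬ Resolved y j
  sparseOrLeastUnresolved y with any? (λ b → ¬? (resolved? y b))
  ... | no done = inj₁ (resolved⇒sparse (λ b → decidable-stable (resolved? y b) (λ r → done (b , r))))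
  ... | yes (b₀ , r₀) with extremal _≺?_ (λ b → ¬? (resolved? y b)) b₀ (≺-wellFounded b₀) r₀
  ...   | b , r , least = inj₂ (b , (λ c c≺b → decidable-stable (resolved? y c) (least c c≺b)) , r)

  private
    Unresolved : M → Set
    Unresolved y = ∃[ j ] (∀ b → b ≺ j → Resolved y b) × ¬ Resolved y j

    Reduced : M → Set
    Reduced y = ∃[ z ] y ∈V z × IsSparse z

  later : ∀ {y} j → (∀ b → b ≡ j ⊎ b ≺ j → Resolved y b) →
    ∀ b → ¬ Resolved y b → j ≺ b
  later j resolved b bad = case b ≟ j of λ where
    (yes b≡j) → contradiction (resolved b (inj₁ b≡j)) bad
    (no b≢j) → case ≺-connex b j b≢j of λ where
      (inj₁ b≺j) → contradiction (resolved b (inj₂ b≺j)) bad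
      (inj₂ j≺b) → j≺b

  nonzeroColumn : ∀ y j → ¬ Resolved y j → ∃[ i ] y i j ≢ 0#
  nonzeroColumn y j bad = case any? (λ i → ¬? (y i j ≟ᶠ 0#)) of λ where
    (yes p) → p
    (no ¬p) → contradiction (λ i q → contradiction (i , q) ¬p) bad

  -- Clearing column j leaves no unresolved column up to j, so the leftmost unresolved one moves
  -- strictly to the right; this is the termination measure.
  reduceFrom : ∀ y j → Acc (λ a b → b ≺ a) j →
    (∀ b → b ≺ j → Resolved y b) → ¬ Resolved y j → Reduced y
  reduceFrom y j (acc rec) left bad = continue (resolveColumn y j left (nonzeroColumn y j bad))
    where
    continue : (∃[ z ] y ∈V z × (∀ b → b ≡ j ⊎ b ≺ j → Resolved z b)) → Reduced y
    continue (z , y∈Vz , resolved) = finish (sparseOrLeastUnresolved z)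
      where
      finish : IsSparse z ⊎ Unresolved z → Reduced y
      finish (inj₁ sparse) = z , y∈Vz , sparse
      finish (inj₂ (b , left′ , bad′)) =
        let w , z∈Vw , sparse = reduceFrom z b (rec (later j resolved b bad′)) left′ bad′
        in w , ∈V-trans y z w y∈Vz z∈Vw , sparse

  reduce : ∀ y → Reduced y
  reduce y with sparseOrLeastUnresolved y
  ... | inj₁ sparse = y , ∈V-refl y , sparse
  ... | inj₂ (b , left , bad) = reduceFrom y b (≻-wellFounded b) left bad

-- Ring identities for the Cayley transform and for double cosets.

module RingIdentities {c ℓ} (R : Ring c ℓ) where

  open Ring R renaming (refl to ≈-refl; sym to ≈-sym; trans to ≈-trans)
  open RingProperties R
  open SetoidReasoning setoid

  difference-commutes-sum : ∀ z → (1# - z) * (1# + z) ≈ (1# + z) * (1# - z)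
  difference-commutes-sum z = begin
    (1# - z) * (1# + z)             ≈⟨ distribˡ (1# - z) 1# z ⟩
    (1# - z) * 1# + (1# - z) * z    ≈⟨ +-cong (*-identityʳ _) (distribʳ z 1# (- z)) ⟩
    1# - z + (1# * z + - z * z)     ≈⟨ +-congˡ (+-cong (≈-trans (*-identityˡ z) (≈-sym (*-identityʳ z)))
                                         (≈-trans (≈-sym (-‿distribˡ-* z z)) (-‿distribʳ-* z z))) ⟩
    1# - z + (z * 1# + z * - z)     ≈⟨ +-cong (*-identityˡ _) (distribˡ z 1# (- z)) ⟨
    1# * (1# - z) + z * (1# - z)    ≈⟨ distribʳ (1# - z) 1# z ⟨
    (1# + z) * (1# - z)             ∎

  -- The unit is rewritten as (1 - z) w, which gives the difference the common right factor w.
  cayley-minus-one : ∀ z w → (1# - z) * w ≈ 1# → (1# + z) * w - 1# ≈ (z + z) * w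
  cayley-minus-one z w e = begin
    (1# + z) * w - 1#              ≈⟨ +-congˡ (-‿cong (≈-sym e)) ⟩
    (1# + z) * w - (1# - z) * w    ≈⟨ +-congˡ (-‿distribˡ-* (1# - z) w) ⟩
    (1# + z) * w + - (1# - z) * w  ≈⟨ distribʳ w (1# + z) (- (1# - z)) ⟨
    (1# + z + - (1# - z)) * w      ≈⟨ *-congʳ (+-cong (+-comm 1# z) (⁻¹-anti-homo-// 1# z)) ⟩
    (z + 1# + (z - 1#)) * w        ≈⟨ *-congʳ (≈-trans (+-assoc z 1# (z - 1#)) (+-congˡ (x+[y-x] 1# z))) ⟩
    (z + z) * w                    ∎
    where
    x+[y-x] : ∀ x y → x + (y - x) ≈ y
    x+[y-x] x y = ≈-trans (+-comm x _) (≈-trans (+-assoc y (- x) x) (≈-trans (+-congˡ (-‿inverseˡ x)) (+-identityʳ y)))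

  leftInverse⇒rightInverse : ∀ a w a′ → w * a ≈ 1# → a * a′ ≈ 1# → a * w ≈ 1#
  leftInverse⇒rightInverse a w a′ wa aa′ = begin
    a * w             ≈⟨ *-congˡ (*-identityʳ w) ⟨
    a * (w * 1#)      ≈⟨ *-congˡ (*-congˡ aa′) ⟨
    a * (w * (a * a′)) ≈⟨ *-congˡ (*-assoc w a a′) ⟨
    a * (w * a * a′)  ≈⟨ *-congˡ (≈-trans (*-congʳ wa) (*-identityˡ a′)) ⟩
    a * a′            ≈⟨ aa′ ⟩
    1#                ∎

  -- Applied to z = y/2 with z† = - z and w′ = w†, where w′ (1 - z) is the adjoint of (1 + z) w. The
  -- product collapses because 1 - z and 1 + z commute.
  cayley-orthogonal : ∀ z w w′ → (1# - z) * w ≈ 1# → w′ * (1# + z) ≈ 1# →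
    w′ * (1# - z) * ((1# + z) * w) ≈ 1#
  cayley-orthogonal z w w′ aw w′b = begin
    w′ * (1# - z) * ((1# + z) * w)    ≈⟨ *-assoc w′ (1# - z) _ ⟩
    w′ * ((1# - z) * ((1# + z) * w))  ≈⟨ *-congˡ (*-assoc (1# - z) (1# + z) w) ⟨
    w′ * ((1# - z) * (1# + z) * w)    ≈⟨ *-congˡ (*-congʳ (difference-commutes-sum z)) ⟩
    w′ * ((1# + z) * (1# - z) * w)    ≈⟨ *-congˡ (*-assoc (1# + z) (1# - z) w) ⟩
    w′ * ((1# + z) * ((1# - z) * w))  ≈⟨ *-congˡ (≈-trans (*-congˡ aw) (*-identityʳ _)) ⟩
    w′ * (1# + z)                     ≈⟨ w′b ⟩
    1#                                ∎

  minus-one-adjoint : ∀ x x′ → x * x′ ≈ 1# → x - 1# ≈ - (x * (x′ - 1#))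
  minus-one-adjoint x x′ e = ≈-sym (begin
    - (x * (x′ - 1#))         ≈⟨ -‿cong (≈-trans (distribˡ x x′ (- 1#)) (+-congˡ (≈-sym (-‿distribʳ-* x 1#)))) ⟩
    - (x * x′ - x * 1#)       ≈⟨ -‿cong (+-cong e (-‿cong (*-identityʳ x))) ⟩
    - (1# - x)                ≈⟨ ⁻¹-anti-homo-// 1# x ⟩
    x - 1#                    ∎)

  negated-translate : ∀ x g y h → - (x * (g * y * h)) ≈ x * g * - y * h
  negated-translate x g y h = begin
    - (x * (g * y * h))   ≈⟨ -‿cong (*-assoc x (g * y) h) ⟨
    - (x * (g * y) * h)   ≈⟨ -‿cong (*-congʳ (*-assoc x g y)) ⟨
    - (x * g * y * h)     ≈⟨ -‿distribˡ-* (x * g * y) h ⟩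
    - (x * g * y) * h     ≈⟨ *-congʳ (-‿distribʳ-* (x * g) y) ⟩
    x * g * - y * h       ∎

  cancel-both : ∀ {g′ g h h′} y → g′ * g ≈ 1# → h * h′ ≈ 1# → y ≈ g′ * (g * y * h) * h′
  cancel-both {g′} {g} {h} {h′} y g′g hh′ = ≈-sym (begin
    g′ * (g * y * h) * h′     ≈⟨ *-congʳ (*-congˡ (*-assoc g y h)) ⟩
    g′ * (g * (y * h)) * h′   ≈⟨ *-congʳ (*-assoc g′ g (y * h)) ⟨
    g′ * g * (y * h) * h′     ≈⟨ *-congʳ (≈-trans (*-congʳ g′g) (*-identityˡ (y * h))) ⟩
    y * h * h′                ≈⟨ *-assoc y h h′ ⟩
    y * (h * h′)              ≈⟨ ≈-trans (*-congˡ hh′) (*-identityʳ y) ⟩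
    y                         ∎)

-- The group as the unitriangular matrices orthogonal for the adjoint `†`.

module OrthogonalGroup {q : ℕ} (𝔽 : FiniteField q) {n : ℕ} where

  open Group 𝔽
  open Group.Disjointness 𝔽
  open SparseReduction 𝔽 {n}
  open CommutativeRing (FiniteField.commutativeRing 𝔽)
    using (ring; semiring; _-_; +-identityˡ; +-identityʳ; +-assoc; +-comm; *-identityʳ; *-assoc; *-comm;
           *-identityˡ; zeroˡ; zeroʳ; distribˡ; distribʳ; -‿inverseʳ; -‿inverseˡ)
  open RingProperties ring
  open SemiringSum semiring
    using (sum; sum-cong-≗; ∑-comm; *-distribˡ-sum; *-distribʳ-sum)
  open IndexProperties
  open ≡-Reasoning

  private M = Mat± n

  I-diag : ∀ {n} (i : Fin n) → I i i ≡ 1#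
  I-diag i with i Fin.≟ i
  ... | yes _ = refl
  ... | no i≢i = contradiction refl i≢i

  I-off : ∀ {n} {i j : Fin n} → i ≢ j → I i j ≡ 0#
  I-off {i = i} {j} i≢j with i Fin.≟ j
  ... | yes i≡j = contradiction i≡j i≢j
  ... | no _ = refl

  I±-pos : (i j : Fin n) → I± (pos i) (pos j) ≡ I i j
  I±-pos i j with i Fin.≟ j
  ... | yes _ = refl
  ... | no _  = refl

  I±-neg : (i j : Fin n) → I± (neg i) (neg j) ≡ I j i
  I±-neg i j with i Fin.≟ j
  ... | yes refl = sym (I-diag i)
  ... | no i≢j   = sym (I-off (i≢j ∘ sym))

  ∙-assoc : (x y z : Mat n) → x ∙ y ∙ z ≋ x ∙ (y ∙ z)
  ∙-assoc x y z i j = begin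
    sum (λ k → sum (λ l → x i l * y l k) * z k j)
      ≡⟨ sum-cong-≗ (λ k → *-distribʳ-sum (z k j) (λ l → x i l * y l k)) ⟩
    sum (λ k → sum (λ l → x i l * y l k * z k j))
      ≡⟨ ∑-comm (λ k l → x i l * y l k * z k j) ⟩
    sum (λ l → sum (λ k → x i l * y l k * z k j))
      ≡⟨ sum-cong-≗ (λ l → trans (sum-cong-≗ (λ k → *-assoc (x i l) (y l k) (z k j)))
                             (sym (*-distribˡ-sum (x i l) (λ k → y l k * z k j)))) ⟩
    sum (λ l → x i l * sum (λ k → y l k * z k j)) ∎

  I∙ : (x : Mat n) → I ∙ x ≋ x
  I∙ x i j = trans
    (sum-single _ i (λ k k≢i → trans (cong (_* x k j) (I-off (k≢i ∘ sym))) (zeroˡ _)))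
    (trans (cong (_* x i j) (I-diag i)) (*-identityˡ _))

  JxJ : (x : Mat n) → J ∙ x ∙ J ≋ λ i j → x (opposite i) (opposite j)
  JxJ x i j = trans
    (sum-single _ (opposite j) (λ k k≢ → trans (cong ((J ∙ x) i k *_) (I-off k≢)) (zeroʳ _)))
    (trans (cong₂ _*_ Jx (I-diag (opposite j))) (*-identityʳ _))
    where
    off : ∀ k → k ≢ opposite i → J i k ≡ 0#
    off k k≢ = I-off λ e → k≢ (trans (sym (Fin.opposite-involutive k)) (cong opposite (sym e)))
    Jx : (J ∙ x) i (opposite j) ≡ x (opposite i) (opposite j)
    Jx = trans (sum-single _ (opposite i) (λ k k≢ → trans (cong (_* x k (opposite j)) (off k k≢)) (zeroˡ _)))
      (trans (cong (_* x (opposite i) (opposite j))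
        (trans (cong (I i) (Fin.opposite-involutive i)) (I-diag i))) (*-identityˡ _))

  -- Induction on the column i. In the vanishing entry (j , i) of P⁻¹ P, the terms with k < i vanish
  -- by induction and those with k > i by triangularity of P, leaving P⁻¹ j i alone.
  leftInverse-upper : {P P⁻¹ : Mat n} → IsUnitriangular Fin._<_ P → P⁻¹ ∙ P ≋ I →
    ∀ i j → i Fin.< j → P⁻¹ j i ≡ 0#
  leftInverse-upper {P} {P⁻¹} (d , l) e i j = go i (Fin.<-wellFounded i)
    where
    go : ∀ i → Acc Fin._<_ i → i Fin.< j → P⁻¹ j i ≡ 0#
    go i (acc rec) i<j = begin
      P⁻¹ j i         ≡⟨ sym (*-identityʳ _) ⟩
      P⁻¹ j i * 1#    ≡⟨ cong (P⁻¹ j i *_) (sym (d i)) ⟩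
      P⁻¹ j i * P i i ≡⟨ sym (sum-single _ i off) ⟩
      (P⁻¹ ∙ P) j i   ≡⟨ e j i ⟩
      I j i           ≡⟨ I-off {i = j} {i} (λ { refl → Fin.<-irrefl refl i<j }) ⟩
      0#              ∎
      where
      off : ∀ k → k ≢ i → P⁻¹ j k * P k i ≡ 0#
      off k k≢i with Fin.<-cmp k i
      ... | tri< k<i _ _ = trans (cong (_* P k i) (go k (rec k<i) (Fin.<-trans k<i i<j))) (zeroˡ _)
      ... | tri≈ _ k≡i _ = contradiction k≡i k≢i
      ... | tri> _ _ i<k = trans (cong (P⁻¹ j k *_) (l k i i<k)) (zeroʳ _)

  leftInverse-unitri : {P P⁻¹ : Mat n} → IsUnitriangular Fin._<_ P → P⁻¹ ∙ P ≋ I →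
    IsUnitriangular Fin._<_ P⁻¹
  leftInverse-unitri {P} {P⁻¹} uP e = diag , λ i j j<i → leftInverse-upper uP e j i j<i
    where
    diag : ∀ i → P⁻¹ i i ≡ 1#
    diag i = begin
      P⁻¹ i i         ≡⟨ sym (*-identityʳ _) ⟩
      P⁻¹ i i * 1#    ≡⟨ cong (P⁻¹ i i *_) (sym (proj₁ uP i)) ⟩
      P⁻¹ i i * P i i ≡⟨ sym (sum-single _ i off) ⟩
      (P⁻¹ ∙ P) i i   ≡⟨ e i i ⟩
      I i i           ≡⟨ I-diag i ⟩
      1#              ∎
      where
      off : ∀ k → k ≢ i → P⁻¹ i k * P k i ≡ 0#
      off k k≢i with Fin.<-cmp k i
      ... | tri< k<i _ _ = trans (cong (_* P k i) (leftInverse-upper uP e k i k<i)) (zeroˡ _)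
      ... | tri≈ _ k≡i _ = contradiction k≡i k≢i
      ... | tri> _ _ i<k = trans (cong (P⁻¹ i k *_) (proj₂ uP k i i<k)) (zeroʳ _)

  module FromUᴰ {x : M} (isU : IsUᴰ x) where
    open IsUᴰ isU

    -- `block` and the conjugation by J both reverse the numbering; in signed indices the reversals
    -- cancel.
    x-neg : ∀ i j → x (neg i) (neg j) ≡ P⁻¹ j i
    x-neg i j = trans (blocks (neg i) (neg j)) (trans (JxJ (P⁻¹ ᵗ) _ _)
      (cong₂ P⁻¹ (Fin.opposite-involutive j) (Fin.opposite-involutive i)))

    unitri : Unitri x
    unitri = diag , lower
      where
      uP⁻¹ = leftInverse-unitri P∈U P⁻¹∙P
      diag : ∀ i → x i i ≡ 1#
      diag (pos i) = trans (blocks _ _) (proj₁ P∈U i)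
      diag (neg i) = trans (x-neg i i) (proj₁ uP⁻¹ i)
      lower : ∀ i j → j ≺ i → x i j ≡ 0#
      lower _ _ (pos≺pos p) = trans (blocks _ _) (proj₂ P∈U _ _ p)
      lower _ _ pos≺neg = blocks _ _
      lower _ _ (neg≺neg p) = trans (x-neg _ _) (proj₂ uP⁻¹ _ _ p)

    -- Q with its columns numbered by signed indices: the condition J Qᵗ J = - Q becomes ordinary
    -- skew-symmetry.
    Q′ : Mat n
    Q′ a k = Q a (opposite k)

    Q′-skew : ∀ a k → Q′ k a ≡ - Q′ a k
    Q′-skew a k = begin
      Q k (opposite a)                       ≡⟨ cong (λ z → Q z (opposite a)) (sym (Fin.opposite-involutive k)) ⟩
      Q (opposite (opposite k)) (opposite a) ≡⟨ sym (JxJ (Q ᵗ) a (opposite k)) ⟩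
      (J ∙ Q ᵗ ∙ J) a (opposite k)           ≡⟨ JQᵗJ a (opposite k) ⟩
      - Q a (opposite k)                     ∎

    -- Only the upper right block takes work: it is P (Q′ᵗ + Q′) Pᵗ, which is zero by skew-symmetry
    -- of `Q′`.
    x·x† : x · x † ≋ I±
    x·x† (pos i) (pos j) = begin
      sum (λ k → x (pos i) (pos k) * x (neg j) (neg k)) + sum (λ k → x (pos i) (neg k) * x (neg j) (pos k))
        ≡⟨ cong₂ _+_ (sum-cong-≗ (λ k → cong₂ _*_ (blocks (pos i) (pos k)) (x-neg j k)))
                     (sum-0 _ (λ k → trans (cong (x (pos i) (neg k) *_) (blocks (neg j) (pos k))) (zeroʳ _))) ⟩
      (P ∙ P⁻¹) i j + 0#
        ≡⟨ trans (+-identityʳ _) (P∙P⁻¹ i j) ⟩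
      I i j ≡⟨ sym (I±-pos i j) ⟩
      I± (pos i) (pos j) ∎
    x·x† (neg i) (neg j) = begin
      sum (λ k → x (neg i) (pos k) * x (pos j) (neg k)) + sum (λ k → x (neg i) (neg k) * x (pos j) (pos k))
        ≡⟨ cong₂ _+_ (sum-0 _ (λ k → trans (cong (_* x (pos j) (neg k)) (blocks (neg i) (pos k))) (zeroˡ _)))
             (sum-cong-≗ (λ k → trans (*-comm _ _) (cong₂ _*_ (blocks (pos j) (pos k)) (x-neg i k)))) ⟩
      0# + (P ∙ P⁻¹) j i
        ≡⟨ trans (+-identityˡ _) (P∙P⁻¹ j i) ⟩
      I j i ≡⟨ sym (I±-neg i j) ⟩
      I± (neg i) (neg j) ∎
    x·x† (neg i) (pos j) = sum±-0 (λ k → x (neg i) k * (x †) k (pos j)) λ where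
      (pos k) → trans (cong (_* x (neg j) (neg k)) (blocks (neg i) (pos k))) (zeroˡ _)
      (neg k) → trans (cong (x (neg i) (neg k) *_) (blocks (neg j) (pos k))) (zeroʳ _)
    x·x† (pos i) (neg j) = begin
      sum (λ k → x (pos i) (pos k) * x (pos j) (neg k)) + sum (λ k → x (pos i) (neg k) * x (pos j) (pos k))
        ≡⟨ cong₂ _+_ (sum-cong-≗ (λ k → cong₂ _*_ (blocks (pos i) (pos k)) (blocks (pos j) (neg k))))
                     (sum-cong-≗ (λ k → cong₂ _*_ (blocks (pos i) (neg k)) (blocks (pos j) (pos k)))) ⟩
      sum (λ k → P i k * sum (λ a → P j a * Q′ a k)) + sum (λ k → sum (λ a → P i a * Q′ a k) * P j k)
        ≡⟨ cong (_+ S) first ⟩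
      - S + S
        ≡⟨ -‿inverseˡ S ⟩
      0# ∎
      where
      S : F
      S = sum (λ k → sum (λ a → P i a * Q′ a k) * P j k)
      term : ∀ k a → P i k * (P j a * Q′ a k) ≡ - 1# * (P i k * Q′ k a * P j a)
      term k a = begin
        P i k * (P j a * Q′ a k)         ≡⟨ cong (λ z → P i k * (P j a * z)) (Q′-skew k a) ⟩
        P i k * (P j a * - Q′ k a)       ≡⟨ cong (P i k *_) (trans (*-comm _ _) (sym (-‿distribˡ-* _ _))) ⟩
        P i k * - (Q′ k a * P j a)       ≡⟨ sym (-‿distribʳ-* _ _) ⟩
        - (P i k * (Q′ k a * P j a))     ≡⟨ cong -_ (sym (*-assoc _ _ _)) ⟩
        - (P i k * Q′ k a * P j a)       ≡⟨ sym (-1*x≈-x _) ⟩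
        - 1# * (P i k * Q′ k a * P j a)  ∎
      first : sum (λ k → P i k * sum (λ a → P j a * Q′ a k)) ≡ - S
      first = begin
        sum (λ k → P i k * sum (λ a → P j a * Q′ a k))
          ≡⟨ sum-cong-≗ (λ k → *-distribˡ-sum (P i k) (λ a → P j a * Q′ a k)) ⟩
        sum (λ k → sum (λ a → P i k * (P j a * Q′ a k)))
          ≡⟨ ∑-comm (λ k a → P i k * (P j a * Q′ a k)) ⟩
        sum (λ a → sum (λ k → P i k * (P j a * Q′ a k)))
          ≡⟨ sum-cong-≗ (λ a → trans (sum-cong-≗ (λ k → term k a))
               (sym (*-distribˡ-sum (- 1#) (λ k → P i k * Q′ k a * P j a)))) ⟩
        sum (λ a → - 1# * sum (λ k → P i k * Q′ k a * P j a))
          ≡⟨ sym (*-distribˡ-sum (- 1#) (λ a → sum (λ k → P i k * Q′ k a * P j a))) ⟩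
        - 1# * sum (λ a → sum (λ k → P i k * Q′ k a * P j a))
          ≡⟨ -1*x≈-x _ ⟩
        - sum (λ a → sum (λ k → P i k * Q′ k a * P j a))
          ≡⟨ cong -_ (sum-cong-≗ (λ a → sym (*-distribʳ-sum (P j a) (λ k → P i k * Q′ k a)))) ⟩
        - S ∎

  -- The conditions on the blocks say that x is orthogonal for the form
  -- whose adjoint is †.
  orthogonal⇒Uᴰ : {x : M} → Unitri x → x † · x ≋ I± → x · x † ≋ I± → IsUᴰ x
  orthogonal⇒Uᴰ {x} ux x†x xx† = record
    { P = P ; P⁻¹ = P⁻¹ ; Q = Q
    ; P∈U = (λ i → proj₁ ux (pos i)) , (λ i j p → proj₂ ux _ _ (pos≺pos p))
    ; P∙P⁻¹ = PP⁻¹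
    ; P⁻¹∙P = P⁻¹P
    ; JQᵗJ = λ i j → begin
        (J ∙ Q ᵗ ∙ J) i j                  ≡⟨ JxJ (Q ᵗ) i j ⟩
        Q (opposite j) (opposite i)
                                           ≡⟨ cong (Q′ (opposite j)) (Fin.opposite-involutive i) ⟩
        Q′ (opposite j) i                  ≡⟨ Q′-skew (opposite j) i ⟩
        - Q i j                            ∎
    ; blocks = λ where
        (pos i) (pos j) → refl
        (neg i) (pos j) → low i j
        (pos i) (neg j) → sym (PQ i j)
        (neg i) (neg j) → sym (trans (JxJ (P⁻¹ ᵗ) _ _)
          (cong₂ P⁻¹ (Fin.opposite-involutive j) (Fin.opposite-involutive i)))
    }
    where
    P P⁻¹ Q Q′ : Mat n
    P i j = x (pos i) (pos j)
    -- Since x† inverts x, the inverse of the upper left block of x is the upper left block of x†.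
    -- The upper right block X of x has to be P Q, so `Q′` is P⁻¹ X in signed column indices.
    P⁻¹ i j = x (neg j) (neg i)
    Q′ i j = sum (λ k → P⁻¹ i k * x (pos k) (neg j))
    Q i j = Q′ i (opposite j)
    low : ∀ i j → x (neg i) (pos j) ≡ 0#
    low i j = proj₂ ux _ _ pos≺neg
    P⁻¹P : P⁻¹ ∙ P ≋ I
    P⁻¹P i j = begin
      (P⁻¹ ∙ P) i j ≡⟨ sym (+-identityʳ _) ⟩
      (P⁻¹ ∙ P) i j + 0#
        ≡⟨ cong ((P⁻¹ ∙ P) i j +_) (sym (sum-0 _ (λ k → trans (cong (x (pos k) (neg i) *_) (low k j)) (zeroʳ _)))) ⟩
      (x † · x) (pos i) (pos j) ≡⟨ trans (x†x (pos i) (pos j)) (I±-pos i j) ⟩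
      I i j ∎
    PP⁻¹ : P ∙ P⁻¹ ≋ I
    PP⁻¹ i j = begin
      (P ∙ P⁻¹) i j ≡⟨ sym (+-identityʳ _) ⟩
      (P ∙ P⁻¹) i j + 0#
        ≡⟨ cong ((P ∙ P⁻¹) i j +_) (sym (sum-0 _ (λ k → trans (cong (x (pos i) (neg k) *_) (low j k)) (zeroʳ _)))) ⟩
      (x · x †) (pos i) (pos j) ≡⟨ trans (xx† (pos i) (pos j)) (I±-pos i j) ⟩
      I i j ∎
    Q′-skew : ∀ j i → Q′ j i ≡ - Q′ i j
    Q′-skew j i = +-inverseˡ-unique (Q′ j i) (Q′ i j) sum≡0
      where
      sum≡0 : Q′ j i + Q′ i j ≡ 0#
      -- This sum is the entry (j , -i) of x† x, in the upper right block, where the identity is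
      -- zero.
      sum≡0 = trans (cong (Q′ j i +_) (sum-cong-≗ (λ k → *-comm (x (neg k) (neg i)) (x (pos k) (neg j)))))
                (x†x (pos j) (neg i))
    PQ : ∀ i j → (P ∙ Q) i (opposite j) ≡ x (pos i) (neg j)
    PQ i j = begin
      sum (λ k → P i k * Q′ k (opposite (opposite j)))
        ≡⟨ sum-cong-≗ (λ k → cong (λ l → P i k * Q′ k l) (Fin.opposite-involutive j)) ⟩
      (P ∙ (P⁻¹ ∙ X)) i j
        ≡⟨ sym (∙-assoc P P⁻¹ X i j) ⟩
      (P ∙ P⁻¹ ∙ X) i j
        ≡⟨ sum-cong-≗ (λ k → cong (_* X k j) (PP⁻¹ i k)) ⟩
      (I ∙ X) i j
        ≡⟨ I∙ X i j ⟩
      x (pos i) (neg j) ∎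
      where
      X : Mat n
      X k j = x (pos k) (neg j)

  matrixRing : Ring 0ℓ 0ℓ
  matrixRing = record
    { Carrier = M ; _≈_ = _≋_
    ; _+_ = λ x y i j → x i j + y i j ; _*_ = _·_ ; -_ = λ x i j → - x i j
    ; 0# = λ _ _ → 0# ; 1# = I±
    ; isRing = record
      { +-isAbelianGroup = record
        { isGroup = record
          { isMonoid = record
            { isSemigroup = record
              { isMagma = record
                { isEquivalence = record
                  { refl = λ _ _ → refl
                  ; sym = λ p i j → sym (p i j)
                  ; trans = λ p q i j → trans (p i j) (q i j)
                  }
                ; ∙-cong = λ p q i j → cong₂ _+_ (p i j) (q i j)
                }
              ; assoc = λ x y z i j → +-assoc (x i j) (y i j) (z i j)
              }
            ; identity = (λ x i j → +-identityˡ (x i j)) , (λ x i j → +-identityʳ (x i j))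
            }
          ; inverse = (λ x i j → -‿inverseˡ (x i j)) , (λ x i j → -‿inverseʳ (x i j))
          ; ⁻¹-cong = λ p i j → cong -_ (p i j)
          }
        ; comm = λ x y i j → +-comm (x i j) (y i j)
        }
      ; *-cong = λ {x} {x′} {y} {y′} → ·-cong {x = x} {x′} {y} {y′}
      ; *-assoc = ·-assoc
      ; *-identity = ·-identityˡ , ·-identityʳ
      ; distrib =
          (λ x y z i j → trans (sum±-cong (λ k → distribˡ (x i k) (y k j) (z k j)))
                           (sum±-+ (λ k → x i k * y k j) (λ k → x i k * z k j))) ,
          (λ x y z i j → trans (sum±-cong (λ k → distribʳ (x k j) (y i k) (z i k)))
                           (sum±-+ (λ k → y i k * x k j) (λ k → z i k * x k j)))
      }
    }

  private module RI = RingIdentities matrixRing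

  I±-† : I± {n} † ≋ I±
  I±-† i j with i ≟ j
  ... | yes refl = I±-diag (opp i)
  ... | no i≢j = I±-off (λ p → i≢j
    (trans (sym (opp-involutive i)) (trans (cong opp (sym p)) (opp-involutive j))))

  module _ (half : F) (half+half : half + half ≡ 1#) where

    -- Once y = - y† is known, each antipodal entry of y equals its own negative. This is the point
    -- at which arcs from i to -i are excluded.
    self-negative⇒0 : ∀ a → a ≡ - a → a ≡ 0#
    self-negative⇒0 a e = begin
      a                   ≡⟨ sym (*-identityˡ a) ⟩
      1# * a              ≡⟨ cong (_* a) (sym half+half) ⟩
      (half + half) * a   ≡⟨ trans (distribʳ a half half) (sym (distribˡ half a a)) ⟩
      half * (a + a)      ≡⟨ cong (λ b → half * (a + b)) e ⟩
      half * (a - a)      ≡⟨ trans (cong (half *_) (-‿inverseʳ a)) (zeroʳ half) ⟩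
      0#                  ∎

    -a≡0⇒a≡0 : ∀ {a} → - a ≡ 0# → a ≡ 0#
    -a≡0⇒a≡0 {a} e = trans (sym (-‿involutive a)) (trans (cong -_ e) -0#≈0#)

    K-covers : (x : Uᴰ n) → ∃[ lam ] x ∈K lam
    K-covers X = record { label = y ; isDPartition = isD } , z∈Vy
      where
      x z y -y† : M
      x = matrix X
      open FromUᴰ (isUᴰ X)
      z i j = x i j - I± i j
      y = proj₁ (reduce z)
      -y† i j = - (y †) i j
      z∈Vy : z ∈V y
      z∈Vy = proj₁ (proj₂ (reduce z))
      sparse : IsSparse y
      sparse = proj₂ (proj₂ (reduce z))
      open IsSparse sparse
      sparse† : IsSparse -y†
      sparse† = record
        { rowwise = λ p q → trans (sym (opp-involutive _)) (trans (cong opp (columnwise (p ∘ negate-0) (q ∘ negate-0))) (opp-involutive _))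
        ; columnwise = λ p q → trans (sym (opp-involutive _)) (trans (cong opp (rowwise (p ∘ negate-0) (q ∘ negate-0))) (opp-involutive _))
        }
        where
        negate-0 : ∀ {a} → a ≡ 0# → - a ≡ 0#
        negate-0 e = trans (cong -_ e) -0#≈0#
      -- Since x† = x⁻¹, z = x - 1 satisfies z = - x z†.
      z∈V-y† : z ∈V -y†
      z∈V-y† =
        let g , h , ug , uh , e = ∈V-† z y z∈Vy
        in x · g , h , ·-unitri unitri ug , uh , λ i j → begin
          z i j                                           ≡⟨ RI.minus-one-adjoint x (x †) x·x† i j ⟩
          - (x · (λ i j → (x †) i j - I± i j)) i j        ≡⟨ cong -_ (·-cong {x = x} (λ _ _ → refl)
                                                               (λ i j → cong (λ a → (x †) i j - a) (sym (I±-† i j))) i j) ⟩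
          - (x · z †) i j                                 ≡⟨ cong -_ (·-cong {x = x} (λ _ _ → refl) e i j) ⟩
          - (x · (g · y † · h)) i j                       ≡⟨ RI.negated-translate x g (y †) h i j ⟩
          (x · g · -y† · h) i j                           ∎
      y-skew : ∀ i j → y i j ≡ - y (opp j) (opp i)
      -- A double coset contains at most one sparse matrix.
      y-skew = ∈V-unique {x = z} {y} { -y†} sparse sparse† z∈Vy z∈V-y†
      z-upper : ∀ i j → z i j ≢ 0# → i ≺ j
      z-upper i j p with i ≟ j
      ... | yes refl = contradiction (trans (cong (_- 1#) (proj₁ unitri i)) (-‿inverseʳ 1#)) p
      ... | no i≢j with ≺-connex i j i≢j
      ...   | inj₁ q = q
      ...   | inj₂ q = contradiction (trans (+-identityˡ _) -0#≈0#) (subst (λ a → a - 0# ≢ 0#) (proj₂ unitri i j q) p)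
      y-upper : ∀ i j → y i j ≢ 0# → i ≺ j
      -- y is g⁻¹ z h⁻¹, and z = x - 1 is strictly upper triangular; a nonzero entry of y therefore
      -- comes from a path with one strict step.
      y-upper i j p =
        let g , h , ug , uh , e = z∈Vy
            g′ , ug′ , g′g = leftInverse g ug
            h′ , uh′ , hh′ = rightInverse h uh
            y≡ : y i j ≡ (g′ · z · h′) i j
            y≡ = trans (RI.cancel-both {g′} {g} {h} {h′} y g′g hh′ i j)
                   (·-cong {x = g′ · (g · y · h)} {g′ · z} {h′} (·-cong {x = g′} (λ _ _ → refl) (λ i j → sym (e i j))) (λ _ _ → refl) i j)
            l , pl = sum±-nonzero (λ l → (g′ · z) i l * h′ l j) (p ∘ trans y≡)
            k , pk = sum±-nonzero (λ k → g′ i k * z k l) (*-nonzeroˡ _ _ pl)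
        in between (unitri-nonzero ug′ (*-nonzeroˡ _ _ pk)) (z-upper k l (*-nonzeroʳ (g′ i k) _ pk))
                   (unitri-nonzero uh′ (*-nonzeroʳ ((g′ · z) i l) _ pl))
        where
        between : ∀ {k l} → i ≡ k ⊎ i ≺ k → k ≺ l → l ≡ j ⊎ l ≺ j → i ≺ j
        between (inj₁ refl) q (inj₁ refl) = q
        between (inj₁ refl) q (inj₂ r) = ≺-trans q r
        between (inj₂ p) q (inj₁ refl) = ≺-trans p q
        between (inj₂ p) q (inj₂ r) = ≺-trans p (≺-trans q r)
      nonzero : ∀ {i j a} → Arc y i j a → y i j ≢ 0#
      nonzero (e , a≢0) p = a≢0 (trans (sym e) p)
      isD : IsDPartition y
      isD = record
        { ordered = λ i j a p → y-upper i j (nonzero p)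
        ; ¬antipodal = λ { i _ a p refl → nonzero p (self-negative⇒0 _
            (trans (y-skew i (opp i)) (cong (λ k → - y k (opp i)) (opp-involutive i)))) }
        ; symmetric = λ i j a p →
            trans (sym (-‿involutive _)) (cong -_ (trans (sym (y-skew i j)) (proj₁ p))) ,
            proj₂ p ∘ -a≡0⇒a≡0
        -- Sparsity forbids any second entry in the row or column of an arc, nested or not.
        ; nonNesting = λ i j a p k i≺k k≺j b →
            (λ q → ≺-irrefl (subst (_≺ j) (rowwise (nonzero q) (nonzero p)) k≺j)) ,
            (λ q → ≺-irrefl (subst (i ≺_) (columnwise (nonzero q) (nonzero p)) i≺k))
        }

    K-nonempty : (lam : DPartition n) → ∃[ x ] x ∈K lam
    K-nonempty lam = record { matrix = x ; isUᴰ = orthogonal⇒Uᴰ ux x†x xx† } ,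
      -- With w the inverse of 1 - z, x - 1 = 2 z w = y w, so the identity and w are the two
      -- unitriangular factors.
      I± , w , I±-unitri , uw , λ i j → begin
        x i j - I± i j                                ≡⟨ RI.cayley-minus-one z w aw i j ⟩
        ((λ i j → z i j + z i j) · w) i j             ≡⟨ ·-cong {y = w} z+z (λ _ _ → refl) i j ⟩
        (y · w) i j                                   ≡⟨ ·-cong {x = y} {I± · y} {w} (λ i j → sym (·-identityˡ y i j)) (λ _ _ → refl) i j ⟩
        (I± · y · w) i j                              ∎
      where
      y z a b : M
      y = label lam
      open IsDPartition (isDPartition lam)
      z i j = half * y i j
      a i j = I± i j - z i j
      b i j = I± i j + z i j
      z+z : (λ i j → z i j + z i j) ≋ y
      z+z i j = trans (sym (distribʳ (y i j) half half)) (trans (cong (_* y i j) half+half) (*-identityˡ _))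
      -- The symmetry of a D-partition speaks of arcs, that is of nonzero entries. A zero entry with
      -- a nonzero mirror image is refuted by applying the symmetry to the mirror image.
      y-skew : ∀ i j → y (opp j) (opp i) ≡ - y i j
      y-skew i j with y i j ≟ᶠ 0# | y (opp j) (opp i) ≟ᶠ 0#
      ... | no p | _ = proj₁ (symmetric i j _ (refl , p))
      ... | yes p | yes q = trans q (sym (trans (cong -_ p) -0#≈0#))
      ... | yes p | no q = contradiction
        (-a≡0⇒a≡0 (trans (sym (proj₁ (symmetric _ _ _ (refl , q))))
          (trans (cong₂ y (opp-involutive i) (opp-involutive j)) p))) q
      z-lower : ∀ i j → ¬ i ≺ j → z i j ≡ 0#
      z-lower i j ¬p = trans (cong (half *_) (decidable-stable (y i j ≟ᶠ 0#) (λ q → ¬p (ordered i j _ (refl , q))))) (zeroʳ half)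
      a-unitri : Unitri a
      a-unitri =
        (λ i → trans (cong₂ _-_ (I±-diag i) (z-lower i i ≺-irrefl)) (trans (cong (1# +_) -0#≈0#) (+-identityʳ 1#))) ,
        (λ i j p → trans (cong₂ _-_ (proj₂ I±-unitri i j p) (z-lower i j (λ q → ≺-irrefl (≺-trans p q))))
                     (-‿inverseʳ 0#))
      b-unitri : Unitri b
      b-unitri =
        (λ i → trans (cong₂ _+_ (I±-diag i) (z-lower i i ≺-irrefl)) (+-identityʳ 1#)) ,
        (λ i j p → trans (cong₂ _+_ (proj₂ I±-unitri i j p) (z-lower i j (λ q → ≺-irrefl (≺-trans p q))))
                     (+-identityʳ 0#))
      w = proj₁ (leftInverse a a-unitri)
      uw : Unitri w
      uw = proj₁ (proj₂ (leftInverse a a-unitri))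
      aw : a · w ≋ I±
      aw = let a′ , _ , aa′ = rightInverse a a-unitri
           in RI.leftInverse⇒rightInverse a w a′ (proj₂ (proj₂ (leftInverse a a-unitri))) aa′
      x : M
      x = b · w
      ux : Unitri x
      ux = ·-unitri b-unitri uw
      z†-skew : ∀ i j → (z †) i j ≡ - z i j
      z†-skew i j = trans (cong (half *_) (y-skew i j)) (sym (-‿distribʳ-* half (y i j)))
      a† : a † ≋ b
      a† i j = cong₂ _+_ (I±-† i j) (trans (cong -_ (z†-skew i j)) (-‿involutive _))
      b† : b † ≋ a
      b† i j = cong₂ _+_ (I±-† i j) (z†-skew i j)
      w†b : w † · b ≋ I±
      w†b i j = begin
        (w † · b) i j    ≡⟨ ·-cong {x = w †} {w †} {b} {a †} (λ _ _ → refl) (λ i j → sym (a† i j)) i j ⟩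
        (w † · a †) i j  ≡⟨ sym (†-anti a w i j) ⟩
        ((a · w) †) i j  ≡⟨ aw (opp j) (opp i) ⟩
        (I± †) i j       ≡⟨ I±-† i j ⟩
        I± i j           ∎
      x†x : x † · x ≋ I±
      x†x i j = begin
        (x † · x) i j             ≡⟨ ·-cong {x = x †} {w † · a} {x} (λ i j → trans (†-anti b w i j)
                                       (·-cong {x = w †} {w †} {b †} {a} (λ _ _ → refl) b† i j)) (λ _ _ → refl) i j ⟩
        (w † · a · (b · w)) i j   ≡⟨ RI.cayley-orthogonal z w (w †) aw w†b i j ⟩
        I± i j                    ∎
      xx† : x · x † ≋ I±
      xx† = let x′ , _ , xx′ = rightInverse x ux
            in RI.leftInverse⇒rightInverse x (x †) x′ x†x xx′

-- Invertibility of 2 in a field of odd order.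

∤2-prime-power : ∀ p r → Prime p → 3 ≤ p → 2 ∤ p ^ r
∤2-prime-power p zero    isPrime 3≤p 2∣1 = case ∣1⇒≡1 2∣1 of λ ()
∤2-prime-power p (suc r) isPrime 3≤p 2∣q with euclidsLemma p (p ^ r) prime[2] 2∣q
... | inj₂ 2∣p^r = ∤2-prime-power p r isPrime 3≤p 2∣p^r
... | inj₁ 2∣p with prime⇒irreducible isPrime 2∣p
...   | inj₂ refl = contradiction 3≤p λ { (s≤s (s≤s ())) }

odd-form : ∀ q → 2 ∤ q → ∃[ k ] q ≡ suc (k ℕ.+ k)
odd-form q 2∤q = k , (begin
  q                        ≡⟨ m≡m%n+[m/n]*n q 2 ⟩
  q ℕ.% 2 ℕ.+ k ℕ.* 2      ≡⟨ cong₂ ℕ._+_ (remainder (q ℕ.% 2) refl (m%n<n q 2)) (trans (ℕ.*-comm k 2) (cong (k ℕ.+_) (ℕ.+-identityʳ k))) ⟩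
  suc (k ℕ.+ k)            ∎)
  where
  open ≡-Reasoning
  k = q ℕ./ 2
  remainder : ∀ r → q ℕ.% 2 ≡ r → r ℕ.< 2 → r ≡ 1
  remainder zero          e _ = contradiction (m%n≡0⇒n∣m q 2 e) 2∤q
  remainder (suc zero)    e _ = refl
  remainder (suc (suc r)) e (s≤s (s≤s ()))

module Characteristic {q : ℕ} (𝔽 : FiniteField q) where

  open FiniteField 𝔽
  open CommutativeRing commutativeRing
    using (ring; semiring; +-monoid; +-identityˡ; +-identityʳ; +-assoc; *-identityˡ; distribʳ; zeroˡ; -‿inverseˡ; -‿inverseʳ)
  open RingProperties ring using (+-cancelʳ)
  open SemiringSum semiring using (sum; sum-cong-≗; sum-permute; ∑-distrib-+; sum-replicate)
  open MonoidMult +-monoid using (×-homo-+) renaming (_×_ to _⋆_)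
  open ≡-Reasoning
  private module E = Inverse enumeration

  translation : Carrier ↔ Carrier
  translation = mk↔ₛ′ (1# +_) (- 1# +_)
    (λ a → trans (sym (+-assoc 1# (- 1#) a)) (trans (cong (_+ a) (-‿inverseʳ 1#)) (+-identityˡ a)))
    (λ a → trans (sym (+-assoc (- 1#) 1# a)) (trans (cong (_+ a) (-‿inverseˡ 1#)) (+-identityˡ a)))

  -- Translation by 1 permutes the q elements of the field, so it preserves their sum.
  q⋆1≡0 : q ⋆ 1# ≡ 0#
  q⋆1≡0 = sym (+-cancelʳ (sum E.to) 0# (q ⋆ 1#) (begin
    0# + sum E.to
      ≡⟨ +-identityˡ _ ⟩
    sum E.to
      ≡⟨ sum-permute E.to (↔-sym enumeration ↔-∘ (translation ↔-∘ enumeration)) ⟩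
    sum (λ i → E.to (E.from (1# + E.to i)))
      ≡⟨ sum-cong-≗ (λ i → E.strictlyInverseˡ (1# + E.to i)) ⟩
    sum (λ i → 1# + E.to i)
      ≡⟨ ∑-distrib-+ (λ _ → 1#) E.to ⟩
    sum {q} (λ _ → 1#) + sum E.to
      ≡⟨ cong (_+ sum E.to) (sum-replicate q) ⟩
    q ⋆ 1# + sum E.to ∎))

  -- The sum of q = 2k + 1 ones is zero. If 1 + 1 were zero, 2k of them would cancel and leave 1 =
  -- 0.
  1+1≢0 : 2 ∤ q → 1# + 1# ≢ 0#
  1+1≢0 2∤q e with odd-form q 2∤q
  ... | k , q≡ = 0≢1 (begin
    0#                          ≡⟨ sym q⋆1≡0 ⟩
    q ⋆ 1#                      ≡⟨ cong (_⋆ 1#) q≡ ⟩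
    1# + (k ℕ.+ k) ⋆ 1#         ≡⟨ cong (1# +_) (×-homo-+ 1# k k) ⟩
    1# + (k ⋆ 1# + k ⋆ 1#)      ≡⟨ cong (1# +_) (cong₂ _+_ (sym (*-identityˡ _)) (sym (*-identityˡ _))) ⟩
    1# + (1# * a + 1# * a)      ≡⟨ cong (1# +_) (sym (distribʳ a 1# 1#)) ⟩
    1# + (1# + 1#) * a          ≡⟨ cong (λ b → 1# + b * a) e ⟩
    1# + 0# * a                 ≡⟨ trans (cong (1# +_) (zeroˡ a)) (+-identityʳ 1#) ⟩
    1#                          ∎)
    where a = k ⋆ 1#

  half : 2 ∤ q → ∃[ h ] h + h ≡ 1#
  half 2∤q with inverse (1# + 1#) (1+1≢0 2∤q)
  ... | h , e = h , trans (cong₂ _+_ (sym (*-identityˡ h)) (sym (*-identityˡ h)))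
                      (trans (sym (distribʳ h 1# 1#)) e)

-- Enumerating the D-partitions without repetition.

pointwise : Set → Setoid 0ℓ 0ℓ → Setoid 0ℓ 0ℓ
pointwise I S = record
  { Carrier = I → Carrier
  ; _≈_ = λ f g → ∀ i → f i ≈ g i
  ; isEquivalence = record
    { refl = λ i → S.refl ; sym = λ p i → S.sym (p i) ; trans = λ p q i → S.trans (p i) (q i) }
  }
  where
  open Setoid S using (Carrier; _≈_)
  module S = Setoid S

functions-unique : ∀ S m {xs} → Unique.Unique S xs →
  Unique.Unique (pointwise (Fin m) S) (Enumeration.functions m xs)
functions-unique S zero    xs! = [] ∷ []
functions-unique S (suc m) xs! = Unique.cartesianProductWith⁺ S (pointwise (Fin m) S) (pointwise (Fin (suc m)) S)
  Vector._∷_ (λ p → p zero , λ i → p (suc i)) xs! (functions-unique S m xs!)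

indexFunctions-unique : ∀ S n {xs} → Unique.Unique S xs →
  Unique.Unique (pointwise (Index n) S) (Enumeration.indexFunctions n xs)
indexFunctions-unique S n xs! = Unique.cartesianProductWith⁺ (pointwise (Fin n) S) (pointwise (Fin n) S)
  (pointwise (Index n) S) Enumeration.copair (λ p → p ∘ pos , p ∘ neg)
  (functions-unique S n xs!) (functions-unique S n xs!)

mapMaybe-All : {A B : Set} {f : A → Maybe B} {P : A → Set} {Q : B → Set} →
  (∀ {x y} → f x ≡ just y → P x → Q y) → ∀ {xs} → All P xs → All Q (mapMaybe f xs)
mapMaybe-All pq [] = []
mapMaybe-All {f = f} pq {x ∷ xs} (px ∷ pxs) with f x in eq
... | nothing = mapMaybe-All pq pxs
... | just y  = pq eq px ∷ mapMaybe-All pq pxs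

mapMaybe-AllPairs : {A B : Set} {f : A → Maybe B} {R : A → A → Set} {R′ : B → B → Set} →
  (∀ {x x′ y y′} → f x ≡ just y → f x′ ≡ just y′ → R x x′ → R′ y y′) →
  ∀ {xs} → AllPairs R xs → AllPairs R′ (mapMaybe f xs)
mapMaybe-AllPairs r [] = []
mapMaybe-AllPairs {f = f} r {x ∷ xs} (px ∷ pxs) with f x in eq
... | nothing = mapMaybe-AllPairs r pxs
... | just y  = mapMaybe-All (r eq) px ∷ mapMaybe-AllPairs r pxs

module DPartitionEnumeration {q : ℕ} (𝔽 : FiniteField q) where

  open Group 𝔽

  infix 4 _≃_

  _≃_ : ∀ {n} → DPartition n → DPartition n → Set
  lam ≃ mu = label lam ≋ label mu

  isDPartition-resp : ∀ {n} {x y : Mat± n} → x ≋ y → IsDPartition x → IsDPartition y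
  isDPartition-resp {x = x} {y} e D = record
    { ordered = λ i j a p → ordered i j a (back p)
    ; ¬antipodal = λ i j a p → ¬antipodal i j a (back p)
    ; symmetric = λ i j a p → let s , a≢0 = symmetric i j a (back p) in trans (sym (e _ _)) s , a≢0
    ; nonNesting = λ i j a p k i≺k k≺j b →
        let f , g = nonNesting i j a (back p) k i≺k k≺j b in f ∘ back , g ∘ back
    }
    where
    open IsDPartition D
    back : ∀ {i j a} → Arc y i j a → Arc x i j a
    back (p , a≢0) = trans (e _ _) p , a≢0

  -- The function mapped over all matrices in `dPartitions`, with the decision made an argument so
  -- that proofs can match on it.
  toDPartition : ∀ {n} (y : Mat± n) → Dec (IsDPartition y) → Maybe (DPartition n)
  toDPartition y d = Maybe.map (λ d → record { label = y ; isDPartition = d }) (dec⇒maybe d)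

  dPartitions-complete : ∀ {n} (lam : DPartition n) → Any (_≃ lam) (dPartitions n)
  dPartitions-complete {n} lam = Any.mapMaybe⁺ (λ y → toDPartition y (isDPartition? y)) (matrices n)
    (Any.map⁺ (Any.map (λ {y} → found y (isDPartition? y)) (matrices-complete (label lam))))
    where
    found : ∀ y d → y ≋ label lam → MAny.Any (_≃ lam) (toDPartition y d)
    found y (yes _) e = MAny.just e
    found y (no ¬d) e = contradiction (isDPartition-resp (λ i j → sym (e i j)) (isDPartition lam)) ¬d

  elements-unique : Unique.Unique (≡-setoid F) elements
  elements-unique = UniqueP.map⁺ (λ {x} {y} e →
      trans (sym (E.strictlyInverseʳ x)) (trans (cong E.from e) (E.strictlyInverseʳ y)))
    (UniqueP.allFin⁺ q)
    where module E = Inverse enumeration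

  dPartitions-unique : ∀ n → AllPairs (λ lam mu → ¬ lam ≃ mu) (dPartitions n)
  dPartitions-unique n = mapMaybe-AllPairs
    (λ {x} {x′} → distinct x x′ (isDPartition? x) (isDPartition? x′))
    (indexFunctions-unique (pointwise (Index n) (≡-setoid F)) n (indexFunctions-unique (≡-setoid F) n elements-unique))
    where
    distinct : ∀ (x x′ : Mat± n) d d′ {lam mu} → toDPartition x d ≡ just lam → toDPartition x′ d′ ≡ just mu →
      ¬ x ≋ x′ → ¬ lam ≃ mu
    distinct x x′ (yes _) (yes _) refl refl x≄x′ = x≄x′

-- The P-basis of the superclass functions

module SuperclassBasis {q : ℕ} (𝔽 : FiniteField q) (R : CommutativeRing 0ℓ 0ℓ)
  (covers : ∀ {n} (x : Group.Uᴰ 𝔽 n) → ∃[ lam ] Group._∈K_ 𝔽 x lam)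
  (nonempty : ∀ {n} (lam : Group.DPartition 𝔽 n) → ∃[ x ] Group._∈K_ 𝔽 x lam) where

  open SuperclassFunctions 𝔽 R
  open Group 𝔽 using (I±; _≟ᶠ_; label; isDPartition; module Disjointness)
  open DPartitionEnumeration 𝔽
  open Sums R
  open CommutativeRing (FiniteField.commutativeRing 𝔽) using (_-_)
  private module R = CommutativeRing R

  ≃-sym : ∀ {n} {lam mu : DPartition n} → lam ≃ mu → mu ≃ lam
  ≃-sym e i j = sym (e i j)

  ≃-trans : ∀ {n} {lam mu nu : DPartition n} → lam ≃ mu → mu ≃ nu → lam ≃ nu
  ≃-trans e e′ i j = trans (e i j) (e′ i j)

  ≃⇒⊑ : ∀ {n} {lam mu : DPartition n} → lam ≃ mu → lam ⊑ mu
  ≃⇒⊑ e i j a (p , a≢0) = trans (sym (e i j)) p , a≢0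

  ⊑-antisym : ∀ {n} (lam mu : DPartition n) → lam ⊑ mu → mu ⊑ lam → lam ≃ mu
  ⊑-antisym lam mu p q i j = go (label lam i j ≟ᶠ Group.0# 𝔽) (label mu i j ≟ᶠ Group.0# 𝔽)
    where
    go : Dec (label lam i j ≡ Group.0# 𝔽) → Dec (label mu i j ≡ Group.0# 𝔽) → label lam i j ≡ label mu i j
    go (no ≢0) _         = sym (proj₁ (p i j _ (refl , ≢0)))
    go (yes _) (no ≢0)   = proj₁ (q i j _ (refl , ≢0))
    go (yes e) (yes e′)  = trans e (sym e′)

  minusI : ∀ {n} → Uᴰ n → Mat± n
  minusI x i j = matrix x i j - I± i j

  ∈K-resp-≃ : ∀ {n} {lam mu : DPartition n} x → lam ≃ mu → x ∈K lam → x ∈K mu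
  ∈K-resp-≃ {lam = lam} {mu} x e = Disjointness.∈V-resp {x = minusI x} {minusI x} {label lam} {label mu} (λ _ _ → refl) e

  ∈K⇒≃ : ∀ {n} (lam mu : DPartition n) x → x ∈K lam → x ∈K mu → lam ≃ mu
  ∈K⇒≃ lam mu x p q = Disjointness.∈V-unique {x = minusI x} {label lam} {label mu} (Disjointness.dPartition-sparse (isDPartition lam))
    (Disjointness.dPartition-sparse (isDPartition mu)) p q

  κ-on : ∀ {n} (lam : DPartition n) x → x ∈K lam → fn (κ lam) x R.≈ R.1#
  κ-on lam x p with x ∈K? lam
  ... | yes _ = R.refl
  ... | no ¬p = contradiction p ¬p

  κ-off : ∀ {n} (lam : DPartition n) x → ¬ x ∈K lam → fn (κ lam) x R.≈ R.0#
  κ-off lam x ¬p with x ∈K? lam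
  ... | yes p = contradiction p ¬p
  ... | no _  = R.refl

  κ-cong : ∀ {n} {lam mu : DPartition n} → lam ≃ mu → κ lam ≈[ SCᴰ₂ n ] κ mu
  κ-cong {lam = lam} {mu} e x = go (x ∈K? lam)
    where
    go : Dec (x ∈K lam) → fn (κ lam) x R.≈ fn (κ mu) x
    go (yes p) = R.trans (κ-on lam x p) (R.sym (κ-on mu x (∈K-resp-≃ {lam = lam} {mu} x e p)))
    go (no ¬p) = R.trans (κ-off lam x ¬p) (R.sym (κ-off mu x (¬p ∘ ∈K-resp-≃ {lam = mu} {lam} x (≃-sym {lam = lam} {mu} e))))

  evaluate : ∀ {n} → Uᴰ n → SCᴰ₂ n ⟶ 𝕂
  evaluate {n} x = linear {SCᴰ₂ n} {𝕂} (λ f → fn f x) (λ e → e x) (λ _ _ → R.refl) (λ _ _ → R.refl)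

  representative : ∀ {n} → DPartition n → Uᴰ n
  representative lam = proj₁ (nonempty lam)

  representative∈K : ∀ {n} (lam : DPartition n) → representative lam ∈K lam
  representative∈K lam = proj₂ (nonempty lam)

  single : ∀ {n} (M : Mod) (lam : DPartition n) {f : DPartition n → ∣ M ∣} {v} →
    (∀ mu → mu ≃ lam → f mu ≈[ M ] v) → (∀ mu → ¬ mu ≃ lam → f mu ≈[ M ] LeftModule.0ᴹ M) →
    sumᴸ M (dPartitions n) f ≈[ M ] v
  single {n} M lam = SumsIn.Σ-single M {_~_ = _≃_}
    (λ {a} {b} → ≃-sym {lam = a} {b}) (λ {a} {b} {c} → ≃-trans {lam = a} {b} {c}) {a = lam}
    (dPartitions-unique n) (dPartitions-complete lam)

  -- At x only the term of the superclass containing x survives, and f takes the same value at x as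
  -- at the representative.
  κ-expansion : ∀ {n} (f : SuperclassFunction n) →
    f ≈[ SCᴰ₂ n ] sumᴸ (SCᴰ₂ n) (dPartitions n) (λ mu → LeftModule._*ₗ_ (SCᴰ₂ n) (fn f (representative mu)) (κ mu))
  κ-expansion {n} f x = R.sym (R.trans (Σ-homo (evaluate x) (dPartitions n) (λ mu → LeftModule._*ₗ_ (SCᴰ₂ n) (fn f (representative mu)) (κ mu)))
    (single 𝕂 lam
      (λ mu mu≃lam → R.trans (R.*-cong
          (constant f mu (representative mu) x (representative∈K mu) (∈K-resp-≃ {lam = lam} {mu} x (≃-sym {lam = mu} {lam} mu≃lam) x∈lam))
          (κ-on mu x (∈K-resp-≃ {lam = lam} {mu} x (≃-sym {lam = mu} {lam} mu≃lam) x∈lam)))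
        (R.*-identityʳ _))
      (λ mu mu≄lam → R.trans (R.*-congˡ (κ-off mu x (λ x∈mu → mu≄lam (∈K⇒≃ mu lam x x∈mu x∈lam)))) (R.zeroʳ _))))
    where
    lam = proj₁ (covers x)
    x∈lam = proj₂ (covers x)

  module Möbius (n : ℕ) = MöbiusInversion {DPartition n} {_⊑_} _⊑?_
    (λ _ _ _ p → p) (λ p q i j a → q i j a ∘ p i j a) (dPartitions n)
    (λ lam → Any.map (λ {mu} e → ≃⇒⊑ {lam = mu} {lam} e , ≃⇒⊑ {lam = lam} {mu} (≃-sym {lam = mu} {lam} e)) (dPartitions-complete lam))
    (AllPairs.map (λ {lam} {mu} lam≄mu (p , q) → lam≄mu (⊑-antisym lam mu p q)) (dPartitions-unique n))

  module _ (N : Mod) where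

    open LeftModule N
    open SumsIn N
    open SetoidReasoning ≈ᴹ-setoid

    Respectful : ∀ n → (DPartition n → ∣ N ∣) → Set
    Respectful n g = ∀ lam mu → lam ≃ mu → g lam ≈ᴹ g mu

    module _ {n} (g : DPartition n → ∣ N ∣) where

      -- The value of f at the representative of K μ is its coefficient at κ μ, so this is linear
      -- extension from the κ μ.
      fromκ : SCᴰ₂ n ⟶ N
      fromκ = linear {SCᴰ₂ n} {N} (λ f → Σ (dPartitions n) (λ mu → fn f (representative mu) *ₗ g mu))
        (λ e → Σ-cong (dPartitions n) (λ mu → *ₗ-congʳ (e (representative mu))))
        (λ f h → ≈ᴹ-trans (Σ-cong (dPartitions n) (λ mu → *ₗ-distribʳ (g mu) _ _)) (Σ-+ (dPartitions n) _ _))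
        (λ r f → ≈ᴹ-trans (Σ-cong (dPartitions n) (λ mu → *ₗ-assoc r _ (g mu))) (Σ-* (dPartitions n) r _))

      fromκ-κ : Respectful n g → ∀ lam → (fromκ $ κ lam) ≈ᴹ g lam
      fromκ-κ resp lam = single N lam
        (λ mu mu≃lam → ≈ᴹ-trans (*ₗ-congʳ (κ-on lam (representative mu) (∈K-resp-≃ {lam = mu} {lam} (representative mu) mu≃lam (representative∈K mu))))
          (≈ᴹ-trans (*ₗ-identityˡ (g mu)) (resp mu lam mu≃lam)))
        (λ mu mu≄lam → ≈ᴹ-trans (*ₗ-congʳ (κ-off lam (representative mu) (λ p → mu≄lam (∈K⇒≃ mu lam (representative mu) (representative∈K mu) p))))
          (*ₗ-zeroˡ (g mu)))

    -- To send each P λ to g λ, the κ μ must go to elements h μ whose sum over μ ≥ λ is g λ for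
    -- every λ; the Möbius inversion of g is such an h.
    fromP₂ : ∀ {n} (g : DPartition n → ∣ N ∣) → Respectful n g → SCᴰ₂ n ⟶ N
    fromP₂ {n} g resp = fromκ (Möbius.inversion n N g (λ {lam} {mu} (p , q) → resp lam mu (⊑-antisym lam mu p q)))

    fromP₂-P₂ : ∀ {n} (g : DPartition n → ∣ N ∣) (resp : Respectful n g) lam → (fromP₂ g resp $ P₂ lam) ≈ᴹ g lam
    fromP₂-P₂ {n} g resp lam = begin
      (fromP₂ g resp $ P₂ lam)
        ≈⟨ Σ-homo (fromP₂ g resp) (filter (lam ⊑?_) (dPartitions n)) κ ⟩
      Σ (filter (lam ⊑?_) (dPartitions n)) (λ mu → fromP₂ g resp $ κ mu)
        ≈⟨ Σ-filter (lam ⊑?_) (dPartitions n) _ ⟩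
      Σ (dPartitions n) (λ mu → when (lam ⊑? mu) (fromP₂ g resp $ κ mu))
        ≈⟨ Σ-cong (dPartitions n) (λ mu → when-cong (lam ⊑? mu) (lam ⊑? mu) (λ p → p) (λ p → p) (λ _ →
             fromκ-κ h (λ mu nu e → Möbius.inversion-resp n N g resp′ (≃⇒⊑ {lam = mu} {nu} e , ≃⇒⊑ {lam = nu} {mu} (≃-sym {lam = mu} {nu} e))) mu)) ⟩
      Möbius.above n N h lam
        ≈⟨ Möbius.above-inversion n N g resp′ lam ⟩
      g lam ∎
      where
      resp′ : Möbius.Respects n N g
      resp′ {lam} {mu} (p , q) = resp lam mu (⊑-antisym lam mu p q)
      h = Möbius.inversion n N g resp′

    -- Agreement on P λ is equality of sums over μ ≥ λ of values on κ μ. Injectivity of these sums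
    -- gives agreement on each κ μ, and the κ μ span.
    P₂-ext : ∀ {n} (f g : SCᴰ₂ n ⟶ N) → (∀ lam → (f $ P₂ lam) ≈ᴹ (g $ P₂ lam)) → f ⟶≈ g
    P₂-ext {n} f g e x = begin
      (f $ x)
        ≈⟨ expand f ⟩
      Σ (dPartitions n) (λ mu → fn x (representative mu) *ₗ (f $ κ mu))
        ≈⟨ Σ-cong (dPartitions n) (λ mu → *ₗ-congˡ (on-κ mu)) ⟩
      Σ (dPartitions n) (λ mu → fn x (representative mu) *ₗ (g $ κ mu))
        ≈⟨ expand g ⟨
      (g $ x) ∎
      where
      expand : ∀ h → (h $ x) ≈ᴹ Σ (dPartitions n) (λ mu → fn x (representative mu) *ₗ (h $ κ mu))
      expand h = ≈ᴹ-trans (_⟶_.⟦⟧-cong h (κ-expansion x)) (≈ᴹ-trans (Σ-homo h (dPartitions n) _)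
        (Σ-cong (dPartitions n) (λ mu → _⟶_.*ₗ-homo h _ _)))
      resp : ∀ h → Möbius.Respects n N (λ mu → h $ κ mu)
      resp h {lam} {mu} (p , q) = _⟶_.⟦⟧-cong h (κ-cong {lam = lam} {mu} (⊑-antisym lam mu p q))
      above-P : ∀ h lam → (h $ P₂ lam) ≈ᴹ Möbius.above n N (λ mu → h $ κ mu) lam
      above-P h lam = ≈ᴹ-trans (Σ-homo h (filter (lam ⊑?_) (dPartitions n)) κ) (Σ-filter (lam ⊑?_) (dPartitions n) _)
      on-κ : ∀ mu → (f $ κ mu) ≈ᴹ (g $ κ mu)
      on-κ = Möbius.above-injective n N (resp f) (resp g) (λ lam →
        ≈ᴹ-trans (≈ᴹ-sym (above-P f lam)) (≈ᴹ-trans (e lam) (above-P g lam)))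

    module _ (g : ∀ {n} → DPartition n → ∣ N ∣) (resp : ∀ {n} → Respectful n g) where

      fromP : SCᴰ ⟶ N
      fromP = DirectSums.fromSummands SCᴰ₂ N (λ n → fromP₂ g resp)

      fromP-P : ∀ {n} (lam : DPartition n) → (fromP $ P lam) ≈ᴹ g lam
      fromP-P {n} lam = ≈ᴹ-trans (DirectSums.fromSummands-ι SCᴰ₂ N (λ n → fromP₂ g resp) n (P₂ lam)) (fromP₂-P₂ g resp lam)

    P-ext : (f g : SCᴰ ⟶ N) → (∀ {n} (lam : DPartition n) → (f $ P lam) ≈ᴹ (g $ P lam)) → f ⟶≈ g
    P-ext f g e = DirectSums.⨁-ext SCᴰ₂ f g (λ n → P₂-ext (summand f n) (summand g n) e)
      where
      summand : (SCᴰ ⟶ N) → ∀ n → SCᴰ₂ n ⟶ N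
      summand h n = _∘ᴸ_ {SCᴰ₂ n} {SCᴰ} {N} h (DirectSums.ιᴸ SCᴰ₂ n)

  P-cong : ∀ {n} (lam mu : DPartition n) → lam ≃ mu → P lam ≈[ SCᴰ ] P mu
  P-cong {n} lam mu e = _⟶_.⟦⟧-cong (DirectSums.ιᴸ SCᴰ₂ n) {P₂ lam} {P₂ mu} (begin
    P₂ lam
      ≈⟨ Σ-filter (lam ⊑?_) (dPartitions n) κ ⟩
    Σ (dPartitions n) (λ nu → when (lam ⊑? nu) (κ nu))
      ≈⟨ Σ-cong (dPartitions n) (λ nu → when-cong (lam ⊑? nu) (mu ⊑? nu)
           (λ p i j a → p i j a ∘ ≃⇒⊑ {lam = mu} {lam} (≃-sym {lam = lam} {mu} e) i j a)
           (λ p i j a → p i j a ∘ ≃⇒⊑ {lam = lam} {mu} e i j a) {κ nu} {κ nu} (λ _ _ → R.refl)) ⟩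
    Σ (dPartitions n) (λ nu → when (mu ⊑? nu) (κ nu))
      ≈⟨ Σ-filter (mu ⊑?_) (dPartitions n) κ ⟨
    P₂ mu ∎)
    where
    open SumsIn (SCᴰ₂ n)
    open SetoidReasoning (LeftModule.≈ᴹ-setoid (SCᴰ₂ n))

  -- The empty ground set carries one D-partition up to `≃`, so its superclass is everything and a
  -- single κ is summed.
  P₂-zero : ∀ (lam : DPartition 0) x → fn (P₂ lam) x R.≈ R.1#
  P₂-zero lam x = R.trans (Σ-homo (evaluate x) (filter (lam ⊑?_) (dPartitions 0)) κ)
    (R.trans (SumsIn.Σ-filter 𝕂 (lam ⊑?_) (dPartitions 0) (λ mu → fn (κ mu) x))
    (single 𝕂 lam
      (λ mu e → R.trans (SumsIn.when-yes 𝕂 (lam ⊑? mu) (≃⇒⊑ {lam = lam} {mu} (all-≃ lam mu)) _)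
        (κ-on mu x (∈K-resp-≃ {lam = proj₁ (covers x)} {mu} x (all-≃ (proj₁ (covers x)) mu) (proj₂ (covers x)))))
      (λ mu ¬e → contradiction (all-≃ mu lam) ¬e)))
    where
    all-≃ : ∀ (lam mu : DPartition 0) → lam ≃ mu
    all-≃ lam mu (pos ())
    all-≃ lam mu (neg ())

  counit-P-zero : ∀ (lam : DPartition 0) → (counit $ P lam) R.≈ R.1#
  counit-P-zero lam = P₂-zero lam 1ᵁ₀

  counit-P-suc : ∀ {n} (lam : DPartition (suc n)) → (counit $ P lam) R.≈ R.0#
  -- The component in degree 0 of an element placed in degree suc n computes to zero.
  counit-P-suc lam = R.refl

  P∅≈unit : P ∅ᴰ ≈[ SCᴰ ] unit
  P∅≈unit = _⟶_.⟦⟧-cong (DirectSums.ιᴸ SCᴰ₂ 0) {P₂ ∅ᴰ} {κ ∅ᴰ} λ x → R.trans (P₂-zero ∅ᴰ x)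
    (R.sym (κ-on ∅ᴰ x (∈K-resp-≃ {lam = proj₁ (covers x)} {∅ᴰ} x (λ { (pos ()) ; (neg ()) }) (proj₂ (covers x)))))

-- Restrictions and unions of D-partitions

StrictlyMonotone : ∀ {m n} → (Fin m → Fin n) → Set
StrictlyMonotone e = ∀ {i j} → i Fin.< j → e i Fin.< e j

Enumerates : ∀ {m n} → (Fin m → Fin n) → (Fin n → Set) → Set
Enumerates e Q = (∀ i → Q (e i)) × (∀ j → Q j → ∃[ i ] e i ≡ j)

module _ {m n} {e : Fin m → Fin n} (mono : StrictlyMonotone e) where

  mono-injective : ∀ {i j} → e i ≡ e j → i ≡ j
  mono-injective {i} {j} ei≡ej with Fin.<-cmp i j
  ... | tri< p _ _ = contradiction (mono p) (Fin.<-irrefl ei≡ej)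
  ... | tri≈ _ p _ = p
  ... | tri> _ _ p = contradiction (mono p) (Fin.<-irrefl (sym ei≡ej))

  mono-reflects : ∀ {i j} → e i Fin.< e j → i Fin.< j
  mono-reflects {i} {j} p with Fin.<-cmp i j
  ... | tri< q _ _ = q
  ... | tri≈ _ refl _ = contradiction p (Fin.<-irrefl refl)
  ... | tri> _ _ q = contradiction (Fin.<-trans p (mono q)) (Fin.<-irrefl refl)

  mono-inflationary : ∀ i → toℕ i ℕ.≤ toℕ (e i)
  mono-inflationary i = go (toℕ i) i refl
    where
    go : ∀ k i → toℕ i ≡ k → k ℕ.≤ toℕ (e i)
    go zero    i       _ = z≤n
    go (suc k) (suc i) p = ℕ.≤-trans
      (s≤s (go k (inject₁ i) (trans (Fin.toℕ-inject₁ i) (ℕ.suc-injective p))))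
      (mono (s≤s (ℕ.≤-reflexive (Fin.toℕ-inject₁ i))))

-- Comparing the enumerations gives increasing maps f and g with g (f i) = i. An increasing map
-- never lowers a value, so i ≤ f i ≤ g (f i) = i, and f is the cast.
enumeration-unique : ∀ {m m′ n} {e : Fin m → Fin n} {e′ : Fin m′ → Fin n} {Q : Fin n → Set} →
  StrictlyMonotone e → StrictlyMonotone e′ → Enumerates e Q → Enumerates e′ Q →
  Σ[ eq ∈ m ≡ m′ ] ∀ i → e′ (Fin.cast eq i) ≡ e i
enumeration-unique {m} {m′} {e = e} {e′} mono mono′ (into , onto) (into′ , onto′) = m≡m′ , λ i →
  trans (cong e′ (Fin.toℕ-injective (trans (Fin.toℕ-cast m≡m′ i)
    (ℕ.≤-antisym (mono-inflationary f-mono i)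
      (ℕ.≤-trans (mono-inflationary g-mono (f i)) (ℕ.≤-reflexive (cong toℕ (gf i)))))))) (e′f i)
  where
  f : Fin m → Fin m′
  f i = proj₁ (onto′ (e i) (into i))
  g : Fin m′ → Fin m
  g i = proj₁ (onto (e′ i) (into′ i))
  e′f : ∀ i → e′ (f i) ≡ e i
  e′f i = proj₂ (onto′ (e i) (into i))
  eg : ∀ i → e (g i) ≡ e′ i
  eg i = proj₂ (onto (e′ i) (into′ i))
  f-mono : StrictlyMonotone f
  f-mono p = mono-reflects mono′ (subst₂ Fin._<_ (sym (e′f _)) (sym (e′f _)) (mono p))
  g-mono : StrictlyMonotone g
  g-mono p = mono-reflects mono (subst₂ Fin._<_ (sym (eg _)) (sym (eg _)) (mono′ p))
  gf : ∀ i → g (f i) ≡ i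
  gf i = mono-injective mono (trans (eg (f i)) (e′f i))
  m≡m′ : m ≡ m′
  m≡m′ = ℕ.≤-antisym (Fin.injective⇒≤ (mono-injective f-mono)) (Fin.injective⇒≤ (mono-injective g-mono))

magnitude : ∀ {n} → Index n → Fin n
magnitude (pos i) = i
magnitude (neg i) = i

magnitude-±map : ∀ {m n} (e : Fin m → Fin n) i → magnitude (±map e i) ≡ e (magnitude i)
magnitude-±map e (pos _) = refl
magnitude-±map e (neg _) = refl

±map-id : ∀ {m} {e : Fin m → Fin m} → (∀ i → e i ≡ i) → ∀ i → ±map e i ≡ i
±map-id p (pos i) = cong pos (p i)
±map-id p (neg i) = cong neg (p i)

card-++ : ∀ {k l} (A : Subset k) (B : Subset l) → card A ℕ.+ card B ≡ card (A ++ᵛ B)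
card-++ []ᵛ B = refl
card-++ (true  ∷ᵛ A) B = cong suc (card-++ A B)
card-++ (false ∷ᵛ A) B = card-++ A B

data Colour : Set where
  first second third : Colour

isFirst isSecond notThird : Colour → Bool
isFirst first = true
isFirst _     = false
isSecond second = true
isSecond _      = false
notThird third = false
notThird _     = true

-- A 3-colouring of [n] is the same as a subset A with a subset of A
-- (colours first, second inside A), and the same as a subset A′ with a subset
-- of its complement (colours second, third outside A′).
notThirdSet firstSet : ∀ {n} → Vec Colour n → Subset n
notThirdSet = Vec.map notThird
firstSet = Vec.map isFirst

-- Recursion on the colouring makes `card (notThirdSet c)` compute in each case.
firstInNotThird : ∀ {n} (c : Vec Colour n) → Subset (card (notThirdSet c))
firstInNotThird []ᵛ = []ᵛ
firstInNotThird (first  ∷ᵛ c) = inside ∷ᵛ firstInNotThird c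
firstInNotThird (second ∷ᵛ c) = outside ∷ᵛ firstInNotThird c
firstInNotThird (third  ∷ᵛ c) = firstInNotThird c

secondInNotFirst : ∀ {n} (c : Vec Colour n) → Subset (card (∁ (firstSet c)))
secondInNotFirst []ᵛ = []ᵛ
secondInNotFirst (first  ∷ᵛ c) = secondInNotFirst c
secondInNotFirst (second ∷ᵛ c) = inside ∷ᵛ secondInNotFirst c
secondInNotFirst (third  ∷ᵛ c) = outside ∷ᵛ secondInNotFirst c

module Restriction {q : ℕ} (𝔽 : FiniteField q) where

  open Group 𝔽
  open DPartitionEnumeration 𝔽

  lookup-embed : ∀ {n} (A : Subset n) i → lookup A (embed A i) ≡ inside
  lookup-embed (true  ∷ᵛ A) zero    = refl
  lookup-embed (true  ∷ᵛ A) (suc i) = lookup-embed A i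
  lookup-embed (false ∷ᵛ A) i       = lookup-embed A i

  embed-onto : ∀ {n} (A : Subset n) j → lookup A j ≡ inside → ∃[ i ] embed A i ≡ j
  embed-onto (true  ∷ᵛ A) zero    _ = zero , refl
  embed-onto (true  ∷ᵛ A) (suc j) p = let i , e = embed-onto A j p in suc i , cong suc e
  embed-onto (false ∷ᵛ A) (suc j) p = let i , e = embed-onto A j p in i , cong suc e

  embed-enumerates : ∀ {n} (A : Subset n) {Q : Fin n → Set} →
    (∀ j → lookup A j ≡ inside → Q j) → (∀ j → Q j → lookup A j ≡ inside) → Enumerates (embed A) Q
  embed-enumerates A f g = (λ i → f (embed A i) (lookup-embed A i)) , λ j p → embed-onto A j (g j p)

  embed∘embed-enumerates : ∀ {n} (A : Subset n) (B : Subset (card A)) {Q : Fin n → Set} →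
    (∀ i → lookup B i ≡ inside → Q (embed A i)) → (∀ i → Q (embed A i) → lookup B i ≡ inside) →
    (∀ j → Q j → lookup A j ≡ inside) → Enumerates (embed A ∘ embed B) Q
  embed∘embed-enumerates A B {Q} f g h = (λ i → f (embed B i) (lookup-embed B i)) , onto
    where
    onto : ∀ j → Q j → ∃[ i ] embed A (embed B i) ≡ j
    onto j p with embed-onto A j (h j p)
    ... | i , refl with embed-onto B i (g i p)
    ...   | i′ , refl = i′ , refl

  lookup-firstInNotThird : ∀ {n} (c : Vec Colour n) i →
    lookup (firstInNotThird c) i ≡ isFirst (lookup c (embed (notThirdSet c) i))
  lookup-firstInNotThird (first  ∷ᵛ c) zero    = refl
  lookup-firstInNotThird (first  ∷ᵛ c) (suc i) = lookup-firstInNotThird c i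
  lookup-firstInNotThird (second ∷ᵛ c) zero    = refl
  lookup-firstInNotThird (second ∷ᵛ c) (suc i) = lookup-firstInNotThird c i
  lookup-firstInNotThird (third  ∷ᵛ c) i       = lookup-firstInNotThird c i

  lookup-secondInNotFirst : ∀ {n} (c : Vec Colour n) i →
    lookup (secondInNotFirst c) i ≡ isSecond (lookup c (embed (∁ (firstSet c)) i))
  lookup-secondInNotFirst (first  ∷ᵛ c) i       = lookup-secondInNotFirst c i
  lookup-secondInNotFirst (second ∷ᵛ c) zero    = refl
  lookup-secondInNotFirst (second ∷ᵛ c) (suc i) = lookup-secondInNotFirst c i
  lookup-secondInNotFirst (third  ∷ᵛ c) zero    = refl
  lookup-secondInNotFirst (third  ∷ᵛ c) (suc i) = lookup-secondInNotFirst c i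

  infix 4 _≅_

  -- Equality of label functions across ground sets whose sizes are only propositionally equal.
  _≅_ : ∀ {m n} → DPartition m → DPartition n → Set
  _≅_ {m} {n} lam mu = Σ[ eq ∈ m ≡ n ]
    ∀ i j → label lam i j ≡ label mu (±map (Fin.cast eq) i) (±map (Fin.cast eq) j)

  PullsBack : ∀ {m n} → (Fin m → Fin n) → DPartition n → DPartition m → Set
  PullsBack e rho lam = ∀ i j → label lam i j ≡ label rho (±map e i) (±map e j)

  -- Increasing maps with the same image differ by a cast, so the two pullbacks of `rho` carry the
  -- same labels. The comparisons of iterated restrictions all reduce to this.
  pullback-unique : ∀ {m m′ n} {rho : DPartition n} {lam : DPartition m} {mu : DPartition m′}
    {e : Fin m → Fin n} {e′ : Fin m′ → Fin n} {Q : Fin n → Set} →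
    StrictlyMonotone e → StrictlyMonotone e′ → Enumerates e Q → Enumerates e′ Q →
    PullsBack e rho lam → PullsBack e′ rho mu → lam ≅ mu
  pullback-unique {rho = rho} {lam} {mu} {e} {e′} mono mono′ enum enum′ p p′
    with enumeration-unique mono mono′ enum enum′
  ... | eq , e′cast = eq , λ i j → begin
    label lam i j                                       ≡⟨ p i j ⟩
    label rho (±map e i) (±map e j)                     ≡⟨ cong₂ (label rho) (same i) (same j) ⟩
    label rho (±map e′ (±map (Fin.cast eq) i)) (±map e′ (±map (Fin.cast eq) j)) ≡⟨ sym (p′ _ _) ⟩
    label mu (±map (Fin.cast eq) i) (±map (Fin.cast eq) j) ∎
    where
    open ≡-Reasoning
    same : ∀ i → ±map e i ≡ ±map e′ (±map (Fin.cast eq) i)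
    same (pos i) = cong pos (sym (e′cast i))
    same (neg i) = cong neg (sym (e′cast i))

  st-st-pullsBack : ∀ {n} (A : Subset n) (B : Subset (card A)) (lam : DPartition n) →
    PullsBack (embed A ∘ embed B) lam (st B (st A lam))
  st-st-pullsBack A B lam (pos _) (pos _) = refl
  st-st-pullsBack A B lam (pos _) (neg _) = refl
  st-st-pullsBack A B lam (neg _) (pos _) = refl
  st-st-pullsBack A B lam (neg _) (neg _) = refl

  st-full : ∀ {n} (A : Subset n) (lam : DPartition n) → (∀ i → lookup A i ≡ inside) → st A lam ≅ lam
  st-full A lam full = pullback-unique {rho = lam} {st A lam} {lam} {Q = λ _ → A ≡ A} (embed-mono A) id
    (embed-enumerates A (λ _ _ → refl) (λ j _ → full j)) ((λ _ → refl) , λ j _ → j , refl)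
    (λ _ _ → refl) (λ i j → cong₂ (label lam) (sym (±map-id (λ _ → refl) i)) (sym (±map-id (λ _ → refl) j)))

  -- Splitting along A means that membership in A is constant on arcs. A general codomain X lets
  -- subsets and 3-colourings share one notion.
  Constant : ∀ {n} {X : Set} → DPartition n → (Fin n → X) → Set
  Constant lam f = ∀ i j a → Arc (label lam) i j a → f (magnitude i) ≡ f (magnitude j)

  ∈±⇒lookup : ∀ {n} (A : Subset n) i → i ∈± A → lookup A (magnitude i) ≡ inside
  ∈±⇒lookup A (pos i) = Vec.[]=⇒lookup
  ∈±⇒lookup A (neg i) = Vec.[]=⇒lookup

  lookup⇒∈± : ∀ {n} (A : Subset n) i → lookup A (magnitude i) ≡ inside → i ∈± A
  lookup⇒∈± A (pos i) = Vec.lookup⇒[]= i A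
  lookup⇒∈± A (neg i) = Vec.lookup⇒[]= i A

  lookup-∁ : ∀ {n} (A : Subset n) i → lookup (∁ A) i ≡ not (lookup A i)
  lookup-∁ A i = Vec.lookup-map i not A

  splits⇒constant : ∀ {n} {lam : DPartition n} {A} → SplitsAlong lam A → Constant lam (lookup A)
  splits⇒constant {A = A} s i j a p with s i j a p
  ... | inj₁ (_ , i∈A , j∈A) = trans (∈±⇒lookup A i i∈A) (sym (∈±⇒lookup A j j∈A))
  ... | inj₂ (_ , i∉A , j∉A) = not-injective (trans (sym (lookup-∁ A _))
    (trans (trans (∈±⇒lookup (∁ A) i i∉A) (sym (∈±⇒lookup (∁ A) j j∉A))) (lookup-∁ A _)))

  constant⇒splits : ∀ {n} {lam : DPartition n} {A} → Constant lam (lookup A) → SplitsAlong lam A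
  constant⇒splits {A = A} c i j a p with lookup A (magnitude i) in eq
  ... | true  = inj₁ (p , lookup⇒∈± A i eq , lookup⇒∈± A j (trans (sym (c i j a p)) eq))
  ... | false = inj₂ (p , lookup⇒∈± (∁ A) i (trans (lookup-∁ A _) (cong not eq)) ,
                          lookup⇒∈± (∁ A) j (trans (lookup-∁ A _) (cong not (trans (sym (c i j a p)) eq))))

  Colouring : ∀ {n} → DPartition n → Vec Colour n → Set
  Colouring lam c = Constant lam (lookup c)

  st-constant : ∀ {n} {lam : DPartition n} (A : Subset n) {X : Set} {f : Fin n → X} →
    Constant lam f → Constant (st A lam) (f ∘ embed A)
  st-constant A {f = f} c i j a p = trans (cong f (sym (magnitude-±map (embed A) i)))
    (trans (c _ _ a p) (cong f (magnitude-±map (embed A) j)))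

  constant-∘ : ∀ {n} {lam : DPartition n} {X Y : Set} {f : Fin n → X} {g : Fin n → Y} (h : X → Y) →
    (∀ i → g i ≡ h (f i)) → Constant lam f → Constant lam g
  constant-∘ h e c i j a p = trans (e _) (trans (cong h (c i j a p)) (sym (e _)))

  -- Constancy of membership puts both ends of an arc inside A or both outside. In the first case
  -- the arc comes from an arc of the restriction to A; in the second, f is assumed not to vary.
  constant-glue : ∀ {n} {lam : DPartition n} {X : Set} {f : Fin n → X} (A : Subset n) →
    Constant lam (lookup A) → Constant (st A lam) (f ∘ embed A) →
    (∀ i j → lookup A i ≡ outside → lookup A j ≡ outside → f i ≡ f j) → Constant lam f
  constant-glue {lam = lam} {f = f} A c cA out i j a p with lookup A (magnitude i) in eq
  ... | false = out _ _ eq (trans (sym (c i j a p)) eq)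
  ... | true = go (embed-onto± i eq) (embed-onto± j (trans (sym (c i j a p)) eq))
    where
    embed-onto± : ∀ i → lookup A (magnitude i) ≡ inside → ∃[ i′ ] ±map (embed A) i′ ≡ i
    embed-onto± (pos i) p = let i′ , e = embed-onto A i p in pos i′ , cong pos e
    embed-onto± (neg i) p = let i′ , e = embed-onto A i p in neg i′ , cong neg e
    go : ∃[ i′ ] ±map (embed A) i′ ≡ i → ∃[ j′ ] ±map (embed A) j′ ≡ j → f (magnitude i) ≡ f (magnitude j)
    go (i′ , refl) (j′ , refl) = trans (cong f (magnitude-±map (embed A) i′))
      (trans (cA i′ j′ a p) (cong f (sym (magnitude-±map (embed A) j′))))

  notThird≡ : ∀ {n} (c : Vec Colour n) i → lookup (notThirdSet c) i ≡ notThird (lookup c i)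
  notThird≡ c i = Vec.lookup-map i notThird c

  first≡ : ∀ {n} (c : Vec Colour n) i → lookup (firstSet c) i ≡ isFirst (lookup c i)
  first≡ c i = Vec.lookup-map i isFirst c

  notFirst≡ : ∀ {n} (c : Vec Colour n) i → lookup (∁ (firstSet c)) i ≡ not (isFirst (lookup c i))
  notFirst≡ c i = trans (lookup-∁ (firstSet c) i) (cong not (first≡ c i))

  third≡ : ∀ {n} (c : Vec Colour n) i → lookup (∁ (notThirdSet c)) i ≡ not (notThird (lookup c i))
  third≡ c i = trans (lookup-∁ (notThirdSet c) i) (cong not (notThird≡ c i))

  module _ {n} (lam : DPartition n) (c : Vec Colour n) where

    colouring⇒splitsˡ : Colouring lam c → SplitsAlong lam (notThirdSet c) ×
      SplitsAlong (st (notThirdSet c) lam) (firstInNotThird c)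
    colouring⇒splitsˡ m =
      constant⇒splits {lam = lam} (constant-∘ {lam = lam} notThird (notThird≡ c) m) ,
      constant⇒splits {lam = st (notThirdSet c) lam} (constant-∘ {lam = st (notThirdSet c) lam} isFirst (lookup-firstInNotThird c)
        (st-constant {lam = lam} (notThirdSet c) {f = lookup c} m))

    colouring⇒splitsʳ : Colouring lam c → SplitsAlong lam (firstSet c) ×
      SplitsAlong (st (∁ (firstSet c)) lam) (secondInNotFirst c)
    colouring⇒splitsʳ m =
      constant⇒splits {lam = lam} (constant-∘ {lam = lam} isFirst (first≡ c) m) ,
      constant⇒splits {lam = st (∁ (firstSet c)) lam} (constant-∘ {lam = st (∁ (firstSet c)) lam} isSecond (lookup-secondInNotFirst c)
        (st-constant {lam = lam} (∁ (firstSet c)) {f = lookup c} m))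

    splitsˡ⇒colouring : SplitsAlong lam (notThirdSet c) →
      SplitsAlong (st (notThirdSet c) lam) (firstInNotThird c) → Colouring lam c
    splitsˡ⇒colouring s t = constant-glue {lam = lam} (notThirdSet c) (splits⇒constant {lam = lam} s)
      (λ i j a p → recover _ _ (trans (sym (notThird≡ c _)) (lookup-embed (notThirdSet c) _))
                               (trans (sym (notThird≡ c _)) (lookup-embed (notThirdSet c) _))
        (trans (sym (lookup-firstInNotThird c _))
          (trans (splits⇒constant {lam = st (notThirdSet c) lam} t i j a p) (lookup-firstInNotThird c _))))
      (λ i j p q → trans (is-third _ (trans (sym (notThird≡ c i)) p)) (sym (is-third _ (trans (sym (notThird≡ c j)) q))))
      where
      -- Among the two colours allowed here, `isFirst` tells one from the other.
      recover : ∀ x y → notThird x ≡ true → notThird y ≡ true → isFirst x ≡ isFirst y → x ≡ y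
      recover first  first  _ _ _ = refl
      recover second second _ _ _ = refl
      is-third : ∀ x → notThird x ≡ false → x ≡ third
      is-third third _ = refl

    splitsʳ⇒colouring : SplitsAlong lam (firstSet c) →
      SplitsAlong (st (∁ (firstSet c)) lam) (secondInNotFirst c) → Colouring lam c
    splitsʳ⇒colouring s t = constant-glue {lam = lam} (∁ (firstSet c))
      (constant-∘ {lam = lam} not (lookup-∁ (firstSet c)) (splits⇒constant {lam = lam} s))
      (λ i j a p → recover _ _ (trans (sym (notFirst≡ c _)) (lookup-embed (∁ (firstSet c)) _))
                               (trans (sym (notFirst≡ c _)) (lookup-embed (∁ (firstSet c)) _))
        (trans (sym (lookup-secondInNotFirst c _))
          (trans (splits⇒constant {lam = st (∁ (firstSet c)) lam} t i j a p) (lookup-secondInNotFirst c _))))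
      (λ i j p q → trans (is-first _ (trans (sym (notFirst≡ c i)) p)) (sym (is-first _ (trans (sym (notFirst≡ c j)) q))))
      where
      recover : ∀ x y → not (isFirst x) ≡ true → not (isFirst y) ≡ true → isSecond x ≡ isSecond y → x ≡ y
      recover second second _ _ _ = refl
      recover third  third  _ _ _ = refl
      is-first : ∀ x → not (isFirst x) ≡ false → x ≡ first
      is-first first _ = refl

    private
      A = notThirdSet c
      B = firstInNotThird c
      A′ = firstSet c
      B′ = secondInNotFirst c

      mono₂ : ∀ (A : Subset n) (B : Subset (card A)) → StrictlyMonotone (embed A ∘ embed B)
      mono₂ A B p = embed-mono A (embed-mono B p)

    -- Here and in the next two lemmas each side is λ restricted to one colour class, reached in one
    -- or two restrictions. The class is the predicate `Q`.
    st-first : st B (st A lam) ≅ st A′ lam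
    st-first = pullback-unique {rho = lam} {st B (st A lam)} {st A′ lam} (mono₂ A B) (embed-mono A′)
      (embed∘embed-enumerates A B {Q = λ j → isFirst (lookup c j) ≡ true}
        (λ i p → trans (sym (lookup-firstInNotThird c i)) p) (λ i p → trans (lookup-firstInNotThird c i) p)
        (λ j p → trans (notThird≡ c j) (weaken (lookup c j) p)))
      (embed-enumerates A′ (λ j p → trans (sym (first≡ c j)) p) (λ j p → trans (first≡ c j) p))
      (st-st-pullsBack A B lam) (λ _ _ → refl)
      where
      weaken : ∀ x → isFirst x ≡ true → notThird x ≡ true
      weaken first _ = refl

    st-second : st (∁ B) (st A lam) ≅ st B′ (st (∁ A′) lam)
    st-second = pullback-unique {rho = lam} {st (∁ B) (st A lam)} {st B′ (st (∁ A′) lam)} (mono₂ A (∁ B)) (mono₂ (∁ A′) B′)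
      (embed∘embed-enumerates A (∁ B) {Q = λ j → isSecond (lookup c j) ≡ true}
        (λ i p → to _ (trans (sym (notThird≡ c _)) (lookup-embed A i)) (trans (sym (inB i)) p))
        (λ i p → trans (inB i) (from _ p))
        (λ j p → trans (notThird≡ c j) (weaken (lookup c j) p)))
      (embed∘embed-enumerates (∁ A′) B′
        (λ i p → trans (sym (lookup-secondInNotFirst c i)) p) (λ i p → trans (lookup-secondInNotFirst c i) p)
        (λ j p → trans (notFirst≡ c j) (from (lookup c j) p)))
      (st-st-pullsBack A (∁ B) lam) (st-st-pullsBack (∁ A′) B′ lam)
      where
      inB : ∀ i → lookup (∁ B) i ≡ not (isFirst (lookup c (embed A i)))
      inB i = trans (lookup-∁ B i) (cong not (lookup-firstInNotThird c i))
      to : ∀ x → notThird x ≡ true → not (isFirst x) ≡ true → isSecond x ≡ true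
      to second _ _ = refl
      from : ∀ x → isSecond x ≡ true → not (isFirst x) ≡ true
      from second _ = refl
      weaken : ∀ x → isSecond x ≡ true → notThird x ≡ true
      weaken second _ = refl

    st-third : st (∁ A) lam ≅ st (∁ B′) (st (∁ A′) lam)
    st-third = pullback-unique {rho = lam} {st (∁ A) lam} {st (∁ B′) (st (∁ A′) lam)} (embed-mono (∁ A)) (mono₂ (∁ A′) (∁ B′))
      (embed-enumerates (∁ A) {Q = λ j → not (notThird (lookup c j)) ≡ true}
        (λ j p → trans (sym (third≡ c j)) p) (λ j p → trans (third≡ c j) p))
      (embed∘embed-enumerates (∁ A′) (∁ B′)
        (λ i p → to _ (trans (sym (notFirst≡ c _)) (lookup-embed (∁ A′) i)) (trans (sym (inB i)) p))
        (λ i p → trans (inB i) (from _ p))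
        (λ j p → trans (notFirst≡ c j) (weaken (lookup c j) p)))
      (λ _ _ → refl) (st-st-pullsBack (∁ A′) (∁ B′) lam)
      where
      inB : ∀ i → lookup (∁ B′) i ≡ not (isSecond (lookup c (embed (∁ A′) i)))
      inB i = trans (lookup-∁ B′ i) (cong not (lookup-secondInNotFirst c i))
      to : ∀ x → not (isFirst x) ≡ true → not (isSecond x) ≡ true → not (notThird x) ≡ true
      to third _ _ = refl
      from : ∀ x → not (notThird x) ≡ true → not (isSecond x) ≡ true
      from third _ = refl
      weaken : ∀ x → not (notThird x) ≡ true → not (isFirst x) ≡ true
      weaken third _ = refl

  module _ {k l} (mu : DPartition k) (nu : DPartition l) where

    open Shift k l

    private
      y = label mu
      z = label nu

    union-ll : ∀ i j → label (mu ⊔↑ nu) (inl i) (inl j) ≡ y i j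
    union-ll i j rewrite split-inl i | split-inl j = refl

    union-rr : ∀ i j → label (mu ⊔↑ nu) (inr i) (inr j) ≡ z i j
    union-rr i j rewrite split-inr i | split-inr j = refl

    union-lr : ∀ i j → label (mu ⊔↑ nu) (inl i) (inr j) ≡ 0#
    union-lr i j rewrite split-inl i | split-inr j = refl

    union-rl : ∀ i j → label (mu ⊔↑ nu) (inr i) (inl j) ≡ 0#
    union-rl i j rewrite split-inr i | split-inl j = refl

    module _ (A : Subset k) (B : Subset l) where

      lookup-inl : ∀ i → lookup (A ++ᵛ B) (magnitude (inl i)) ≡ lookup A (magnitude i)
      lookup-inl (pos i) = Vec.lookup-++ˡ A B i
      lookup-inl (neg i) = Vec.lookup-++ˡ A B i

      lookup-inr : ∀ i → lookup (A ++ᵛ B) (magnitude (inr i)) ≡ lookup B (magnitude i)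
      lookup-inr (pos i) = Vec.lookup-++ʳ A B i
      lookup-inr (neg i) = Vec.lookup-++ʳ A B i

      union-splits⁺ : SplitsAlong mu A × SplitsAlong nu B → SplitsAlong (mu ⊔↑ nu) (A ++ᵛ B)
      union-splits⁺ (s , t) = constant⇒splits {lam = mu ⊔↑ nu} λ i j a p → go i j a (arc⇒union y z i j a p)
        where
        go : ∀ i j a → UnionArc y z i j a → lookup (A ++ᵛ B) (magnitude i) ≡ lookup (A ++ᵛ B) (magnitude j)
        go _ _ a (arcˡ i j refl refl p) = trans (lookup-inl i) (trans (splits⇒constant {lam = mu} s i j a p) (sym (lookup-inl j)))
        go _ _ a (arcʳ i j refl refl p) = trans (lookup-inr i) (trans (splits⇒constant {lam = nu} t i j a p) (sym (lookup-inr j)))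

      union-splits⁻ : SplitsAlong (mu ⊔↑ nu) (A ++ᵛ B) → SplitsAlong mu A × SplitsAlong nu B
      union-splits⁻ s =
        constant⇒splits {lam = mu} (λ i j a p → trans (sym (lookup-inl i))
          (trans (splits⇒constant {lam = mu ⊔↑ nu} s (inl i) (inl j) a (union⇒arc y z (inl i) (inl j) a (arcˡ i j refl refl p))) (lookup-inl j))) ,
        constant⇒splits {lam = nu} (λ i j a p → trans (sym (lookup-inr i))
          (trans (splits⇒constant {lam = mu ⊔↑ nu} s (inr i) (inr j) a (union⇒arc y z (inr i) (inr j) a (arcʳ i j refl refl p))) (lookup-inr j)))

  embed-++ˡ : ∀ {k l} (A : Subset k) (B : Subset l) i →
    embed (A ++ᵛ B) (Fin.cast (card-++ A B) (i ↑ˡ card B)) ≡ embed A i ↑ˡ l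
  embed-++ˡ (true  ∷ᵛ A) B zero    = refl
  embed-++ˡ (true  ∷ᵛ A) B (suc i) = cong suc (embed-++ˡ A B i)
  embed-++ˡ (false ∷ᵛ A) B i       = cong suc (embed-++ˡ A B i)

  embed-++ʳ : ∀ {k l} (A : Subset k) (B : Subset l) i →
    embed (A ++ᵛ B) (Fin.cast (card-++ A B) (card A ↑ʳ i)) ≡ k ↑ʳ embed B i
  embed-++ʳ []ᵛ           B i = cong (embed B) (Fin.cast-is-id refl i)
  embed-++ʳ (true  ∷ᵛ A) B i = cong suc (embed-++ʳ A B i)
  embed-++ʳ (false ∷ᵛ A) B i = cong suc (embed-++ʳ A B i)

  -- Restriction respects the two diagonal blocks, and off them both sides are zero.
  st-union : ∀ {k l} (mu : DPartition k) (nu : DPartition l) (A : Subset k) (B : Subset l) →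
    st A mu ⊔↑ st B nu ≅ st (A ++ᵛ B) (mu ⊔↑ nu)
  st-union {k} {l} mu nu A B = card-++ A B , λ i j → go i j (S.view i) (S.view j)
    where
    module S = Shift (card A) (card B)
    module T = Shift k l
    C : Index (card A ℕ.+ card B) → Index (card (A ++ᵛ B))
    C = ±map (Fin.cast (card-++ A B))
    e : Index (card (A ++ᵛ B)) → Index (k ℕ.+ l)
    e = ±map (embed (A ++ᵛ B))
    l≡ : ∀ i → e (C (S.inl i)) ≡ T.inl (±map (embed A) i)
    l≡ (pos i) = cong pos (embed-++ˡ A B i)
    l≡ (neg i) = cong neg (embed-++ˡ A B i)
    r≡ : ∀ i → e (C (S.inr i)) ≡ T.inr (±map (embed B) i)
    r≡ (pos i) = cong pos (embed-++ʳ A B i)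
    r≡ (neg i) = cong neg (embed-++ʳ A B i)
    u = label (mu ⊔↑ nu)
    go : ∀ i j → S.View i → S.View j → label (st A mu ⊔↑ st B nu) i j ≡ u (e (C i)) (e (C j))
    go _ _ (S.left i)  (S.left j)  = trans (union-ll (st A mu) (st B nu) i j)
      (sym (trans (cong₂ u (l≡ i) (l≡ j)) (union-ll mu nu _ _)))
    go _ _ (S.right i) (S.right j) = trans (union-rr (st A mu) (st B nu) i j)
      (sym (trans (cong₂ u (r≡ i) (r≡ j)) (union-rr mu nu _ _)))
    go _ _ (S.left i)  (S.right j) = trans (union-lr (st A mu) (st B nu) i j)
      (sym (trans (cong₂ u (l≡ i) (r≡ j)) (union-lr mu nu (±map (embed A) i) (±map (embed B) j))))
    go _ _ (S.right i) (S.left j)  = trans (union-rl (st A mu) (st B nu) i j)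
      (sym (trans (cong₂ u (r≡ i) (l≡ j)) (union-rl mu nu (±map (embed B) i) (±map (embed A) j))))

  -- Both sides are block diagonal with the same three blocks; the casts only identify where each
  -- block sits.
  union-assoc : ∀ {k l m} (mu : DPartition k) (nu : DPartition l) (rho : DPartition m) →
    mu ⊔↑ nu ⊔↑ rho ≅ mu ⊔↑ (nu ⊔↑ rho)
  union-assoc {k} {l} {m} mu nu rho = eq , λ i j → go i j (view i) (view j)
    where
    eq = ℕ.+-assoc k l m
    module S = Shift (k ℕ.+ l) m
    module S′ = Shift k l
    module T = Shift k (l ℕ.+ m)
    module T′ = Shift l m
    C : Index (k ℕ.+ l ℕ.+ m) → Index (k ℕ.+ (l ℕ.+ m))
    C = ±map (Fin.cast eq)
    data View : Index (k ℕ.+ l ℕ.+ m) → Set where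
      v₁ : ∀ i → View (S.inl (S′.inl i))
      v₂ : ∀ i → View (S.inl (S′.inr i))
      v₃ : ∀ i → View (S.inr i)
    view : ∀ i → View i
    view i with S.view i
    ... | S.right j = v₃ j
    ... | S.left j with S′.view j
    ...   | S′.left j′ = v₁ j′
    ...   | S′.right j′ = v₂ j′
    cast₁ : ∀ i → Fin.cast eq ((i ↑ˡ l) ↑ˡ m) ≡ i ↑ˡ (l ℕ.+ m)
    cast₁ i = Fin.toℕ-injective (trans (Fin.toℕ-cast eq _) (trans (Fin.toℕ-↑ˡ (i ↑ˡ l) m)
      (trans (Fin.toℕ-↑ˡ i l) (sym (Fin.toℕ-↑ˡ i (l ℕ.+ m))))))
    cast₂ : ∀ i → Fin.cast eq ((k ↑ʳ i) ↑ˡ m) ≡ k ↑ʳ (i ↑ˡ m)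
    cast₂ i = Fin.toℕ-injective (trans (Fin.toℕ-cast eq _) (trans (Fin.toℕ-↑ˡ (k ↑ʳ i) m)
      (trans (Fin.toℕ-↑ʳ k i) (sym (trans (Fin.toℕ-↑ʳ k (i ↑ˡ m)) (cong (k ℕ.+_) (Fin.toℕ-↑ˡ i m)))))))
    cast₃ : ∀ i → Fin.cast eq ((k ℕ.+ l) ↑ʳ i) ≡ k ↑ʳ (l ↑ʳ i)
    cast₃ i = Fin.toℕ-injective (trans (Fin.toℕ-cast eq _) (trans (Fin.toℕ-↑ʳ (k ℕ.+ l) i)
      (trans (ℕ.+-assoc k l (toℕ i)) (sym (trans (Fin.toℕ-↑ʳ k (l ↑ʳ i)) (cong (k ℕ.+_) (Fin.toℕ-↑ʳ l i)))))))
    c₁ : ∀ i → C (S.inl (S′.inl i)) ≡ T.inl i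
    c₁ (pos i) = cong pos (cast₁ i)
    c₁ (neg i) = cong neg (cast₁ i)
    c₂ : ∀ i → C (S.inl (S′.inr i)) ≡ T.inr (T′.inl i)
    c₂ (pos i) = cong pos (cast₂ i)
    c₂ (neg i) = cong neg (cast₂ i)
    c₃ : ∀ i → C (S.inr i) ≡ T.inr (T′.inr i)
    c₃ (pos i) = cong pos (cast₃ i)
    c₃ (neg i) = cong neg (cast₃ i)
    L = label (mu ⊔↑ nu ⊔↑ rho)
    R = label (mu ⊔↑ (nu ⊔↑ rho))
    mn = mu ⊔↑ nu
    nr = nu ⊔↑ rho
    go : ∀ i j → View i → View j → L i j ≡ R (C i) (C j)
    go _ _ (v₁ i) (v₁ j) = trans (trans (union-ll mn rho (S′.inl i) (S′.inl j)) (union-ll mu nu i j))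
      (sym (trans (cong₂ R (c₁ i) (c₁ j)) (union-ll mu nr i j)))
    go _ _ (v₁ i) (v₂ j) = trans (trans (union-ll mn rho (S′.inl i) (S′.inr j)) (union-lr mu nu i j))
      (sym (trans (cong₂ R (c₁ i) (c₂ j)) (union-lr mu nr i (T′.inl j))))
    go _ _ (v₁ i) (v₃ j) = trans (union-lr mn rho (S′.inl i) j)
      (sym (trans (cong₂ R (c₁ i) (c₃ j)) (union-lr mu nr i (T′.inr j))))
    go _ _ (v₂ i) (v₁ j) = trans (trans (union-ll mn rho (S′.inr i) (S′.inl j)) (union-rl mu nu i j))
      (sym (trans (cong₂ R (c₂ i) (c₁ j)) (union-rl mu nr (T′.inl i) j)))
    go _ _ (v₂ i) (v₂ j) = trans (trans (union-ll mn rho (S′.inr i) (S′.inr j)) (union-rr mu nu i j))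
      (sym (trans (cong₂ R (c₂ i) (c₂ j)) (trans (union-rr mu nr (T′.inl i) (T′.inl j)) (union-ll nu rho i j))))
    go _ _ (v₂ i) (v₃ j) = trans (union-lr mn rho (S′.inr i) j)
      (sym (trans (cong₂ R (c₂ i) (c₃ j)) (trans (union-rr mu nr (T′.inl i) (T′.inr j)) (union-lr nu rho i j))))
    go _ _ (v₃ i) (v₁ j) = trans (union-rl mn rho i (S′.inl j))
      (sym (trans (cong₂ R (c₃ i) (c₁ j)) (union-rl mu nr (T′.inr i) j)))
    go _ _ (v₃ i) (v₂ j) = trans (union-rl mn rho i (S′.inr j))
      (sym (trans (cong₂ R (c₃ i) (c₂ j)) (trans (union-rr mu nr (T′.inr i) (T′.inl j)) (union-rl nu rho i j))))
    go _ _ (v₃ i) (v₃ j) = trans (union-rr mn rho i j)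
      (sym (trans (cong₂ R (c₃ i) (c₃ j)) (trans (union-rr mu nr (T′.inr i) (T′.inr j)) (union-rr nu rho i j))))

  union-identityˡ : ∀ {n} (lam : DPartition n) → ∅ᴰ ⊔↑ lam ≃ lam
  union-identityˡ lam (pos _) (pos _) = refl
  union-identityˡ lam (pos _) (neg _) = refl
  union-identityˡ lam (neg _) (pos _) = refl
  union-identityˡ lam (neg _) (neg _) = refl

  union-identityʳ : ∀ {n} (lam : DPartition n) → lam ⊔↑ ∅ᴰ ≅ lam
  union-identityʳ {n} lam = eq , λ i j → go i j (S.view i) (S.view j)
    where
    eq = ℕ.+-identityʳ n
    module S = Shift n 0
    C : Index (n ℕ.+ 0) → Index n
    C = ±map (Fin.cast eq)
    cast≡ : ∀ i → Fin.cast eq (i ↑ˡ 0) ≡ i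
    cast≡ i = Fin.toℕ-injective (trans (Fin.toℕ-cast eq _) (Fin.toℕ-↑ˡ i 0))
    c : ∀ i → C (S.inl i) ≡ i
    c (pos i) = cong pos (cast≡ i)
    c (neg i) = cong neg (cast≡ i)
    go : ∀ i j → S.View i → S.View j → label (lam ⊔↑ ∅ᴰ) i j ≡ label lam (C i) (C j)
    go _ _ (S.left i) (S.left j) = trans (union-ll lam ∅ᴰ i j) (sym (cong₂ (label lam) (c i) (c j)))
    go _ _ (S.right (pos ())) _
    go _ _ (S.right (neg ())) _
    go _ _ _ (S.right (pos ()))
    go _ _ _ (S.right (neg ()))

  union-cong : ∀ {k l} {mu mu′ : DPartition k} {nu nu′ : DPartition l} →
    mu ≃ mu′ → nu ≃ nu′ → mu ⊔↑ nu ≃ mu′ ⊔↑ nu′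
  union-cong {k} {l} {mu} {mu′} {nu} {nu′} p q i j = go i j (S.view i) (S.view j)
    where
    module S = Shift k l
    go : ∀ i j → S.View i → S.View j → label (mu ⊔↑ nu) i j ≡ label (mu′ ⊔↑ nu′) i j
    go _ _ (S.left i)  (S.left j)  = trans (union-ll mu nu i j) (trans (p i j) (sym (union-ll mu′ nu′ i j)))
    go _ _ (S.right i) (S.right j) = trans (union-rr mu nu i j) (trans (q i j) (sym (union-rr mu′ nu′ i j)))
    go _ _ (S.left i)  (S.right j) = trans (union-lr mu nu i j) (sym (union-lr mu′ nu′ i j))
    go _ _ (S.right i) (S.left j)  = trans (union-rl mu nu i j) (sym (union-rl mu′ nu′ i j))

  splits-resp : ∀ {n} {lam mu : DPartition n} {A} → lam ≃ mu → SplitsAlong lam A → SplitsAlong mu A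
  splits-resp {lam = lam} {mu} e s = constant⇒splits {lam = mu} λ i j a (p , a≢0) →
    splits⇒constant {lam = lam} s i j a (trans (e i j) p , a≢0)

  splits-⊥ : ∀ {n} (lam : DPartition n) → SplitsAlong lam ⊥
  splits-⊥ lam = constant⇒splits {lam = lam} λ i j a p →
    trans (Vec.lookup-replicate (magnitude i) outside) (sym (Vec.lookup-replicate (magnitude j) outside))

  splits-⊤ : ∀ {n} (lam : DPartition n) → SplitsAlong lam ⊤
  splits-⊤ lam = constant⇒splits {lam = lam} λ i j a p →
    trans (Vec.lookup-replicate (magnitude i) inside) (sym (Vec.lookup-replicate (magnitude j) inside))

-- Convolution and the Hopf algebra axioms

-- Partial sums of the geometric series for the inverse of i = 1 + u.
module GeometricSeries {c ℓ} (R : Ring c ℓ) (i : Ring.Carrier R) where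

  open Ring R renaming (refl to ≈-refl; sym to ≈-sym; trans to ≈-trans)
  open RingProperties R
  open SetoidReasoning setoid

  u : Carrier
  u = i - 1#

  -- Horner form of the sum of the powers of - u with exponents below k.
  partialSum : ℕ → Carrier
  partialSum zero    = 0#
  partialSum (suc k) = 1# - u * partialSum k

  -- The ring is not assumed commutative. The partial sums commute with u because they are
  -- polynomials in u, which lets one series serve as inverse on both sides.
  u-comm : ∀ k → u * partialSum k ≈ partialSum k * u
  u-comm zero    = ≈-trans (zeroʳ u) (≈-sym (zeroˡ u))
  u-comm (suc k) = begin
    u * (1# - u * T)         ≈⟨ distribˡ u 1# (- (u * T)) ⟩
    u * 1# + u * - (u * T)   ≈⟨ +-cong (≈-trans (*-identityʳ u) (≈-sym (*-identityˡ u)))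
                                  (≈-trans (≈-sym (-‿distribʳ-* u (u * T)))
                                  (≈-trans (-‿cong (≈-trans (*-congˡ (u-comm k)) (≈-sym (*-assoc u T u))))
                                           (-‿distribˡ-* (u * T) u))) ⟩
    1# * u + - (u * T) * u   ≈⟨ distribʳ u 1# (- (u * T)) ⟨
    (1# - u * T) * u         ∎
    where T = partialSum k

  i≈1+u : i ≈ 1# + u
  i≈1+u = ≈-sym (≈-trans (+-comm 1# u) (≈-trans (+-assoc i (- 1#) 1#) (≈-trans (+-congˡ (-‿inverseˡ 1#)) (+-identityʳ i))))

  remainder : ∀ k → u * partialSum k ≈ 1# - partialSum (suc k)
  remainder k = ≈-sym (begin
    1# - (1# - u * T)       ≈⟨ +-congˡ (⁻¹-anti-homo-// 1# (u * T)) ⟩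
    1# + (u * T - 1#)       ≈⟨ +-comm 1# _ ⟩
    u * T - 1# + 1#         ≈⟨ ≈-trans (+-assoc _ _ _) (≈-trans (+-congˡ (-‿inverseˡ 1#)) (+-identityʳ _)) ⟩
    u * T                   ∎)
    where T = partialSum k

  -- The deviation from 1 is the difference of two consecutive partial sums, which vanishes wherever
  -- the series has become stationary.
  i*partialSum : ∀ k → i * partialSum k ≈ partialSum k + (1# - partialSum (suc k))
  i*partialSum k = ≈-trans (*-congʳ i≈1+u)
    (≈-trans (distribʳ _ 1# u) (+-cong (*-identityˡ _) (remainder k)))

  partialSum*i : ∀ k → partialSum k * i ≈ partialSum k + (1# - partialSum (suc k))
  partialSum*i k = ≈-trans (*-congˡ i≈1+u)
    (≈-trans (distribˡ _ 1# u) (+-cong (*-identityʳ _) (≈-trans (≈-sym (u-comm k)) (remainder k))))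

module Tensors (R : CommutativeRing 0ℓ 0ℓ) where

  open Linear R

  -- Spanning in the form in which it is applied: the family detects equality of linear maps into
  -- every module.
  Spans : (M : Mod) {I : Set} → (I → ∣ M ∣) → Set₁
  Spans M p = ∀ {N} (f g : M ⟶ N) → (∀ i → (f $ p i) ≈[ N ] (g $ p i)) → f ⟶≈ g

  _⊗—_ : (M : Mod) {N : Mod} → ∣ N ∣ → M ⟶ M ⊗ᴹ N
  _⊗—_ M {N} y = linear {M} {M ⊗ᴹ N} (_⊗ y) (λ e → T.⊗-cong e (LeftModule.≈ᴹ-refl N))
    (λ x x′ → T.⊗-+ˡ x x′ y) (λ _ _ → T.≋-refl)
    where module T = TensorProduct M N

  -- By currying: the first family detects equality of maps into `Hom N L`, and for each of its
  -- members the second detects equality of maps into L.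
  ⊗-spans : ∀ {M N I J} {p : I → ∣ M ∣} {q : J → ∣ N ∣} → Spans M p → Spans N q →
    Spans (M ⊗ᴹ N) (λ (ij : I × J) → p (proj₁ ij) ⊗ q (proj₂ ij))
  ⊗-spans {M} {N} {p = p} spanM spanN {L} f g e = ⊗-ext f g λ x y →
    spanM (curry f) (curry g) (λ i → spanN (_$_ {M} {Hom N L} (curry f) (p i)) (_$_ {M} {Hom N L} (curry g) (p i)) (λ j → e (i , j))) x y
    where
    curry : (M ⊗ᴹ N ⟶ L) → (M ⟶ Hom N L)
    curry h = _∘ᴸ_ {M} {Hom N (M ⊗ᴹ N)} {Hom N L} (post h) pure

  module Convolution (A : Mod) (m : A ⊗ᴹ A ⟶ A) (1ᴬ : ∣ A ∣) (Δ : A ⟶ A ⊗ᴹ A) (ε : A ⟶ 𝕂)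
    (assoc     : ∀ a b c → (m $ (m $ a ⊗ b) ⊗ c) ≈[ A ] (m $ a ⊗ (m $ b ⊗ c)))
    (identityˡ : ∀ a → (m $ 1ᴬ ⊗ a) ≈[ A ] a)
    (identityʳ : ∀ a → (m $ a ⊗ 1ᴬ) ≈[ A ] a)
    (coassoc   : ∀ a → (associator $ Δ ⊗ᴸ idᴸ $ Δ $ a) ≈[ A ⊗ᴹ (A ⊗ᴹ A) ] (idᴸ ⊗ᴸ Δ $ Δ $ a))
    (counitˡ   : ∀ a → (unitorˡ $ ε ⊗ᴸ idᴸ $ Δ $ a) ≈[ A ] a)
    (counitʳ   : ∀ a → (unitorʳ $ idᴸ ⊗ᴸ ε $ Δ $ a) ≈[ A ] a) where

    open LeftModule A
    open SetoidReasoning ≈ᴹ-setoid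
    private
      module m = _⟶_ m
      module ε = _⟶_ ε
      module T = TensorProduct A A
      module H = LeftModule (Hom A A)
      A² = A ⊗ᴹ A

    ηε : A ⟶ A
    ηε = linear {A} {A} (λ a → (ε $ a) *ₗ 1ᴬ) (λ e → *ₗ-congʳ (ε.⟦⟧-cong e))
      (λ a b → ≈ᴹ-trans (*ₗ-congʳ (ε.+ᴹ-homo a b)) (*ₗ-distribʳ 1ᴬ _ _))
      (λ r a → ≈ᴹ-trans (*ₗ-congʳ (ε.*ₗ-homo r a)) (*ₗ-assoc r _ 1ᴬ))

    _⊛_ : (A ⟶ A) → (A ⟶ A) → (A² ⟶ A)
    f ⊛ g = _∘ᴸ_ {A²} {A²} {A} m (f ⊗ᴸ g)

    infixl 7 _⋆_
    _⋆_ : (A ⟶ A) → (A ⟶ A) → (A ⟶ A)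
    f ⋆ g = _∘ᴸ_ {A} {A²} {A} (f ⊛ g) Δ

    -- The coproduct of a is a formal sum of pure tensors, so identities between convolutions need
    -- checking only there.
    ⋆-via : ∀ {B : Mod} (h k : A² ⟶ B) → (∀ x y → (h $ x ⊗ y) ≈[ B ] (k $ x ⊗ y)) →
      ∀ a → (h $ Δ $ a) ≈[ B ] (k $ Δ $ a)
    ⋆-via h k e a = ⊗-ext h k e (Δ $ a)

    ⋆-cong : ∀ {f f′ g g′} → f ⟶≈ f′ → g ⟶≈ g′ → (f ⋆ g) ⟶≈ (f′ ⋆ g′)
    ⋆-cong {f} {f′} {g} {g′} p q = ⋆-via (f ⊛ g) (f′ ⊛ g′) (λ x y → m.⟦⟧-cong (T.⊗-cong (p x) (q y)))

    -- Both sides apply a triple product to an iterated coproduct. The iterated coproducts are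
    -- matched by `coassoc`, the triple products by `assoc` on pure tensors.
    ⋆-assoc : ∀ f g h → ((f ⋆ g) ⋆ h) ⟶≈ (f ⋆ (g ⋆ h))
    ⋆-assoc f g h a = begin
      ((f ⋆ g) ⋆ h $ a)
        ≈⟨ ⋆-via ((f ⋆ g) ⊛ h) (_∘ᴸ_ {A²} {A² ⊗ᴹ A} {A} leftAssociated (Δ ⊗ᴸ idᴸ)) (λ _ _ → ≈ᴹ-refl) a ⟩
      (leftAssociated $ Δ ⊗ᴸ idᴸ $ Δ $ a)
        ≈⟨ ⊗-ext leftAssociated (_∘ᴸ_ {A² ⊗ᴹ A} {A ⊗ᴹ A²} {A} rightAssociated associator) (λ t z →
             ⊗-ext (_∘ᴸ_ {A²} {A² ⊗ᴹ A} {A} leftAssociated (A² ⊗— z))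
                   (_∘ᴸ_ {A²} {A² ⊗ᴹ A} {A} (_∘ᴸ_ {A² ⊗ᴹ A} {A ⊗ᴹ A²} {A} rightAssociated associator) (A² ⊗— z))
                   (λ x y → assoc _ _ _) t) (Δ ⊗ᴸ idᴸ $ Δ $ a) ⟩
      (rightAssociated $ associator $ Δ ⊗ᴸ idᴸ $ Δ $ a)
        ≈⟨ _⟶_.⟦⟧-cong rightAssociated (coassoc a) ⟩
      (rightAssociated $ idᴸ ⊗ᴸ Δ $ Δ $ a)
        ≈⟨ ⋆-via (f ⊛ (g ⋆ h)) (_∘ᴸ_ {A²} {A ⊗ᴹ A²} {A} rightAssociated (idᴸ ⊗ᴸ Δ)) (λ _ _ → ≈ᴹ-refl) a ⟨
      (f ⋆ (g ⋆ h) $ a) ∎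
      where
      leftAssociated : A² ⊗ᴹ A ⟶ A
      leftAssociated = _∘ᴸ_ {A² ⊗ᴹ A} {A²} {A} m (_⊗ᴸ_ {A²} {A} {A} {A} (f ⊛ g) h)
      rightAssociated : A ⊗ᴹ A² ⟶ A
      rightAssociated = _∘ᴸ_ {A ⊗ᴹ A²} {A²} {A} m (_⊗ᴸ_ {A} {A} {A²} {A} f (g ⊛ h))

    ⋆-identityˡ : ∀ f → (ηε ⋆ f) ⟶≈ f
    ⋆-identityˡ f a = ≈ᴹ-trans
      (⋆-via (ηε ⊛ f) (_∘ᴸ_ {A²} {A} {A} f (_∘ᴸ_ {A²} {𝕂 ⊗ᴹ A} {A} unitorˡ (ε ⊗ᴸ idᴸ)))
        (λ x y → ≈ᴹ-trans (m.*ₗ-homo (ε $ x) (1ᴬ ⊗ (f $ y)))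
          (≈ᴹ-trans (*ₗ-congˡ (identityˡ (f $ y))) (≈ᴹ-sym (_⟶_.*ₗ-homo f (ε $ x) y)))) a)
      (_⟶_.⟦⟧-cong f (counitˡ a))

    ⋆-identityʳ : ∀ f → (f ⋆ ηε) ⟶≈ f
    ⋆-identityʳ f a = ≈ᴹ-trans
      (⋆-via (f ⊛ ηε) (_∘ᴸ_ {A²} {A} {A} f (_∘ᴸ_ {A²} {A ⊗ᴹ 𝕂} {A} unitorʳ (idᴸ ⊗ᴸ ε)))
        (λ x y → ≈ᴹ-trans (m.⟦⟧-cong (T.≋-sym (T.⊗-* (ε $ y) (f $ x) 1ᴬ)))
          (≈ᴹ-trans (m.*ₗ-homo (ε $ y) ((f $ x) ⊗ 1ᴬ))
          (≈ᴹ-trans (*ₗ-congˡ (identityʳ (f $ x))) (≈ᴹ-sym (_⟶_.*ₗ-homo f (ε $ y) x))))) a)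
      (_⟶_.⟦⟧-cong f (counitʳ a))

    _⊞_ : ∀ {B} → (B ⟶ A) → (B ⟶ A) → (B ⟶ A)
    _⊞_ {B} = LeftModule._+ᴹ_ (Hom B A)

    ⋆-distribˡ : ∀ f g h → (f ⋆ (g H.+ᴹ h)) ⟶≈ ((f ⋆ g) H.+ᴹ (f ⋆ h))
    ⋆-distribˡ f g h = ⋆-via (f ⊛ (g H.+ᴹ h)) ((f ⊛ g) ⊞ (f ⊛ h))
      (λ x y → ≈ᴹ-trans (m.⟦⟧-cong (T.⊗-+ʳ (f $ x) (g $ y) (h $ y))) (m.+ᴹ-homo ((f $ x) ⊗ (g $ y)) ((f $ x) ⊗ (h $ y))))

    ⋆-distribʳ : ∀ f g h → ((g H.+ᴹ h) ⋆ f) ⟶≈ ((g ⋆ f) H.+ᴹ (h ⋆ f))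
    ⋆-distribʳ f g h = ⋆-via ((g H.+ᴹ h) ⊛ f) ((g ⊛ f) ⊞ (h ⊛ f))
      (λ x y → ≈ᴹ-trans (m.⟦⟧-cong (T.⊗-+ˡ (g $ x) (h $ x) (f $ y))) (m.+ᴹ-homo ((g $ x) ⊗ (f $ y)) ((h $ x) ⊗ (f $ y))))

    convolutionRing : Ring 0ℓ 0ℓ
    convolutionRing = record
      { Carrier = A ⟶ A ; _≈_ = _⟶≈_ ; _+_ = H._+ᴹ_ ; _*_ = _⋆_ ; -_ = H.-ᴹ_ ; 0# = H.0ᴹ ; 1# = ηε
      ; isRing = record
        { +-isAbelianGroup = H.+ᴹ-isAbelianGroup
        ; *-cong = λ {f} {f′} {g} {g′} → ⋆-cong {f} {f′} {g} {g′}
        ; *-assoc = ⋆-assoc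
        ; *-identity = ⋆-identityˡ , ⋆-identityʳ
        ; distrib = ⋆-distribˡ , ⋆-distribʳ
        }
      }

-- Sums over the subsets of [n].

module SubsetSums {q : ℕ} (𝔽 : FiniteField q) (R : CommutativeRing 0ℓ 0ℓ) (M : Linear.Mod R) where

  open Linear R
  open Group 𝔽 using (subsets)
  open Sums R
  open SumsIn M
  open LeftModule M
  open SetoidReasoning ≈ᴹ-setoid

  Σ-subsets-suc : ∀ n (f : Subset (suc n) → ∣ M ∣) →
    Σ (subsets (suc n)) f ≈ᴹ Σ (subsets n) (f ∘ (inside ∷ᵛ_)) +ᴹ Σ (subsets n) (f ∘ (outside ∷ᵛ_))
  Σ-subsets-suc n f = ≈ᴹ-trans (Σ-++ (map (inside ∷ᵛ_) (subsets n)) (map (outside ∷ᵛ_) (subsets n)) f)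
    (+ᴹ-cong (Σ-map (inside ∷ᵛ_) (subsets n) f) (Σ-map (outside ∷ᵛ_) (subsets n) f))

  Σ-subsets-++ : ∀ k l (f : Subset (k ℕ.+ l) → ∣ M ∣) →
    Σ (subsets (k ℕ.+ l)) f ≈ᴹ Σ (subsets k) (λ A → Σ (subsets l) (λ B → f (A ++ᵛ B)))
  Σ-subsets-++ zero    l f = ≈ᴹ-sym (+ᴹ-identityʳ _)
  Σ-subsets-++ (suc k) l f = begin
    Σ (subsets (suc k ℕ.+ l)) f
      ≈⟨ Σ-subsets-suc (k ℕ.+ l) f ⟩
    Σ (subsets (k ℕ.+ l)) (f ∘ (inside ∷ᵛ_)) +ᴹ Σ (subsets (k ℕ.+ l)) (f ∘ (outside ∷ᵛ_))
      ≈⟨ +ᴹ-cong (Σ-subsets-++ k l (f ∘ (inside ∷ᵛ_))) (Σ-subsets-++ k l (f ∘ (outside ∷ᵛ_))) ⟩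
    _
      ≈⟨ Σ-subsets-suc k (λ A → Σ (subsets l) (λ B → f (A ++ᵛ B))) ⟨
    Σ (subsets (suc k)) (λ A → Σ (subsets l) (λ B → f (A ++ᵛ B))) ∎

  -- Emptiness is expressed by `card`, because the counit of a restriction depends only on its size.
  Σ-only-⊥ : ∀ n (f : Subset n → ∣ M ∣) → (∀ A → card A ≢ 0 → f A ≈ᴹ 0ᴹ) → Σ (subsets n) f ≈ᴹ f ⊥
  Σ-only-⊥ zero    f f≈0 = +ᴹ-identityʳ _
  Σ-only-⊥ (suc n) f f≈0 = begin
    Σ (subsets (suc n)) f
      ≈⟨ Σ-subsets-suc n f ⟩
    Σ (subsets n) (f ∘ (inside ∷ᵛ_)) +ᴹ Σ (subsets n) (f ∘ (outside ∷ᵛ_))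
      ≈⟨ +ᴹ-cong (Σ-0 (subsets n) (λ A → f≈0 (inside ∷ᵛ A) λ ())) (Σ-only-⊥ n (f ∘ (outside ∷ᵛ_)) (λ A → f≈0 (outside ∷ᵛ A))) ⟩
    0ᴹ +ᴹ f ⊥
      ≈⟨ +ᴹ-identityˡ _ ⟩
    f ⊥ ∎

  Σ-only-⊤ : ∀ n (f : Subset n → ∣ M ∣) → (∀ A → card (∁ A) ≢ 0 → f A ≈ᴹ 0ᴹ) → Σ (subsets n) f ≈ᴹ f ⊤
  Σ-only-⊤ zero    f f≈0 = +ᴹ-identityʳ _
  Σ-only-⊤ (suc n) f f≈0 = begin
    Σ (subsets (suc n)) f
      ≈⟨ Σ-subsets-suc n f ⟩
    Σ (subsets n) (f ∘ (inside ∷ᵛ_)) +ᴹ Σ (subsets n) (f ∘ (outside ∷ᵛ_))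
      ≈⟨ +ᴹ-cong (Σ-only-⊤ n (f ∘ (inside ∷ᵛ_)) (λ A → f≈0 (inside ∷ᵛ A))) (Σ-0 (subsets n) (λ A → f≈0 (outside ∷ᵛ A) λ ())) ⟩
    f ⊤ +ᴹ 0ᴹ
      ≈⟨ +ᴹ-identityʳ _ ⟩
    f ⊤ ∎

  -- The colour of the first element of [n] splits each side into three sums. On the left the
  -- element lies in B, in A but not in B, or outside A; on the right in A, in B, or in neither. The
  -- second sum is grouped differently on the two sides, hence the reassociation.
  Σ-colourings : ∀ n (f : (A : Subset n) → Subset (card A) → ∣ M ∣) (g : (A : Subset n) → Subset (card (∁ A)) → ∣ M ∣) →
    (∀ c → f (notThirdSet c) (firstInNotThird c) ≈ᴹ g (firstSet c) (secondInNotFirst c)) →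
    Σ (subsets n) (λ A → Σ (subsets (card A)) (f A)) ≈ᴹ Σ (subsets n) (λ A → Σ (subsets (card (∁ A))) (g A))
  Σ-colourings zero    f g e = +ᴹ-congʳ (+ᴹ-congʳ (e []ᵛ))
  Σ-colourings (suc n) f g e = begin
    Σ (subsets (suc n)) (λ A → Σ (subsets (card A)) (f A))
      ≈⟨ Σ-subsets-suc n (λ A → Σ (subsets (card A)) (f A)) ⟩
    Σ (subsets n) (λ A → Σ (subsets (suc (card A))) (f (inside ∷ᵛ A))) +ᴹ f₃
      ≈⟨ +ᴹ-congʳ (Σ-cong (subsets n) (λ A → Σ-subsets-suc (card A) (f (inside ∷ᵛ A)))) ⟩
    Σ (subsets n) (λ A → Σ (subsets (card A)) (f (inside ∷ᵛ A) ∘ (inside ∷ᵛ_)) +ᴹ Σ (subsets (card A)) (f (inside ∷ᵛ A) ∘ (outside ∷ᵛ_))) +ᴹ f₃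
      ≈⟨ +ᴹ-congʳ (Σ-+ (subsets n) _ _) ⟩
    f₁ +ᴹ f₂ +ᴹ f₃
      ≈⟨ +ᴹ-cong (+ᴹ-cong
           (Σ-colourings n (λ A B → f (inside ∷ᵛ A) (inside ∷ᵛ B)) (λ A → g (inside ∷ᵛ A)) (λ c → e (first ∷ᵛ c)))
           (Σ-colourings n (λ A B → f (inside ∷ᵛ A) (outside ∷ᵛ B)) (λ A B → g (outside ∷ᵛ A) (inside ∷ᵛ B)) (λ c → e (second ∷ᵛ c))))
           (Σ-colourings n (λ A → f (outside ∷ᵛ A)) (λ A B → g (outside ∷ᵛ A) (outside ∷ᵛ B)) (λ c → e (third ∷ᵛ c))) ⟩
    g₁ +ᴹ g₂ +ᴹ g₃
      ≈⟨ +ᴹ-assoc g₁ g₂ g₃ ⟩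
    g₁ +ᴹ (g₂ +ᴹ g₃)
      ≈⟨ +ᴹ-congˡ (Σ-+ (subsets n) _ _) ⟨
    g₁ +ᴹ Σ (subsets n) (λ A → Σ (subsets (card (∁ A))) (g (outside ∷ᵛ A) ∘ (inside ∷ᵛ_)) +ᴹ Σ (subsets (card (∁ A))) (g (outside ∷ᵛ A) ∘ (outside ∷ᵛ_)))
      ≈⟨ +ᴹ-congˡ (Σ-cong (subsets n) (λ A → Σ-subsets-suc (card (∁ A)) (g (outside ∷ᵛ A)))) ⟨
    g₁ +ᴹ Σ (subsets n) (λ A → Σ (subsets (suc (card (∁ A)))) (g (outside ∷ᵛ A)))
      ≈⟨ Σ-subsets-suc n (λ A → Σ (subsets (card (∁ A))) (g A)) ⟨
    Σ (subsets (suc n)) (λ A → Σ (subsets (card (∁ A))) (g A)) ∎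
    where
    f₁ f₂ f₃ g₁ g₂ g₃ : ∣ M ∣
    f₁ = Σ (subsets n) (λ A → Σ (subsets (card A)) (f (inside ∷ᵛ A) ∘ (inside ∷ᵛ_)))
    f₂ = Σ (subsets n) (λ A → Σ (subsets (card A)) (f (inside ∷ᵛ A) ∘ (outside ∷ᵛ_)))
    f₃ = Σ (subsets n) (λ A → Σ (subsets (card A)) (f (outside ∷ᵛ A)))
    g₁ = Σ (subsets n) (λ A → Σ (subsets (card (∁ A))) (g (inside ∷ᵛ A)))
    g₂ = Σ (subsets n) (λ A → Σ (subsets (card (∁ A))) (g (outside ∷ᵛ A) ∘ (inside ∷ᵛ_)))
    g₃ = Σ (subsets n) (λ A → Σ (subsets (card (∁ A))) (g (outside ∷ᵛ A) ∘ (outside ∷ᵛ_)))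

-- The Hopf algebra axioms for a module spanned by vectors indexed by D-partitions.

module DPartitionBialgebra {q : ℕ} (𝔽 : FiniteField q) (R : CommutativeRing 0ℓ 0ℓ)
  (A : Linear.Mod R)
  (P : ∀ {n} → Group.DPartition 𝔽 n → Linear.∣_∣ R A)
  (P-cong : ∀ {n} (lam mu : Group.DPartition 𝔽 n) → DPartitionEnumeration._≃_ 𝔽 lam mu → Linear.Eq R A (P lam) (P mu))
  (P-ext : ∀ (N : Linear.Mod R) (f g : Linear._⟶_ R A N) →
     (∀ {n} (lam : Group.DPartition 𝔽 n) → Linear.Eq R N (Linear._$_ R f (P lam)) (Linear._$_ R g (P lam))) → Linear._⟶≈_ R f g)
  (1ᴬ : Linear.∣_∣ R A)
  (P∅≈1 : Linear.Eq R A (P (Group.∅ᴰ 𝔽)) 1ᴬ)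
  (ε : Linear._⟶_ R A (Linear.𝕂 R))
  (ε-zero : ∀ (lam : Group.DPartition 𝔽 0) → CommutativeRing._≈_ R (Linear._$_ R ε (P lam)) (CommutativeRing.1# R))
  (ε-suc : ∀ {n} (lam : Group.DPartition 𝔽 (suc n)) → CommutativeRing._≈_ R (Linear._$_ R ε (P lam)) (CommutativeRing.0# R))
  where

  open Linear R
  open Group 𝔽 using (DPartition; label; subsets; splitsAlong?; SplitsAlong; st; _⊔↑_; ∅ᴰ)
  open DPartitionEnumeration 𝔽
  open Restriction 𝔽
  open Sums R
  open Tensors R
  private
    module R = CommutativeRing R
    module ε = _⟶_ ε
    module T = TensorProduct A A
    A² = A ⊗ᴹ A
    A³ = A ⊗ᴹ A²
    module T₃ = TensorProduct A A²
  open LeftModule A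
  open SumsIn using (when)

  P-≅ : ∀ {m n} (lam : DPartition m) (mu : DPartition n) → lam ≅ mu → P lam ≈ᴹ P mu
  P-≅ lam mu (refl , e) = P-cong lam mu (λ i j → trans (e i j)
    (cong₂ (label mu) (±map-id (Fin.cast-is-id refl) i) (±map-id (Fin.cast-is-id refl) j)))

  p : ∃ DPartition → ∣ A ∣
  p (_ , lam) = P lam

  p-spans : Spans A p
  p-spans {N} f g e = P-ext N f g (λ lam → e (_ , lam))

  P⊗P-ext : ∀ {N} (f g : A² ⟶ N) →
    (∀ {k l} (mu : DPartition k) (nu : DPartition l) → (f $ P mu ⊗ P nu) ≈[ N ] (g $ P mu ⊗ P nu)) → f ⟶≈ g
  P⊗P-ext f g e = ⊗-spans p-spans p-spans f g (λ ((_ , mu) , (_ , nu)) → e mu nu)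

  P-zero : ∀ {n} → n ≡ 0 → (lam : DPartition n) → P lam ≈ᴹ 1ᴬ
  P-zero refl lam = ≈ᴹ-trans (P-cong lam ∅ᴰ λ { (pos ()) ; (neg ()) }) P∅≈1

  ε-P-zero : ∀ {n} → n ≡ 0 → (lam : DPartition n) → (ε $ P lam) R.≈ R.1#
  ε-P-zero refl lam = ε-zero lam

  ε-P-nonzero : ∀ {n} → n ≢ 0 → (lam : DPartition n) → (ε $ P lam) R.≈ R.0#
  ε-P-nonzero {zero}  n≢0 lam = contradiction refl n≢0
  ε-P-nonzero {suc n} n≢0 lam = ε-suc lam

  coproductSum : ∀ {n} → DPartition n → ∣ A² ∣
  coproductSum {n} lam = sumᴸ A² (filter (splitsAlong? lam) (subsets n)) (λ S → P (st S lam) ⊗ P (st (∁ S) lam))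

  coproductSum-cong : ∀ {n} (lam mu : DPartition n) → lam ≃ mu → coproductSum lam ≈[ A² ] coproductSum mu
  coproductSum-cong {n} lam mu e = T.≋-trans (SumsIn.Σ-filter A² (splitsAlong? lam) (subsets n) _)
    (T.≋-trans (SumsIn.Σ-cong A² (subsets n) (λ S → SumsIn.when-cong A² (splitsAlong? lam S) (splitsAlong? mu S)
      (splits-resp {lam = lam} {mu} e) (splits-resp {lam = mu} {lam} (λ i j → sym (e i j)))
      (λ _ → T.⊗-cong (P-cong (st S lam) (st S mu) (λ i j → e _ _)) (P-cong (st (∁ S) lam) (st (∁ S) mu) (λ i j → e _ _)))))
    (T.≋-sym (SumsIn.Σ-filter A² (splitsAlong? mu) (subsets n) _)))

  module _ (m : A² ⟶ A)
    (m-P : ∀ {k l} (mu : DPartition k) (nu : DPartition l) → (m $ P mu ⊗ P nu) ≈ᴹ P (mu ⊔↑ nu))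
    (Δ : A ⟶ A²)
    (Δ-P : ∀ {n} (lam : DPartition n) → (Δ $ P lam) ≈[ A² ] coproductSum lam) where

    private
      module m = _⟶_ m
      module Δ = _⟶_ Δ

    -- Trades the filtered list for a sum over all subsets with default term zero, so that sums with
    -- different conditions can be reindexed and compared term by term.
    apply-Δ : ∀ {N} (h : A² ⟶ N) {n} (lam : DPartition n) → (h $ Δ $ P lam) ≈[ N ]
      sumᴸ N (subsets n) (λ S → when N (splitsAlong? lam S) (h $ P (st S lam) ⊗ P (st (∁ S) lam)))
    apply-Δ {N} h {n} lam = N.≈ᴹ-trans (_⟶_.⟦⟧-cong h (Δ-P lam))
      (N.≈ᴹ-trans (Σ-homo h (filter (splitsAlong? lam) (subsets n)) _)
        (SumsIn.Σ-filter N (splitsAlong? lam) (subsets n) _))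
      where module N = LeftModule N

    assoc : ∀ a b c → (m $ (m $ a ⊗ b) ⊗ c) ≈ᴹ (m $ a ⊗ (m $ b ⊗ c))
    assoc a b c = ⊗-spans (⊗-spans p-spans p-spans) p-spans left right
      (λ (((_ , mu) , (_ , nu)) , (_ , rho)) → ≈ᴹ-trans (m.⟦⟧-cong (T.⊗-cong (m-P mu nu) ≈ᴹ-refl))
        (≈ᴹ-trans (m-P (mu ⊔↑ nu) rho)
        (≈ᴹ-trans (P-≅ _ _ (union-assoc mu nu rho))
        (≈ᴹ-trans (≈ᴹ-sym (m-P mu (nu ⊔↑ rho)))
                  (m.⟦⟧-cong (T.⊗-cong ≈ᴹ-refl (≈ᴹ-sym (m-P nu rho))))))))
      ((a ⊗ b) ⊗ c)
      where
      left right : A² ⊗ᴹ A ⟶ A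
      left = _∘ᴸ_ {A² ⊗ᴹ A} {A²} {A} m (_⊗ᴸ_ {A²} {A} {A} {A} m idᴸ)
      right = _∘ᴸ_ {A² ⊗ᴹ A} {A²} {A} m (_∘ᴸ_ {A² ⊗ᴹ A} {A³} {A²} (_⊗ᴸ_ {A} {A} {A²} {A} idᴸ m) associator)

    identityˡ : ∀ a → (m $ 1ᴬ ⊗ a) ≈ᴹ a
    identityˡ = P-ext A (_∘ᴸ_ {A} {A²} {A} m (_$_ {A} {Hom A A²} pure 1ᴬ)) idᴸ λ lam →
      ≈ᴹ-trans (m.⟦⟧-cong (T.⊗-cong (≈ᴹ-sym P∅≈1) ≈ᴹ-refl))
        (≈ᴹ-trans (m-P ∅ᴰ lam) (P-cong (∅ᴰ ⊔↑ lam) lam (union-identityˡ lam)))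

    identityʳ : ∀ a → (m $ a ⊗ 1ᴬ) ≈ᴹ a
    identityʳ = P-ext A (_∘ᴸ_ {A} {A²} {A} m (A ⊗— 1ᴬ)) idᴸ λ lam →
      ≈ᴹ-trans (m.⟦⟧-cong (T.⊗-cong ≈ᴹ-refl (≈ᴹ-sym P∅≈1)))
        (≈ᴹ-trans (m-P lam ∅ᴰ) (P-≅ (lam ⊔↑ ∅ᴰ) lam (union-identityʳ lam)))

    coassoc : ∀ a → (associator $ Δ ⊗ᴸ idᴸ $ Δ $ a) ≈[ A³ ] (idᴸ ⊗ᴸ Δ $ Δ $ a)
    coassoc = P-ext A³ (_∘ᴸ_ {A} {A²} {A³} left Δ) (_∘ᴸ_ {A} {A²} {A³} right Δ) on-P
      where
      open SumsIn A³ using (Σ; Σ-cong; when-cong; when-Σ; when-×)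
      open SetoidReasoning (LeftModule.≈ᴹ-setoid A³)
      left right : A² ⟶ A³
      left = _∘ᴸ_ {A²} {A² ⊗ᴹ A} {A³} associator (_⊗ᴸ_ {A} {A²} {A} {A} Δ idᴸ)
      right = _⊗ᴸ_ {A} {A} {A} {A²} idᴸ Δ
      module _ {n} (lam : DPartition n) where
        F : (S : Subset n) → Subset (card S) → ∣ A³ ∣
        F S B = P (st B (st S lam)) ⊗ (P (st (∁ B) (st S lam)) ⊗ P (st (∁ S) lam))
        G : (S : Subset n) → Subset (card (∁ S)) → ∣ A³ ∣
        G S B = P (st S lam) ⊗ (P (st B (st (∁ S) lam)) ⊗ P (st (∁ B) (st (∁ S) lam)))
        F? : ∀ S B → Dec (SplitsAlong lam S × SplitsAlong (st S lam) B)
        F? S B = splitsAlong? lam S ×-dec splitsAlong? (st S lam) B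
        G? : ∀ S B → Dec (SplitsAlong lam S × SplitsAlong (st (∁ S) lam) B)
        G? S B = splitsAlong? lam S ×-dec splitsAlong? (st (∁ S) lam) B
        expandˡ : ∀ S → when A³ (splitsAlong? lam S) (left $ P (st S lam) ⊗ P (st (∁ S) lam)) ≈[ A³ ]
          Σ (subsets (card S)) (λ B → when A³ (F? S B) (F S B))
        expandˡ S = begin
          when A³ (splitsAlong? lam S) (left $ P (st S lam) ⊗ P (st (∁ S) lam))
            ≈⟨ when-cong (splitsAlong? lam S) (splitsAlong? lam S) id id (λ _ →
                 apply-Δ (_∘ᴸ_ {A²} {A² ⊗ᴹ A} {A³} associator (A² ⊗— P (st (∁ S) lam))) (st S lam)) ⟩
          when A³ (splitsAlong? lam S) (Σ (subsets (card S)) (λ B → when A³ (splitsAlong? (st S lam) B) (F S B)))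
            ≈⟨ when-Σ (splitsAlong? lam S) (subsets (card S)) _ ⟩
          Σ (subsets (card S)) (λ B → when A³ (splitsAlong? lam S) (when A³ (splitsAlong? (st S lam) B) (F S B)))
            ≈⟨ Σ-cong (subsets (card S)) (λ B → when-× (splitsAlong? lam S) (splitsAlong? (st S lam) B) (F S B)) ⟩
          Σ (subsets (card S)) (λ B → when A³ (F? S B) (F S B)) ∎
        expandʳ : ∀ S → when A³ (splitsAlong? lam S) (right $ P (st S lam) ⊗ P (st (∁ S) lam)) ≈[ A³ ]
          Σ (subsets (card (∁ S))) (λ B → when A³ (G? S B) (G S B))
        expandʳ S = begin
          when A³ (splitsAlong? lam S) (right $ P (st S lam) ⊗ P (st (∁ S) lam))
            ≈⟨ when-cong (splitsAlong? lam S) (splitsAlong? lam S) id id (λ _ →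
                 apply-Δ (_$_ {A} {Hom A² A³} pure (P (st S lam))) (st (∁ S) lam)) ⟩
          when A³ (splitsAlong? lam S) (Σ (subsets (card (∁ S))) (λ B → when A³ (splitsAlong? (st (∁ S) lam) B) (G S B)))
            ≈⟨ when-Σ (splitsAlong? lam S) (subsets (card (∁ S))) _ ⟩
          Σ (subsets (card (∁ S))) (λ B → when A³ (splitsAlong? lam S) (when A³ (splitsAlong? (st (∁ S) lam) B) (G S B)))
            ≈⟨ Σ-cong (subsets (card (∁ S))) (λ B → when-× (splitsAlong? lam S) (splitsAlong? (st (∁ S) lam) B) (G S B)) ⟩
          Σ (subsets (card (∁ S))) (λ B → when A³ (G? S B) (G S B)) ∎
        on-P : (left $ Δ $ P lam) ≈[ A³ ] (right $ Δ $ P lam)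
        on-P = begin
          (left $ Δ $ P lam)
            ≈⟨ apply-Δ left lam ⟩
          Σ (subsets n) (λ S → when A³ (splitsAlong? lam S) (left $ P (st S lam) ⊗ P (st (∁ S) lam)))
            ≈⟨ Σ-cong (subsets n) expandˡ ⟩
          Σ (subsets n) (λ S → Σ (subsets (card S)) (λ B → when A³ (F? S B) (F S B)))
            ≈⟨ SubsetSums.Σ-colourings 𝔽 R A³ n (λ S B → when A³ (F? S B) (F S B)) (λ S B → when A³ (G? S B) (G S B))
                 -- Each condition says that the colouring c is constant on arcs, which converts one
                 -- into the other. Colourings violating it contribute zero on both sides.
                 (λ c → when-cong (F? (notThirdSet c) (firstInNotThird c)) (G? (firstSet c) (secondInNotFirst c))
                   (λ (s , t) → colouring⇒splitsʳ lam c (splitsˡ⇒colouring lam c s t))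
                   (λ (s , t) → colouring⇒splitsˡ lam c (splitsʳ⇒colouring lam c s t))
                   (λ _ → T₃.⊗-cong (P-≅ _ _ (st-first lam c)) (T.⊗-cong (P-≅ _ _ (st-second lam c)) (P-≅ _ _ (st-third lam c))))) ⟩
          Σ (subsets n) (λ S → Σ (subsets (card (∁ S))) (λ B → when A³ (G? S B) (G S B)))
            ≈⟨ Σ-cong (subsets n) expandʳ ⟨
          Σ (subsets n) (λ S → when A³ (splitsAlong? lam S) (right $ P (st S lam) ⊗ P (st (∁ S) lam)))
            ≈⟨ apply-Δ right lam ⟨
          (right $ Δ $ P lam) ∎

    -- The counit kills every restriction of positive size, so only the empty subset contributes,
    -- and its complement restricts λ to itself.
    counitˡ : ∀ a → (unitorˡ $ ε ⊗ᴸ idᴸ $ Δ $ a) ≈ᴹ a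
    counitˡ = P-ext A (_∘ᴸ_ {A} {A²} {A} h Δ) idᴸ λ {n} lam → ≈ᴹ-trans (apply-Δ h lam)
      (≈ᴹ-trans (SubsetSums.Σ-only-⊥ 𝔽 R A n (λ S → when A (splitsAlong? lam S) ((ε $ P (st S lam)) *ₗ P (st (∁ S) lam)))
        (λ S S≢0 → SumsIn.when-0 A (splitsAlong? lam S) (≈ᴹ-trans (*ₗ-congʳ (ε-P-nonzero S≢0 (st S lam))) (*ₗ-zeroˡ (P (st (∁ S) lam))))))
      (≈ᴹ-trans (SumsIn.when-yes A (splitsAlong? lam ⊥) (splits-⊥ lam) ((ε $ P (st ⊥ lam)) *ₗ P (st (∁ ⊥) lam)))
      (≈ᴹ-trans (*ₗ-congʳ (ε-P-zero (∣⊥∣≡0 n) (st ⊥ lam))) (≈ᴹ-trans (*ₗ-identityˡ (P (st (∁ ⊥) lam)))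
        (P-≅ (st (∁ ⊥) lam) lam (st-full (∁ ⊥) lam (λ i → trans (lookup-∁ ⊥ i) (cong not (Vec.lookup-replicate i outside)))))))))
      where
      h : A² ⟶ A
      h = _∘ᴸ_ {A²} {𝕂 ⊗ᴹ A} {A} unitorˡ (ε ⊗ᴸ idᴸ)

    counitʳ : ∀ a → (unitorʳ $ idᴸ ⊗ᴸ ε $ Δ $ a) ≈ᴹ a
    counitʳ = P-ext A (_∘ᴸ_ {A} {A²} {A} h Δ) idᴸ λ {n} lam → ≈ᴹ-trans (apply-Δ h lam)
      (≈ᴹ-trans (SubsetSums.Σ-only-⊤ 𝔽 R A n (λ S → when A (splitsAlong? lam S) ((ε $ P (st (∁ S) lam)) *ₗ P (st S lam)))
        (λ S S≢0 → SumsIn.when-0 A (splitsAlong? lam S) (≈ᴹ-trans (*ₗ-congʳ (ε-P-nonzero S≢0 (st (∁ S) lam))) (*ₗ-zeroˡ (P (st S lam))))))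
      (≈ᴹ-trans (SumsIn.when-yes A (splitsAlong? lam ⊤) (splits-⊤ lam) ((ε $ P (st (∁ ⊤) lam)) *ₗ P (st ⊤ lam)))
      (≈ᴹ-trans (*ₗ-congʳ (ε-P-zero (∁⊤-empty n) (st (∁ ⊤) lam))) (≈ᴹ-trans (*ₗ-identityˡ (P (st ⊤ lam)))
        (P-≅ (st ⊤ lam) lam (st-full ⊤ lam (λ i → Vec.lookup-replicate i inside)))))))
      where
      h : A² ⟶ A
      h = _∘ᴸ_ {A²} {A ⊗ᴹ 𝕂} {A} unitorʳ (idᴸ ⊗ᴸ ε)
      ∁⊤-empty : ∀ n → card (∁ (⊤ {n})) ≡ 0
      ∁⊤-empty zero    = refl
      ∁⊤-empty (suc n) = ∁⊤-empty n

    -- A subset of [k + l] is a pair of subsets of the two blocks. A union splits along it exactly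
    -- when each part splits along its own piece, and restriction and complement act blockwise.
    Δ-homo : ∀ a b → (Δ $ m $ a ⊗ b) ≈[ A² ] (m ⊗ᴸ m $ middleSwap $ (Δ $ a) ⊗ (Δ $ b))
    Δ-homo a b = P⊗P-ext (_∘ᴸ_ {A²} {A} {A²} Δ m) (_∘ᴸ_ {A²} {A² ⊗ᴹ A²} {A²} h (_⊗ᴸ_ {A} {A²} {A} {A²} Δ Δ)) on-P (a ⊗ b)
      where
      open SumsIn A² using (Σ; Σ-cong; when-cong; when-Σ; when-×)
      open SetoidReasoning (LeftModule.≈ᴹ-setoid A²)
      h : A² ⊗ᴹ A² ⟶ A²
      h = _∘ᴸ_ {A² ⊗ᴹ A²} {A² ⊗ᴹ A²} {A²} (_⊗ᴸ_ {A²} {A} {A²} {A} m m) middleSwap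
      module _ {k l} (mu : DPartition k) (nu : DPartition l) where
        F : Subset k → Subset l → ∣ A² ∣
        F S B = (m $ P (st S mu) ⊗ P (st B nu)) ⊗ (m $ P (st (∁ S) mu) ⊗ P (st (∁ B) nu))
        F? : ∀ S B → Dec (SplitsAlong mu S × SplitsAlong nu B)
        F? S B = splitsAlong? mu S ×-dec splitsAlong? nu B
        part : ∀ S B → P (st (S ++ᵛ B) (mu ⊔↑ nu)) ≈ᴹ (m $ P (st S mu) ⊗ P (st B nu))
        part S B = ≈ᴹ-sym (≈ᴹ-trans (m-P (st S mu) (st B nu)) (P-≅ _ _ (st-union mu nu S B)))
        expand : ∀ S → when A² (splitsAlong? mu S) (h $ (P (st S mu) ⊗ P (st (∁ S) mu)) ⊗ (Δ $ P nu)) ≈[ A² ]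
          Σ (subsets l) (λ B → when A² (F? S B) (F S B))
        expand S = begin
          when A² (splitsAlong? mu S) (h $ (P (st S mu) ⊗ P (st (∁ S) mu)) ⊗ (Δ $ P nu))
            ≈⟨ when-cong (splitsAlong? mu S) (splitsAlong? mu S) id id (λ _ →
                 apply-Δ (_∘ᴸ_ {A²} {A² ⊗ᴹ A²} {A²} h (_$_ {A²} {Hom A² (A² ⊗ᴹ A²)} pure (P (st S mu) ⊗ P (st (∁ S) mu)))) nu) ⟩
          when A² (splitsAlong? mu S) (Σ (subsets l) (λ B → when A² (splitsAlong? nu B) (F S B)))
            ≈⟨ when-Σ (splitsAlong? mu S) (subsets l) _ ⟩
          Σ (subsets l) (λ B → when A² (splitsAlong? mu S) (when A² (splitsAlong? nu B) (F S B)))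
            ≈⟨ Σ-cong (subsets l) (λ B → when-× (splitsAlong? mu S) (splitsAlong? nu B) (F S B)) ⟩
          Σ (subsets l) (λ B → when A² (F? S B) (F S B)) ∎
        on-P : (Δ $ m $ P mu ⊗ P nu) ≈[ A² ] (h $ (Δ $ P mu) ⊗ (Δ $ P nu))
        on-P = begin
          (Δ $ m $ P mu ⊗ P nu)
            ≈⟨ Δ.⟦⟧-cong (m-P mu nu) ⟩
          (Δ $ P (mu ⊔↑ nu))
            ≈⟨ apply-Δ idᴸ (mu ⊔↑ nu) ⟩
          Σ (subsets (k ℕ.+ l)) (λ C → when A² (splitsAlong? (mu ⊔↑ nu) C) (P (st C (mu ⊔↑ nu)) ⊗ P (st (∁ C) (mu ⊔↑ nu))))
            ≈⟨ SubsetSums.Σ-subsets-++ 𝔽 R A² k l _ ⟩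
          Σ (subsets k) (λ S → Σ (subsets l) (λ B → when A² (splitsAlong? (mu ⊔↑ nu) (S ++ᵛ B))
            (P (st (S ++ᵛ B) (mu ⊔↑ nu)) ⊗ P (st (∁ (S ++ᵛ B)) (mu ⊔↑ nu)))))
            ≈⟨ Σ-cong (subsets k) (λ S → Σ-cong (subsets l) (λ B → when-cong
                 (splitsAlong? (mu ⊔↑ nu) (S ++ᵛ B)) (F? S B) (union-splits⁻ mu nu S B) (union-splits⁺ mu nu S B)
                 (λ _ → T.⊗-cong (part S B)
                   (≈ᴹ-trans (≈ᴹ-reflexive (cong (λ C → P (st C (mu ⊔↑ nu))) (Vec.map-++ not S B))) (part (∁ S) (∁ B)))))) ⟩
          Σ (subsets k) (λ S → Σ (subsets l) (λ B → when A² (F? S B) (F S B)))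
            ≈⟨ Σ-cong (subsets k) expand ⟨
          Σ (subsets k) (λ S → when A² (splitsAlong? mu S) (h $ (P (st S mu) ⊗ P (st (∁ S) mu)) ⊗ (Δ $ P nu)))
            ≈⟨ apply-Δ (_∘ᴸ_ {A²} {A² ⊗ᴹ A²} {A²} h (A² ⊗— (Δ $ P nu))) mu ⟨
          (h $ (Δ $ P mu) ⊗ (Δ $ P nu)) ∎

    Δ-unit : (Δ $ 1ᴬ) ≈[ A² ] (1ᴬ ⊗ 1ᴬ)
    Δ-unit = T.≋-trans (Δ.⟦⟧-cong (≈ᴹ-sym P∅≈1)) (T.≋-trans (apply-Δ idᴸ ∅ᴰ)
      (T.≋-trans (SubsetSums.Σ-only-⊥ 𝔽 R A² 0 (λ S → when A² (splitsAlong? ∅ᴰ S) (P (st S ∅ᴰ) ⊗ P (st (∁ S) ∅ᴰ)))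
        (λ { []ᵛ 0≢0 → contradiction refl 0≢0 }))
      (T.≋-trans (SumsIn.when-yes A² (splitsAlong? ∅ᴰ []ᵛ) (splits-⊥ ∅ᴰ) (P (st []ᵛ ∅ᴰ) ⊗ P (st []ᵛ ∅ᴰ)))
        (T.⊗-cong (P-zero refl (st []ᵛ ∅ᴰ)) (P-zero refl (st []ᵛ ∅ᴰ))))))

    ε-homo : ∀ a b → (ε $ m $ a ⊗ b) R.≈ (ε $ a) R.* (ε $ b)
    -- The right-hand side is written as a linear map on the tensor square, so that it can be
    -- compared on the P μ ⊗ P ν.
    ε-homo a b = P⊗P-ext (_∘ᴸ_ {A²} {A} {𝕂} ε m) (_∘ᴸ_ {A²} {𝕂 ⊗ᴹ 𝕂} {𝕂} unitorˡ (ε ⊗ᴸ ε))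
      (λ mu nu → R.trans (ε.⟦⟧-cong (m-P mu nu)) (go mu nu)) (a ⊗ b)
      where
      go : ∀ {k l} (mu : DPartition k) (nu : DPartition l) → (ε $ P (mu ⊔↑ nu)) R.≈ (ε $ P mu) R.* (ε $ P nu)
      go {zero}  {zero}  mu nu = R.trans (ε-zero (mu ⊔↑ nu)) (R.sym (R.trans (R.*-cong (ε-zero mu) (ε-zero nu)) (R.*-identityˡ R.1#)))
      go {zero}  {suc l} mu nu = R.trans (ε-suc (mu ⊔↑ nu)) (R.sym (R.trans (R.*-congˡ (ε-suc nu)) (R.zeroʳ _)))
      go {suc k}         mu nu = R.trans (ε-suc (mu ⊔↑ nu)) (R.sym (R.trans (R.*-congʳ (ε-suc mu)) (R.zeroˡ _)))

    ε-unit : (ε $ 1ᴬ) R.≈ R.1#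
    ε-unit = R.trans (ε.⟦⟧-cong (≈ᴹ-sym P∅≈1)) (ε-zero ∅ᴰ)

    module C = Convolution A m 1ᴬ Δ ε assoc identityˡ identityʳ coassoc counitˡ counitʳ
    open C using (_⋆_; _⊛_; ηε; convolutionRing)
    open GeometricSeries convolutionRing idᴸ using (u; partialSum; i*partialSum; partialSum*i)

    -- In degree 0 the identity and ηε both send P λ to the unit.
    u-P-zero : ∀ {n} → n ≡ 0 → (lam : DPartition n) → (u $ P lam) ≈ᴹ 0ᴹ
    u-P-zero n≡0 lam = ≈ᴹ-trans
      (+ᴹ-congʳ (≈ᴹ-trans (P-zero n≡0 lam)
        (≈ᴹ-sym (≈ᴹ-trans (*ₗ-congʳ (ε-P-zero n≡0 lam)) (*ₗ-identityˡ 1ᴬ)))))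
      (LeftModule.-ᴹ‿inverseʳ (Hom A A) ηε (P lam))

    -- A convolution at P λ sees its factors only on restrictions of λ, so it can be compared degree
    -- by degree although the factors differ elsewhere.
    ⋆-agree : ∀ f g f′ g′ {n} (lam : DPartition n) →
      (∀ S → (m $ (f $ P (st S lam)) ⊗ (g $ P (st (∁ S) lam))) ≈ᴹ (m $ (f′ $ P (st S lam)) ⊗ (g′ $ P (st (∁ S) lam)))) →
      (f ⋆ g $ P lam) ≈ᴹ (f′ ⋆ g′ $ P lam)
    ⋆-agree f g f′ g′ {n} lam e = ≈ᴹ-trans (apply-Δ (f ⊛ g) lam)
      (≈ᴹ-trans (SumsIn.Σ-cong A (subsets n) (λ S → SumsIn.when-cong A (splitsAlong? lam S) (splitsAlong? lam S) id id (λ _ → e S)))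
      (≈ᴹ-sym (apply-Δ (f′ ⊛ g′) lam)))

    ⊗-zeroˡ′ : ∀ {x} y → x ≈ᴹ 0ᴹ → (m $ x ⊗ y) ≈ᴹ 0ᴹ
    ⊗-zeroˡ′ y e = ≈ᴹ-trans (m.⟦⟧-cong (T.≋-trans (T.⊗-cong e ≈ᴹ-refl) (T.⊗-zeroˡ y))) m.0ᴹ-homo

    card-∁≤ : ∀ {n} (S : Subset n) → card (∁ S) ℕ.≤ n
    card-∁≤ S = ∣p∣≤n (∁ S)

    card-∁< : ∀ {n} (S : Subset n) → card S ≢ 0 → card (∁ S) ℕ.< n
    card-∁< {n} S S≢0 = subst (ℕ._< n) (sym (∣∁p∣≡n∸∣p∣ S)) (lemma n (card S) S≢0 (∣p∣≤n S))
      where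
      lemma : ∀ n k → k ≢ 0 → k ℕ.≤ n → n ℕ.∸ k ℕ.< n
      lemma n       zero    k≢0 _ = contradiction refl k≢0
      lemma (suc n) (suc k) _   _ = s≤s (ℕ.m∸n≤m n k)

    -- u kills degree 0, so each further power of u vanishes in one more degree.
    partialSum-step : ∀ k {n} (lam : DPartition n) → n ℕ.< k → (partialSum (suc k) $ P lam) ≈ᴹ (partialSum k $ P lam)
    partialSum-step (suc k) lam (s≤s n≤k) = +ᴹ-congˡ (*ₗ-congˡ (⋆-agree u (partialSum (suc k)) u (partialSum k) lam agree))
      where
      agree : ∀ S → (m $ (u $ P (st S lam)) ⊗ (partialSum (suc k) $ P (st (∁ S) lam))) ≈ᴹ
                    (m $ (u $ P (st S lam)) ⊗ (partialSum k $ P (st (∁ S) lam)))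
      agree S = case card S ℕ.≟ 0 of λ where
        (yes S≡0) → ≈ᴹ-trans (⊗-zeroˡ′ _ (u-P-zero S≡0 (st S lam))) (≈ᴹ-sym (⊗-zeroˡ′ _ (u-P-zero S≡0 (st S lam))))
        (no S≢0) → m.⟦⟧-cong (T.⊗-cong ≈ᴹ-refl (partialSum-step k (st (∁ S) lam) (ℕ.<-≤-trans (card-∁< S S≢0) n≤k)))

    partialSum-stable : ∀ {k j} {n} (lam : DPartition n) → n ℕ.< k → k ℕ.≤′ j → (partialSum j $ P lam) ≈ᴹ (partialSum k $ P lam)
    partialSum-stable lam n<k ℕ.≤′-refl = ≈ᴹ-refl
    partialSum-stable lam n<k (ℕ.≤′-step k≤j) = ≈ᴹ-trans
      (partialSum-step _ lam (ℕ.<-≤-trans n<k (ℕ.≤′⇒≤ k≤j))) (partialSum-stable lam n<k k≤j)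

    module _ (fromP : (g : ∀ {n} → DPartition n → ∣ A ∣) → (∀ {n} (lam mu : DPartition n) → lam ≃ mu → g lam ≈ᴹ g mu) →
      Σ[ f ∈ (A ⟶ A) ] ∀ {n} (lam : DPartition n) → (f $ P lam) ≈ᴹ g lam) where

      private
        -- In degree n the geometric series is stationary from index n + 1 on, so its limit is
        -- defined degree by degree; `fromP` assembles these values into one linear map.
        antipode : Σ[ S ∈ (A ⟶ A) ] ∀ {n} (lam : DPartition n) → (S $ P lam) ≈ᴹ (partialSum (suc n) $ P lam)
        antipode = fromP (λ {n} lam → partialSum (suc n) $ P lam)
          (λ {n} lam mu e → _⟶_.⟦⟧-cong (partialSum (suc n)) (P-cong lam mu e))

      S : A ⟶ A
      S = proj₁ antipode

      S-P : ∀ {n} (lam : DPartition n) → (S $ P lam) ≈ᴹ (partialSum (suc n) $ P lam)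
      S-P = proj₂ antipode

      -- Restrictions of a D-partition of size n have size at most n, so a single partial sum
      -- replaces `S` throughout the coproduct of P λ, and the ring identities for that partial sum
      -- apply.
      S-below : ∀ {n m} (lam : DPartition m) → m ℕ.≤ n → (S $ P lam) ≈ᴹ (partialSum (suc n) $ P lam)
      S-below lam m≤n = ≈ᴹ-trans (S-P lam) (≈ᴹ-sym (partialSum-stable lam ℕ.≤-refl (ℕ.≤⇒≤′ (s≤s m≤n))))

      -- The two consecutive partial sums agree on P λ and cancel.
      telescope : ∀ {n} (lam : DPartition n) →
        ((partialSum (suc n) $ P lam) +ᴹ ((ηε $ P lam) +ᴹ (R.- R.1#) *ₗ (partialSum (suc (suc n)) $ P lam))) ≈ᴹ (ηε $ P lam)
      telescope {n} lam = ≈ᴹ-trans (+ᴹ-congˡ (+ᴹ-congˡ (*ₗ-congˡ (partialSum-step (suc n) lam ℕ.≤-refl))))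
        (≈ᴹ-trans (≈ᴹ-sym (+ᴹ-assoc _ _ _)) (≈ᴹ-trans (+ᴹ-congʳ (+ᴹ-comm _ _))
        (≈ᴹ-trans (+ᴹ-assoc _ _ _) (≈ᴹ-trans (+ᴹ-congˡ (LeftModule.-ᴹ‿inverseʳ (Hom A A) (partialSum (suc n)) (P lam))) (+ᴹ-identityʳ _)))))

      antipodeˡ : ∀ a → (m $ S ⊗ᴸ idᴸ $ Δ $ a) ≈ᴹ ((ε $ a) *ₗ 1ᴬ)
      antipodeˡ = P-ext A (S ⋆ idᴸ) ηε λ {n} lam → ≈ᴹ-trans
        (⋆-agree S idᴸ (partialSum (suc n)) idᴸ lam (λ B → m.⟦⟧-cong (T.⊗-cong (S-below (st B lam) (∣p∣≤n B)) ≈ᴹ-refl)))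
        (≈ᴹ-trans (partialSum*i (suc n) (P lam)) (telescope lam))

      antipodeʳ : ∀ a → (m $ idᴸ ⊗ᴸ S $ Δ $ a) ≈ᴹ ((ε $ a) *ₗ 1ᴬ)
      antipodeʳ = P-ext A (idᴸ ⋆ S) ηε λ {n} lam → ≈ᴹ-trans
        (⋆-agree idᴸ S idᴸ (partialSum (suc n)) lam (λ B → m.⟦⟧-cong (T.⊗-cong ≈ᴹ-refl (S-below (st (∁ B) lam) (card-∁≤ B)))))
        (≈ᴹ-trans (i*partialSum (suc n) (P lam)) (telescope lam))

      isHopfAlgebra : IsHopfAlgebra A m 1ᴬ Δ ε
      isHopfAlgebra = record
        { assoc = assoc ; identityˡ = identityˡ ; identityʳ = identityʳ
        ; coassoc = coassoc ; counitˡ = counitˡ ; counitʳ = counitʳ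
        ; Δ-homo = Δ-homo ; Δ-unit = Δ-unit ; ε-homo = ε-homo ; ε-unit = ε-unit
        ; S = S ; antipodeˡ = antipodeˡ ; antipodeʳ = antipodeʳ
        }

-- Product, coproduct and Hopf algebra structure on the superclass functions.

module HopfAlgebraSCᴰ {q : ℕ} (𝔽 : FiniteField q) (R : CommutativeRing 0ℓ 0ℓ)
  (covers : ∀ {n} (x : Group.Uᴰ 𝔽 n) → ∃[ lam ] Group._∈K_ 𝔽 x lam)
  (nonempty : ∀ {n} (lam : Group.DPartition 𝔽 n) → ∃[ x ] Group._∈K_ 𝔽 x lam) where

  open SuperclassFunctions 𝔽 R
  open DPartitionEnumeration 𝔽
  open SuperclassBasis 𝔽 R covers nonempty
  open Restriction 𝔽
  open Tensors R
  open DPartitionBialgebra 𝔽 R SCᴰ P P-cong P-ext unit P∅≈unit counit counit-P-zero counit-P-suc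
    using (coproductSum; coproductSum-cong; P⊗P-ext)
  private
    module S = LeftModule SCᴰ
    A² = SCᴰ ⊗ᴹ SCᴰ

  ≃-refl : ∀ {n} (lam : DPartition n) → lam ≃ lam
  ≃-refl lam i j = refl

  -- The product is extended one argument at a time: here linearly in ν for fixed μ, afterwards
  -- linearly in μ with values in the module of linear maps.
  multiplyBy : ∀ {k} → DPartition k → SCᴰ ⟶ SCᴰ
  multiplyBy mu = fromP SCᴰ (λ nu → P (mu ⊔↑ nu)) λ nu nu′ e →
    P-cong (mu ⊔↑ nu) (mu ⊔↑ nu′) (union-cong {mu = mu} {mu} {nu} {nu′} (≃-refl mu) e)

  multiplyBy-P : ∀ {k l} (mu : DPartition k) (nu : DPartition l) → (multiplyBy mu $ P nu) ≈[ SCᴰ ] P (mu ⊔↑ nu)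
  multiplyBy-P mu = fromP-P SCᴰ (λ nu → P (mu ⊔↑ nu)) λ nu nu′ e →
    P-cong (mu ⊔↑ nu) (mu ⊔↑ nu′) (union-cong {mu = mu} {mu} {nu} {nu′} (≃-refl mu) e)

  multiplyBy-cong : ∀ {k} (mu mu′ : DPartition k) → mu ≃ mu′ → multiplyBy mu ⟶≈ multiplyBy mu′
  multiplyBy-cong mu mu′ e = P-ext SCᴰ (multiplyBy mu) (multiplyBy mu′) λ nu → S.≈ᴹ-trans
    {multiplyBy mu $ P nu} {P (mu ⊔↑ nu)} {multiplyBy mu′ $ P nu} (multiplyBy-P mu nu)
    (S.≈ᴹ-trans {P (mu ⊔↑ nu)} {P (mu′ ⊔↑ nu)} {multiplyBy mu′ $ P nu}
      (P-cong (mu ⊔↑ nu) (mu′ ⊔↑ nu) (union-cong {mu = mu} {mu′} {nu} {nu} e (≃-refl nu)))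
      (S.≈ᴹ-sym {multiplyBy mu′ $ P nu} {P (mu′ ⊔↑ nu)} (multiplyBy-P mu′ nu)))

  product : A² ⟶ SCᴰ
  product = lift {SCᴰ} {SCᴰ} {SCᴰ} (fromP (Hom SCᴰ SCᴰ) multiplyBy multiplyBy-cong)

  product-rule : ProductRule product
  product-rule mu nu = S.≈ᴹ-trans {product $ P mu ⊗ P nu} {multiplyBy mu $ P nu} {P (mu ⊔↑ nu)}
    (fromP-P (Hom SCᴰ SCᴰ) multiplyBy multiplyBy-cong mu (P nu)) (multiplyBy-P mu nu)

  product-unique : ∀ m → ProductRule m → m ⟶≈ product
  product-unique m rule = P⊗P-ext m product λ mu nu →
    S.≈ᴹ-trans {m $ P mu ⊗ P nu} {P (mu ⊔↑ nu)} {product $ P mu ⊗ P nu} (rule mu nu)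
      (S.≈ᴹ-sym {product $ P mu ⊗ P nu} {P (mu ⊔↑ nu)} (product-rule mu nu))

  coproduct : SCᴰ ⟶ A²
  coproduct = fromP A² coproductSum coproductSum-cong

  coproduct-rule : CoproductRule coproduct
  coproduct-rule = fromP-P A² coproductSum coproductSum-cong

  coproduct-unique : ∀ Δ → CoproductRule Δ → Δ ⟶≈ coproduct
  coproduct-unique Δ rule = P-ext A² Δ coproduct λ lam → T.≋-trans (rule lam) (T.≋-sym (coproduct-rule lam))
    where module T = TensorProduct SCᴰ SCᴰ

  isHopfAlgebra : IsHopfAlgebra SCᴰ product unit coproduct counit
  isHopfAlgebra = B.isHopfAlgebra product product-rule coproduct coproduct-rule
    (λ g resp → fromP SCᴰ g resp , fromP-P SCᴰ g resp)
    where module B = DPartitionBialgebra 𝔽 R SCᴰ P P-cong P-ext unit P∅≈unit counit counit-P-zero counit-P-suc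

theorem3p14 : (p r : ℕ) → Prime p → 3 ≤ p → 1 ≤ r → (𝔽 : FiniteField (p ^ r)) →
    let open SuperclassFunctions 𝔽 Complex.ℂ-ring in
    Σ[ m ∈ (SCᴰ ⊗ᴹ SCᴰ ⟶ SCᴰ) ] Σ[ Δ ∈ (SCᴰ ⟶ SCᴰ ⊗ᴹ SCᴰ) ]
    ProductRule m × (∀ m′ → ProductRule m′ → m′ ⟶≈ m) ×
    CoproductRule Δ × (∀ Δ′ → CoproductRule Δ′ → Δ′ ⟶≈ Δ) ×
    IsHopfAlgebra SCᴰ m unit Δ counit
theorem3p14 p r isPrime 3≤p _ 𝔽 =
  product , coproduct , product-rule , product-unique , coproduct-rule , coproduct-unique , isHopfAlgebra
  where
  -- An odd prime makes the order of the field odd, hence 2 invertible.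
  h = Characteristic.half 𝔽 (∤2-prime-power p r isPrime 3≤p)
  open HopfAlgebraSCᴰ 𝔽 Complex.ℂ-ring
    (λ {n} → OrthogonalGroup.K-covers 𝔽 {n} (proj₁ h) (proj₂ h))
    (λ {n} → OrthogonalGroup.K-nonempty 𝔽 {n} (proj₁ h) (proj₂ h))
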